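{- Let $1/2\le\alpha\le 1$, let $n\ge 1$, and let $S$ be a set of $n$ points in $\mathbb{R}^2$ such that no line contains more than $n^{\alpha}$ points of $S$. Then the number of unordered pairs $\{p,q\}\subset S$ such that $|p-q|\in\mathbb{Q}$ and $\{p,q\}$ has rational angle is at most $4n^{1+\alpha}$.
   Context: Identify $\mathbb{R}^2$ with $\mathbb{C}$. A pair of distinct points $p,q$ has rational angle if the segment between them, viewed as the complex number $q-p=re^{\pi i\gamma}$ with $r>0$, has $\gamma\in\mathbb{Q}$; equivalently, the line through $p$ and $q$ makes an angle with the $x$-axis that is a rational multiple of $\pi$. -}

module Defs where

open import Algebra.Bundles using (RawSemiring)
import Algebra.Definitions.RawSemiring as RawSemiringDefs
open import Data.Fin.Base as Fin using (Fin; toℕ)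
open import Data.Integer.Base using (+_)
open import Data.List.Base using (List; length)
open import Data.List.Relation.Unary.All using (All)
open import Data.List.Relation.Unary.Unique.Propositional using (Unique)
open import Data.Nat.Base as ℕ using (ℕ; _⊔_; _!)
import Data.Nat.Properties as ℕ
open import Data.Product.Base using (∃-syntax; _×_; _,_)
open import Data.Rational.Base as ℚ using (ℚ; 0ℚ; 1ℚ; ½; Positive; positive)
import Data.Rational.Properties as ℚ
open import Data.Rational.Solver using (module +-*-Solver)
open import Level using (0ℓ)
open import Relation.Binary.PropositionalEquality
  using (_≡_; refl; sym; trans; cong; cong₂; subst)
open import Relation.Nullary.Negation.Core using (¬_)

-- The reals are Cauchy sequences of rationals under the setoid equality _≈ᴿ_.

IsCauchy : (ℕ → ℚ) → Set
IsCauchy x = ∀ ε → 0ℚ ℚ.< ε →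
  ∃[ N ] ∀ m n → N ℕ.≤ m → N ℕ.≤ n → ℚ.∣ x m ℚ.- x n ∣ ℚ.< ε

record ℝ : Set where
  constructor mkℝ
  field
    seq    : ℕ → ℚ
    cauchy : IsCauchy seq

open ℝ public

infix 4 _≈ᴿ_ _<ᴿ_ _≤ᴿ_

_≈ᴿ_ : ℝ → ℝ → Set
x ≈ᴿ y = ∀ ε → 0ℚ ℚ.< ε →
  ∃[ N ] ∀ n → N ℕ.≤ n → ℚ.∣ seq x n ℚ.- seq y n ∣ ℚ.< ε

_<ᴿ_ : ℝ → ℝ → Set
x <ᴿ y = ∃[ ε ] 0ℚ ℚ.< ε ×
  ∃[ N ] (∀ n → N ℕ.≤ n → seq x n ℚ.+ ε ℚ.< seq y n)

_≤ᴿ_ : ℝ → ℝ → Set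
x ≤ᴿ y = ¬ (y <ᴿ x)

private
  half-pos : ∀ {ε} → 0ℚ ℚ.< ε → 0ℚ ℚ.< ½ ℚ.* ε
  half-pos {ε} 0<ε =
    ℚ.positive⁻¹ _ {{ℚ.pos*pos⇒pos ½ ε {{positive 0<ε}}}}

  halves : ∀ ε → ½ ℚ.* ε ℚ.+ ½ ℚ.* ε ≡ ε
  halves ε = trans (sym (ℚ.*-distribʳ-+ ε ½ ½)) (ℚ.*-identityˡ ε)

  +-isCauchy : ∀ {x y} → IsCauchy x → IsCauchy y → IsCauchy (λ n → x n ℚ.+ y n)
  +-isCauchy {x} {y} cx cy ε 0<ε
    with M , hM ← cx (½ ℚ.* ε) (half-pos 0<ε)
       | N , hN ← cy (½ ℚ.* ε) (half-pos 0<ε)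
    = M ⊔ N , λ m n p q → begin-strict
        ℚ.∣ (x m ℚ.+ y m) ℚ.- (x n ℚ.+ y n) ∣
          ≡⟨ cong ℚ.∣_∣ (solve 4 (λ a b c d →
               (a :+ b) :- (c :+ d) := (a :- c) :+ (b :- d)) refl (x m) (y m) (x n) (y n)) ⟩
        ℚ.∣ (x m ℚ.- x n) ℚ.+ (y m ℚ.- y n) ∣
          ≤⟨ ℚ.∣p+q∣≤∣p∣+∣q∣ (x m ℚ.- x n) (y m ℚ.- y n) ⟩
        ℚ.∣ x m ℚ.- x n ∣ ℚ.+ ℚ.∣ y m ℚ.- y n ∣
          <⟨ ℚ.+-mono-< (hM m n (ℕ.m⊔n≤o⇒m≤o M N p) (ℕ.m⊔n≤o⇒m≤o M N q))
                        (hN m n (ℕ.m⊔n≤o⇒n≤o M N p) (ℕ.m⊔n≤o⇒n≤o M N q)) ⟩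
        ½ ℚ.* ε ℚ.+ ½ ℚ.* ε
          ≡⟨ halves ε ⟩
        ε ∎
    where open ℚ.≤-Reasoning
          open +-*-Solver

  neg-isCauchy : ∀ {x} → IsCauchy x → IsCauchy (λ n → ℚ.- x n)
  neg-isCauchy {x} cx ε 0<ε with N , h ← cx ε 0<ε
    = N , λ m n p q → subst (ℚ._< ε) (eq m n) (h m n p q)
    where
      open +-*-Solver
      eq : ∀ m n → ℚ.∣ x m ℚ.- x n ∣ ≡ ℚ.∣ ℚ.- x m ℚ.- ℚ.- x n ∣
      eq m n = trans (sym (ℚ.∣-p∣≡∣p∣ (x m ℚ.- x n)))
        (cong ℚ.∣_∣ (solve 2 (λ a b → :- (a :- b) := (:- a) :- (:- b)) refl (x m) (x n)))

  eventuallyBounded : ∀ {x} → IsCauchy x →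
    ∃[ B ] Positive B × ∃[ N ] (∀ n → N ℕ.≤ n → ℚ.∣ x n ∣ ℚ.≤ B)
  eventuallyBounded {x} cx with N , h ← cx 1ℚ (ℚ.positive⁻¹ 1ℚ)
    = 1ℚ ℚ.+ ℚ.∣ x N ∣
    , ℚ.pos+nonNeg⇒pos 1ℚ ℚ.∣ x N ∣ {{ℚ.∣-∣-nonNeg (x N)}}
    , N , λ n p → begin
        ℚ.∣ x n ∣
          ≡⟨ cong ℚ.∣_∣ (solve 2 (λ a b → a := (a :- b) :+ b) refl (x n) (x N)) ⟩
        ℚ.∣ (x n ℚ.- x N) ℚ.+ x N ∣
          ≤⟨ ℚ.∣p+q∣≤∣p∣+∣q∣ (x n ℚ.- x N) (x N) ⟩
        ℚ.∣ x n ℚ.- x N ∣ ℚ.+ ℚ.∣ x N ∣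
          ≤⟨ ℚ.+-monoˡ-≤ ℚ.∣ x N ∣ (ℚ.<⇒≤ (h n N p ℕ.≤-refl)) ⟩
        1ℚ ℚ.+ ℚ.∣ x N ∣ ∎
    where open ℚ.≤-Reasoning
          open +-*-Solver

  scale : ∀ B ε → Positive B → 0ℚ ℚ.< ε → ∃[ δ ] 0ℚ ℚ.< δ × B ℚ.* δ ≡ ε
  scale B ε B>0 0<ε = B⁻¹ ℚ.* ε
    , ℚ.positive⁻¹ _ {{ℚ.pos*pos⇒pos B⁻¹ {{ℚ.1/pos⇒pos B}} ε {{positive 0<ε}}}}
    , trans (sym (ℚ.*-assoc B B⁻¹ ε))
        (trans (cong (ℚ._* ε) (ℚ.*-inverseʳ B)) (ℚ.*-identityˡ ε))
    where
      instance
        _ = B>0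
        _ = ℚ.pos⇒nonZero B
      B⁻¹ : ℚ
      B⁻¹ = ℚ.1/ B

  *-bound : ∀ a b A ε → Positive A → ℚ.∣ a ∣ ℚ.≤ A → ℚ.∣ b ∣ ℚ.< ε →
    ℚ.∣ a ℚ.* b ∣ ℚ.< A ℚ.* ε
  *-bound a b A ε A>0 a≤A b<ε = begin-strict
    ℚ.∣ a ℚ.* b ∣         ≡⟨ ℚ.∣p*q∣≡∣p∣*∣q∣ a b ⟩
    ℚ.∣ a ∣ ℚ.* ℚ.∣ b ∣   ≤⟨ ℚ.*-monoʳ-≤-nonNeg ℚ.∣ b ∣ {{ℚ.∣-∣-nonNeg b}} a≤A ⟩
    A ℚ.* ℚ.∣ b ∣         <⟨ ℚ.*-monoʳ-<-pos A {{A>0}} b<ε ⟩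
    A ℚ.* ε               ∎
    where open ℚ.≤-Reasoning

  telescope : ∀ a b c d → a ℚ.* b ℚ.- c ℚ.* d ≡ a ℚ.* (b ℚ.- d) ℚ.+ d ℚ.* (a ℚ.- c)
  telescope = solve 4 (λ a b c d →
    a :* b :- c :* d := a :* (b :- d) :+ d :* (a :- c)) refl
    where open +-*-Solver

  *-difference : ∀ a b c d ε → ℚ.∣ a ℚ.* (b ℚ.- d) ∣ ℚ.< ½ ℚ.* ε →
    ℚ.∣ d ℚ.* (a ℚ.- c) ∣ ℚ.< ½ ℚ.* ε → ℚ.∣ a ℚ.* b ℚ.- c ℚ.* d ∣ ℚ.< ε
  *-difference a b c d ε h k = begin-strict
    ℚ.∣ a ℚ.* b ℚ.- c ℚ.* d ∣                       ≡⟨ cong ℚ.∣_∣ (telescope a b c d) ⟩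
    ℚ.∣ a ℚ.* (b ℚ.- d) ℚ.+ d ℚ.* (a ℚ.- c) ∣       ≤⟨ ℚ.∣p+q∣≤∣p∣+∣q∣ (a ℚ.* (b ℚ.- d)) (d ℚ.* (a ℚ.- c)) ⟩
    ℚ.∣ a ℚ.* (b ℚ.- d) ∣ ℚ.+ ℚ.∣ d ℚ.* (a ℚ.- c) ∣ <⟨ ℚ.+-mono-< h k ⟩
    ½ ℚ.* ε ℚ.+ ½ ℚ.* ε                             ≡⟨ halves ε ⟩
    ε                                               ∎
    where open ℚ.≤-Reasoning

  *-isCauchy : ∀ {x y} → IsCauchy x → IsCauchy y → IsCauchy (λ n → x n ℚ.* y n)
  *-isCauchy {x} {y} cx cy ε 0<ε =
    let A , A>0 , K , hK = eventuallyBounded cx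
        B , B>0 , L , hL = eventuallyBounded cy
        δ , 0<δ , Aδ≡ = scale A (½ ℚ.* ε) A>0 (half-pos 0<ε)
        η , 0<η , Bη≡ = scale B (½ ℚ.* ε) B>0 (half-pos 0<ε)
        M , hM = cy δ 0<δ
        N , hN = cx η 0<η
    in (K ⊔ L) ⊔ (M ⊔ N) , λ m n p q →
      let KL≤m = ℕ.m⊔n≤o⇒m≤o (K ⊔ L) (M ⊔ N) p
          MN≤m = ℕ.m⊔n≤o⇒n≤o (K ⊔ L) (M ⊔ N) p
          KL≤n = ℕ.m⊔n≤o⇒m≤o (K ⊔ L) (M ⊔ N) q
          MN≤n = ℕ.m⊔n≤o⇒n≤o (K ⊔ L) (M ⊔ N) q
      in *-difference (x m) (y m) (x n) (y n) ε
        (subst (ℚ.∣ x m ℚ.* (y m ℚ.- y n) ∣ ℚ.<_) Aδ≡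
          (*-bound (x m) (y m ℚ.- y n) A δ A>0 (hK m (ℕ.m⊔n≤o⇒m≤o K L KL≤m))
            (hM m n (ℕ.m⊔n≤o⇒m≤o M N MN≤m) (ℕ.m⊔n≤o⇒m≤o M N MN≤n))))
        (subst (ℚ.∣ y n ℚ.* (x m ℚ.- x n) ∣ ℚ.<_) Bη≡
          (*-bound (y n) (x m ℚ.- x n) B η B>0 (hL n (ℕ.m⊔n≤o⇒n≤o K L KL≤n))
            (hN m n (ℕ.m⊔n≤o⇒n≤o M N MN≤m) (ℕ.m⊔n≤o⇒n≤o M N MN≤n))))

fromℚ : ℚ → ℝ
fromℚ q = mkℝ (λ _ → q) λ ε 0<ε → 0 , λ _ _ _ _ →
  subst (ℚ._< ε) (sym (cong ℚ.∣_∣ (ℚ.+-inverseʳ q))) 0<ε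

fromℕ : ℕ → ℝ
fromℕ n = fromℚ (+ n ℚ./ 1)

0ᴿ 1ᴿ : ℝ
0ᴿ = fromℚ 0ℚ
1ᴿ = fromℚ 1ℚ

infixl 6 _+ᴿ_ _-ᴿ_
infixl 7 _*ᴿ_
infix  8 -ᴿ_

_+ᴿ_ _*ᴿ_ : ℝ → ℝ → ℝ
x +ᴿ y = mkℝ (λ n → seq x n ℚ.+ seq y n) (+-isCauchy {seq x} {seq y} (cauchy x) (cauchy y))
x *ᴿ y = mkℝ (λ n → seq x n ℚ.* seq y n) (*-isCauchy {seq x} {seq y} (cauchy x) (cauchy y))

-ᴿ_ : ℝ → ℝ
-ᴿ x = mkℝ (λ n → ℚ.- seq x n) (neg-isCauchy {seq x} (cauchy x))

_-ᴿ_ : ℝ → ℝ → ℝ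
x -ᴿ y = x +ᴿ (-ᴿ y)

infix 4 _≈ᶜ_
infixl 6 _+ᶜ_ _-ᶜ_
infixl 7 _*ᶜ_ _·ᶜ_

record ℂ : Set where
  constructor _+i_
  field
    re im : ℝ

open ℂ public

_≈ᶜ_ : ℂ → ℂ → Set
z ≈ᶜ w = re z ≈ᴿ re w × im z ≈ᴿ im w

_+ᶜ_ _-ᶜ_ _*ᶜ_ : ℂ → ℂ → ℂ
z +ᶜ w = (re z +ᴿ re w) +i (im z +ᴿ im w)
z -ᶜ w = (re z -ᴿ re w) +i (im z -ᴿ im w)
z *ᶜ w = (re z *ᴿ re w -ᴿ im z *ᴿ im w) +i (re z *ᴿ im w +ᴿ im z *ᴿ re w)

_·ᶜ_ : ℝ → ℂ → ℂ
r ·ᶜ z = (r *ᴿ re z) +i (r *ᴿ im z)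

normSq : ℂ → ℝ
normSq z = re z *ᴿ re z +ᴿ im z *ᴿ im z

IsModulus : ℂ → ℝ → Set
IsModulus z r = 0ᴿ ≤ᴿ r × r *ᴿ r ≈ᴿ normSq z

ℂ-rawSemiring : RawSemiring 0ℓ 0ℓ
ℂ-rawSemiring = record
  { Carrier = ℂ
  ; _≈_     = _≈ᶜ_
  ; _+_     = _+ᶜ_
  ; _*_     = _*ᶜ_
  ; 0#      = 0ᴿ +i 0ᴿ
  ; 1#      = 1ᴿ +i 0ᴿ
  }

open RawSemiringDefs ℂ-rawSemiring public using (sum) renaming (_^_ to _^ᶜ_)

-- Comparing squares expresses ∣ s n - z ∣ < ε without a square root.
_ConvergesTo_ : (ℕ → ℂ) → ℂ → Set
s ConvergesTo z = ∀ ε → 0ℚ ℚ.< ε →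
  ∃[ N ] ∀ n → N ℕ.≤ n → normSq (s n -ᶜ z) <ᴿ fromℚ (ε ℚ.* ε)

1/_! : ℕ → ℚ
1/ k ! = (+ 1 ℚ./ (k !)) {{k ℕ.!≢0}}

expPartialSum : ℂ → ℕ → ℂ
expPartialSum z n = sum {n} λ k → fromℚ (1/ toℕ k !) ·ᶜ (z ^ᶜ toℕ k)

-- IsExp z w says e^z = w.  Transcendental functions are given by their graphs.
IsExp : ℂ → ℂ → Set
IsExp z w = expPartialSum z ConvergesTo w

-- Euler: e^{it} = cos t + i sin t.
IsSin : ℝ → ℝ → Set
IsSin t s = ∃[ c ] IsExp (0ᴿ +i t) (c +i s)

-- π is the least positive zero of the sine.
IsPi : ℝ → Set
IsPi p = 0ᴿ <ᴿ p × IsSin p 0ᴿ × (∀ t → 0ᴿ <ᴿ t → IsSin t 0ᴿ → p ≤ᴿ t)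

-- IsPower n β y says n^β = y, where n^β = e^{β log n}; here l is log n.
IsPower : ℕ → ℝ → ℝ → Set
IsPower n β y = ∃[ l ] IsExp (l +i 0ᴿ) (fromℕ n +i 0ᴿ) ×
                       IsExp ((β *ᴿ l) +i 0ᴿ) (y +i 0ᴿ)

-- The line a x + b y = c.
record Line : Set where
  field
    a b c         : ℝ
    nondegenerate : ¬ (a ≈ᴿ 0ᴿ × b ≈ᴿ 0ᴿ)

infix 4 _∈ᴸ_

_∈ᴸ_ : ℂ → Line → Set
p ∈ᴸ ℓ = a *ᴿ re p +ᴿ b *ᴿ im p ≈ᴿ c
  where open Line ℓ

HasRationalDistance : ℂ → ℂ → Set
HasRationalDistance p q = ∃[ d ] IsModulus (p -ᶜ q) (fromℚ d)

-- q - p = r e^{π i γ} with r > 0 and γ ∈ ℚ; here u is e^{π i γ}.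
HasRationalAngle : ℂ → ℂ → Set
HasRationalAngle p q =
  ∃[ r ] ∃[ γ ] ∃[ π ] ∃[ u ]
    0ᴿ <ᴿ r × IsPi π × IsExp (0ᴿ +i (π *ᴿ fromℚ γ)) u × q -ᶜ p ≈ᶜ r ·ᶜ u

-- "At most y elements satisfy P".  P need not be decidable, so its extent
-- need not have a cardinality; instead every duplicate-free list of elements
-- satisfying P has length at most y.
AtMost : {A : Set} → ℝ → (A → Set) → Set
AtMost {A} y P = ∀ (xs : List A) → Unique xs → All P xs → fromℕ (length xs) ≤ᴿ y

-- For an injective family S, each unordered pair {S i , S j} of distinct points
-- is represented exactly once, by its indices in increasing order.
RationalPair : ∀ {n} → (Fin n → ℂ) → Fin n × Fin n → Set
RationalPair S (i , j) =
  i Fin.< j × HasRationalDistance (S i) (S j) × HasRationalAngle (S i) (S j)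

{-
Join two points when their distance is rational and their angle is rational.
The difference of two joined points is a positive rational times a root of
unity, because e^{iπ} squares to 1.  Two walks v - p - w and v - p′ - w thus
give a vanishing rational combination of four roots of unity.  By Mann's
theorem either the two walks form a parallelogram or all ratios of the four
roots are sixth roots of unity, so that v and w have at most 2 + 6 * 6 common
neighbours p for which v, p, w are not collinear.  The walks with v, p, w
collinear are few because a line carries at most n^α points.  Comparing with the
Cauchy-Schwarz lower bound for the number of all walks, and using n ≤ n^{2α},
bounds the number of edges.

Mann's theorem rests on conjugation: a relation between N-th roots of unity
survives ω ↦ ω^t for t coprime to N.  Replace t by a number congruent to it
modulo N all of whose prime factors p are large; by the Frobenius congruence
each p divides the conjugated sum in ℤ[ω₁, …, ω_k], and a nonzero element of a
finitely generated torsion-free group is divisible by finitely many integers.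
If N = p M with p² ∣ N or p ≥ 5, four exponents t + j M are coprime to N, and a
Vandermonde argument isolates the roots of order dividing M; descend to N ∣ 6.

Since _≤ᴿ_ is a negation, classical case distinctions are available under ¬ ¬.
-}
module Submission where

open import Defs hiding (sum)
open import Algebra.Bundles using (CommutativeRing)
import Algebra.Properties.CommutativeMonoid.Mult as CMult
import Algebra.Properties.CommutativeSemiring.Binomial as Binomial
import Algebra.Properties.CommutativeSemiring.Exp as CExp
import Algebra.Properties.Ring as RingProperties
import Algebra.Properties.Semiring.Exp as Exp
import Algebra.Properties.Semiring.Mult as Mult
import Algebra.Properties.Semiring.Sum as Sum
import Algebra.Solver.Ring
open import Algebra.Solver.Ring.AlmostCommutativeRing
  using (fromCommutativeRing; _-Raw-AlmostCommutative⟶_)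
open import Data.Empty using (⊥; ⊥-elim)
open import Data.Fin as Fin using (Fin; toℕ; inject₁)
import Data.Fin.Properties as Fin
open import Data.Integer.Base as ℤ using (ℤ; +_; -[1+_]; _⊖_)
import Data.Integer.Properties as ℤ
open import Data.List.Base
  using (List; []; _∷_; map; length; lookup; filter; upTo; allFin; tabulate; cartesianProductWith)
import Data.List.Properties as List
import Data.List.Membership.DecPropositional as DecMembership
import Data.List.Membership.Propositional.Properties as ∈ₚ
import Data.List.Membership.Setoid as Membership
import Data.List.Membership.Setoid.Properties as Membershipₚ
open import Data.List.Relation.Unary.All as All using (All; []; _∷_)
import Data.List.Relation.Unary.All.Properties as Allₚ
open import Data.List.Relation.Unary.Any using (here; there)
open import Data.List.Relation.Unary.Unique.Propositional using (Unique; []; _∷_)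
import Data.List.Relation.Unary.Unique.Propositional.Properties as Uniqueₚ
open import Data.Maybe.Base using (Maybe; just; nothing)
open import Data.Nat.Base as ℕ using (ℕ; suc; zero; _!; NonZero)
open import Data.Nat.Combinatorics using (_C_; nCn≡1; nCk≡n!/k![n-k]!; k![n∸k]!∣n!)
open import Data.Nat.Coprimality using (Coprime; coprime?; coprime-Bézout)
open import Data.Nat.Divisibility
  using (_∣_; _∤_; _∣?_; divides; ∣⇒≤; ∣1⇒≡1; 0∣⇒≡0; ∣-trans; ∣-refl; m∣m*n; n∣m*n; ∣m⇒∣m*n;
    ∣n⇒∣m*n; ∣m∣n⇒∣m+n; ∣m+n∣m⇒∣n)
import Data.Nat.DivMod as ℕ
open import Data.Nat.GCD using (gcd; gcd[m,n]∣m; gcd[m,n]∣n; gcd-greatest; module Bézout)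
open import Data.Nat.Induction using (<-rec)
open import Data.Nat.ListAction using (product)
open import Data.Nat.Primality
  using (Prime; euclidsLemma; prime⇒irreducible; ¬prime[0]; ¬prime[1]; prime⇒nonZero;
    prime⇒nonTrivial)
open import Data.Nat.Primality.Factorisation using (factorise; PrimeFactorisation)
import Data.Nat.Properties as ℕ
open import Data.Nat.Solver as ℕ using ()
open import Data.Product.Base using (∃; ∃-syntax; _×_; _,_; proj₁; proj₂)
open import Data.Product.Properties using (≡-dec)
open import Data.Rational.Base as ℚ using (ℚ; mkℚ; 0ℚ; 1ℚ; ½)
import Data.Rational.Properties as ℚ
open import Data.Rational.Solver as ℚ using ()
import Data.Rational.Unnormalised.Base as ℚᵘ
import Data.Rational.Unnormalised.Properties as ℚᵘ
open import Data.Sum.Base using (_⊎_; inj₁; inj₂) renaming (swap to ⊎-swap)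
open import Function.Base using (_∘_)
open import Function.Definitions using (Injective)
open import Level using (0ℓ)
open import Relation.Binary.Definitions using (Tri; tri<; tri≈; tri>)
open import Relation.Binary.PropositionalEquality as ≡ using (_≡_)
import Relation.Binary.Reasoning.Setoid as SetoidReasoning
open import Relation.Nullary using (¬_; Dec; yes; no; ¬?; _×-dec_; _⊎-dec_)
open import Relation.Nullary.Decidable.Core using (¬¬-excluded-middle)

-- The statement denies `4 n^(1+α) < E`, where `E` is the length of a list of pairs, so that
-- inequality may be assumed, and it keeps real powers out of the counting: `k` points on a line
-- satisfy `4 n k < E`, and `16 n³ < E²` holds. The rest takes place in ℕ. With `D ≥ 2E` the sum of
-- the degrees, the collinear walks number at most `D E / (4n)` and the others at most `38 n²`, so
-- that `4 D² ≤ D E + 152 n³`, hence `14 E² ≤ 152 n³`. This contradicts `16 n³ < E²` because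
-- `152 < 14 · 16`: the constant 4 of the bound has to absorb the 38.
--
-- Two features of the setting decide the form of the rest. Equality of complex numbers is only
-- stable, so the algebra is carried out in domains with stable equality, and conjugation is
-- obtained from divisibility alone, with no minimal polynomials. Exponentials and powers are
-- graphs, so a value such as `e^(y - x)` may not be introduced freely; powers are compared through
-- partial sums with Gaussian rational arguments.

private
  module S = ℚ.+-*-Solver

-- Finitely many double negations can be stripped one after the other; this is how undecidable
-- alternatives are settled for all indices before a counting argument starts.
¬¬-Fin : ∀ {n} {P : Fin n → Set} → (∀ i → ¬ ¬ P i) → ¬ ¬ (∀ i → P i)
¬¬-Fin {zero}  h k = k λ ()
¬¬-Fin {suc n} h k = h Fin.zero λ p → ¬¬-Fin (h ∘ Fin.suc) λ ps →
  k λ { Fin.zero → p ; (Fin.suc i) → ps i }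

-- Ring identities with integer coefficients

module IntegerSolver (R : CommutativeRing 0ℓ 0ℓ) where
  open CommutativeRing R
  open RingProperties ring
  open Mult semiring using (×-homo-+) renaming (_×_ to _•_)
  open SetoidReasoning setoid

  ι : ℤ → Carrier
  ι (+ n)    = n • 1#
  ι -[1+ n ] = - (suc n • 1#)

  ι-⊖ : ∀ m n → ι (m ⊖ n) ≈ m • 1# - n • 1#
  ι-⊖ m zero = begin
    m • 1#        ≈⟨ +-identityʳ _ ⟨
    m • 1# + 0#   ≈⟨ +-congˡ -0#≈0# ⟨
    m • 1# - 0#   ∎
  ι-⊖ zero (suc n) = sym (+-identityˡ _)
  ι-⊖ (suc m) (suc n) = begin
    ι (suc m ⊖ suc n)                 ≡⟨ ≡.cong ι (ℤ.[1+m]⊖[1+n]≡m⊖n m n) ⟩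
    ι (m ⊖ n)                         ≈⟨ ι-⊖ m n ⟩
    m • 1# - n • 1#                   ≈⟨ +-identityˡ _ ⟨
    0# + (m • 1# - n • 1#)            ≈⟨ +-congʳ (-‿inverseʳ 1#) ⟨
    (1# - 1#) + (m • 1# - n • 1#)     ≈⟨ interchange 1# _ _ _ ⟩
    (1# + m • 1#) + (- 1# - n • 1#)   ≈⟨ +-congˡ (⁻¹-∙-comm 1# _) ⟩
    suc m • 1# - suc n • 1#           ∎
    where open import Algebra.Properties.CommutativeSemigroup +-commutativeSemigroup using (interchange)
          open import Algebra.Properties.AbelianGroup +-abelianGroup using (⁻¹-∙-comm)

  ι-neg : ∀ i → ι (ℤ.- i) ≈ - ι i
  ι-neg (+ zero)   = sym -0#≈0#
  ι-neg (+ suc n)  = refl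
  ι-neg (-[1+ n ]) = sym (-‿involutive _)

  ι-+ : ∀ i j → ι (i ℤ.+ j) ≈ ι i + ι j
  ι-+ (+ m) (+ n) = ×-homo-+ 1# m n
  ι-+ (+ m) -[1+ n ] = ι-⊖ m (suc n)
  ι-+ -[1+ m ] (+ n) = trans (ι-⊖ n (suc m)) (+-comm _ _)
  ι-+ -[1+ m ] -[1+ n ] = begin
    - (suc (suc (m ℕ.+ n)) • 1#)        ≡⟨ ≡.cong (λ k → - (suc k • 1#)) (ℕ.+-suc m n) ⟨
    - ((suc m ℕ.+ suc n) • 1#)          ≈⟨ -‿cong (×-homo-+ 1# (suc m) (suc n)) ⟩
    - (suc m • 1# + suc n • 1#)         ≈⟨ ⁻¹-∙-comm _ _ ⟨
    - (suc m • 1#) - suc n • 1#         ∎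
    where open import Algebra.Properties.AbelianGroup +-abelianGroup using (⁻¹-∙-comm)

  ι-+* : ∀ m j → ι (+ m ℤ.* j) ≈ m • 1# * ι j
  ι-+* zero j = trans (reflexive (≡.cong ι (ℤ.*-zeroˡ j))) (sym (zeroˡ _))
  ι-+* (suc m) j = begin
    ι (+ suc m ℤ.* j)         ≡⟨ ≡.cong ι (ℤ.*-distribʳ-+ j (+ 1) (+ m)) ⟩
    ι (+ 1 ℤ.* j ℤ.+ + m ℤ.* j) ≈⟨ ι-+ (+ 1 ℤ.* j) (+ m ℤ.* j) ⟩
    ι (+ 1 ℤ.* j) + ι (+ m ℤ.* j) ≈⟨ +-cong (reflexive (≡.cong ι (ℤ.*-identityˡ j))) (ι-+* m j) ⟩
    ι j + m • 1# * ι j        ≈⟨ +-congʳ (*-identityˡ _) ⟨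
    1# * ι j + m • 1# * ι j   ≈⟨ distribʳ _ _ _ ⟨
    suc m • 1# * ι j          ∎

  ι-* : ∀ i j → ι (i ℤ.* j) ≈ ι i * ι j
  ι-* (+ m) j = ι-+* m j
  ι-* -[1+ m ] j = begin
    ι (-[1+ m ] ℤ.* j)          ≡⟨ ≡.cong ι (ℤ.neg-distribˡ-* (+ suc m) j) ⟨
    ι (ℤ.- (+ suc m ℤ.* j))     ≈⟨ ι-neg (+ suc m ℤ.* j) ⟩
    - ι (+ suc m ℤ.* j)         ≈⟨ -‿cong (ι-+* (suc m) j) ⟩
    - (suc m • 1# * ι j)        ≈⟨ -‿distribˡ-* _ _ ⟩
    - (suc m • 1#) * ι j        ∎

  ι-homomorphism : ℤ.+-*-rawRing -Raw-AlmostCommutative⟶ fromCommutativeRing R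
  ι-homomorphism = record
    { ⟦_⟧ = ι ; +-homo = ι-+ ; *-homo = ι-* ; -‿homo = ι-neg
    ; 0-homo = refl ; 1-homo = +-identityʳ 1# }

  -- Coefficients are compared in ℤ, where equality is decidable, so the solver works in rings whose
  -- own equality is not.
  ι-≟ : ∀ i j → Maybe (ι i ≈ ι j)
  ι-≟ i j with i ℤ.≟ j
  ... | yes ≡.refl = just refl
  ... | no _       = nothing

  open Algebra.Solver.Ring ℤ.+-*-rawRing (fromCommutativeRing R) ι-homomorphism ι-≟ public
    using (solve; con; _:=_; _:+_; _:*_; _:-_; :-_)

-- Divisibility in finitely generated subgroups

-- The absence of zero divisors is phrased as cancellation of a nonzero factor: for Cauchy reals one
-- cannot extract which of two factors vanishes. `stable` replaces decidable equality whenever an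
-- equation is to be proved.
record CharZeroDomain : Set₁ where
  field
    commutativeRing : CommutativeRing 0ℓ 0ℓ
  open CommutativeRing commutativeRing public
  open Mult semiring public using () renaming (_×_ to _•_)
  field
    stable     : ∀ {x y} → ¬ ¬ (x ≈ y) → x ≈ y
    x*y≈0⇒y≈0  : ∀ {x y} → ¬ (x ≈ 0#) → x * y ≈ 0# → y ≈ 0#
    1+n•1≉0    : ∀ n → ¬ (suc n • 1# ≈ 0#)

congruent⇒equal : ∀ p {a b c d} → a ℕ.< p → b ℕ.< p → a ℕ.+ p ℕ.* c ≡ b ℕ.+ p ℕ.* d → a ≡ b
congruent⇒equal p@(suc _) {a} {b} {c} {d} a<p b<p eq = begin
  a                    ≡⟨ ℕ.m<n⇒m%n≡m a<p ⟨
  a ℕ.% p              ≡⟨ ℕ.[m+kn]%n≡m%n a c p ⟨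
  (a ℕ.+ c ℕ.* p) ℕ.% p ≡⟨ ≡.cong (λ x → (a ℕ.+ x) ℕ.% p) (ℕ.*-comm c p) ⟩
  (a ℕ.+ p ℕ.* c) ℕ.% p ≡⟨ ≡.cong (ℕ._% p) eq ⟩
  (b ℕ.+ p ℕ.* d) ℕ.% p ≡⟨ ≡.cong (λ x → (b ℕ.+ x) ℕ.% p) (ℕ.*-comm d p) ⟨
  (b ℕ.+ d ℕ.* p) ℕ.% p ≡⟨ ℕ.[m+kn]%n≡m%n b d p ⟩
  b ℕ.% p              ≡⟨ ℕ.m<n⇒m%n≡m b<p ⟩
  b                    ∎
  where open ≡.≡-Reasoning

module DomainProperties (R : CharZeroDomain) where
  open CharZeroDomain R
  open IntegerSolver commutativeRing
  open RingProperties ring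
  open Mult semiring using (×-congʳ; ×-congˡ; ×-homo-+; ×-assocˡ; ×-assoc-*)
  open CMult +-commutativeMonoid using (×-distrib-+)
  open SetoidReasoning setoid

  x•y≈x1*y : ∀ n x → n • x ≈ n • 1# * x
  x•y≈x1*y n x = begin
    n • x        ≈⟨ ×-congʳ n (*-identityˡ x) ⟨
    n • (1# * x) ≈⟨ ×-assoc-* n 1# x ⟨
    n • 1# * x   ∎

  n•0≈0 : ∀ n → n • 0# ≈ 0#
  n•0≈0 n = trans (x•y≈x1*y n 0#) (zeroʳ _)

  •-neg : ∀ n x → n • (- x) ≈ - (n • x)
  •-neg n x = begin
    n • (- x)        ≈⟨ x•y≈x1*y n (- x) ⟩
    n • 1# * (- x)   ≈⟨ -‿distribʳ-* _ _ ⟨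
    - (n • 1# * x)   ≈⟨ -‿cong (x•y≈x1*y n x) ⟨
    - (n • x)        ∎

  x-y≈0⇒x≈y : ∀ {x y} → x - y ≈ 0# → x ≈ y
  x-y≈0⇒x≈y {x} {y} h = begin
    x         ≈⟨ solve 2 (λ x y → x := (x :- y) :+ y) refl x y ⟩
    x - y + y ≈⟨ +-congʳ h ⟩
    0# + y    ≈⟨ +-identityˡ y ⟩
    y         ∎

  x≈y⇒x-y≈0 : ∀ {x y} → x ≈ y → x - y ≈ 0#
  x≈y⇒x-y≈0 {x} {y} h = trans (+-congʳ h) (-‿inverseʳ y)

  torsionFree : ∀ n {x} → suc n • x ≈ 0# → x ≈ 0#
  torsionFree n {x} eq = x*y≈0⇒y≈0 (1+n•1≉0 n) (trans (sym (x•y≈x1*y (suc n) x)) eq)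

  -- The coefficient of g is the difference of two naturals.
  Span : List Carrier → Carrier → Set
  Span []       x = x ≈ 0#
  Span (g ∷ gs) x = ∃[ a ] ∃[ b ] ∃[ y ] Span gs y × x + b • g ≈ a • g + y

  span-resp : ∀ gs {x y} → x ≈ y → Span gs x → Span gs y
  span-resp []       x≈y s = trans (sym x≈y) s
  span-resp (g ∷ gs) x≈y (a , b , z , s , eq) = a , b , z , s , trans (+-congʳ (sym x≈y)) eq

  span-0 : ∀ gs → Span gs 0#
  span-0 []       = refl
  span-0 (g ∷ gs) = 0 , 0 , 0# , span-0 gs , refl

  span-+ : ∀ gs {x y} → Span gs x → Span gs y → Span gs (x + y)
  span-+ [] s t = trans (+-cong s t) (+-identityʳ 0#)
  span-+ (g ∷ gs) {x} {y} (a , b , z , s , eq) (a′ , b′ , z′ , s′ , eq′) =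
    a ℕ.+ a′ , b ℕ.+ b′ , z + z′ , span-+ gs s s′ , (begin
      x + y + (b ℕ.+ b′) • g           ≈⟨ +-congˡ (×-homo-+ g b b′) ⟩
      x + y + (b • g + b′ • g)         ≈⟨ interchange x y _ _ ⟩
      x + b • g + (y + b′ • g)         ≈⟨ +-cong eq eq′ ⟩
      a • g + z + (a′ • g + z′)        ≈⟨ interchange _ z _ z′ ⟩
      a • g + a′ • g + (z + z′)        ≈⟨ +-congʳ (×-homo-+ g a a′) ⟨
      (a ℕ.+ a′) • g + (z + z′)        ∎)
    where open import Algebra.Properties.CommutativeSemigroup +-commutativeSemigroup using (interchange)

  span-neg : ∀ gs {x} → Span gs x → Span gs (- x)
  span-neg [] s = trans (-‿cong s) -0#≈0#
  span-neg (g ∷ gs) {x} (a , b , z , s , eq) = b , a , - z , span-neg gs s , (begin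
    - x + a • g ≈⟨ solve 4 (λ x a b z → :- x :+ a := (:- (x :+ b) :+ (a :+ z)) :+ (b :- z)) refl x
      (a • g) (b • g) z ⟩
    - (x + b • g) + (a • g + z) + (b • g - z) ≈⟨ +-congʳ (+-congˡ eq) ⟨
    - (x + b • g) + (x + b • g) + (b • g - z) ≈⟨ +-congʳ (-‿inverseˡ _) ⟩
    0# + (b • g - z)            ≈⟨ +-identityˡ _ ⟩
    b • g - z                   ∎)

  span-• : ∀ gs n {x} → Span gs x → Span gs (n • x)
  span-• gs zero    s = span-0 gs
  span-• gs (suc n) s = span-+ gs s (span-• gs n s)

  -- The quotient has to lie in the span: in a field such as ℂ every element is divisible by every
  -- positive integer.
  IndivisibleBeyond : List Carrier → Carrier → ℕ → Set
  IndivisibleBeyond gs γ B = ∀ p → B ℕ.< p → ∀ {β} → Span gs β → ¬ (γ ≈ p • β)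

  -- Either a positive multiple of g lies in the span of the other generators,
  -- or the coefficient of g is unique and must be divisible by p.
  eventuallyIndivisible : ∀ gs {γ} → ¬ (γ ≈ 0#) → ¬ ¬ (∃[ B ] IndivisibleBeyond gs γ B)
  eventuallyIndivisible [] γ≉0 k = k (0 , λ p _ β≈0 γ≈pβ →
    γ≉0 (trans γ≈pβ (trans (×-congʳ p β≈0) (n•0≈0 p))))
  eventuallyIndivisible (g ∷ gs) {γ} γ≉0 k =
    ¬¬-excluded-middle {A = ∃[ e ] Span gs (suc e • g)} λ where
      (yes (e , s)) → eventuallyIndivisible gs (λ eγ≈0 → γ≉0 (torsionFree e eγ≈0)) λ (B , h) →
        k (B , λ p B<p {β} s′ γ≈pβ → h p B<p (dependent e s s′) (begin
          suc e • γ           ≈⟨ ×-congʳ (suc e) γ≈pβ ⟩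
          suc e • (p • β)     ≈⟨ ×-assocˡ β (suc e) p ⟩
          (suc e ℕ.* p) • β   ≈⟨ ×-congˡ (ℕ.*-comm (suc e) p) ⟩
          (p ℕ.* suc e) • β   ≈⟨ ×-assocˡ β p (suc e) ⟨
          p • (suc e • β)     ∎))
      (no indep) → ¬¬-excluded-middle {A = Span (g ∷ gs) γ} λ where
        -- Outside the span any bound will do, for `p • β` lies inside it.
        (no γ∉) → k (0 , λ p _ s γ≈pβ → γ∉ (span-resp (g ∷ gs) (sym γ≈pβ) (span-• (g ∷ gs) p s)))
        (yes (a , b , y , s , eq)) → independent indep a b y s eq
    where
    dependent : ∀ e → Span gs (suc e • g) → ∀ {β} → Span (g ∷ gs) β → Span gs (suc e • β)
    dependent e s {β} (a , b , y , t , eq) = span-resp gs (begin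
      (a • (m • g) + m • y) - b • (m • g)   ≈⟨ +-cong (+-congʳ (swap a)) (-‿cong (swap b)) ⟩
      (m • (a • g) + m • y) - m • (b • g)   ≈⟨ +-congʳ (×-distrib-+ (a • g) y m) ⟨
      m • (a • g + y) - m • (b • g)         ≈⟨ +-congʳ (×-congʳ m eq) ⟨
      m • (β + b • g) - m • (b • g)         ≈⟨ +-congʳ (×-distrib-+ β (b • g) m) ⟩
      (m • β + m • (b • g)) - m • (b • g)
        ≈⟨ solve 2 (λ x y → (x :+ y) :- y := x) refl (m • β) (m • (b • g)) ⟩
      m • β                                 ∎)
      (span-+ gs (span-+ gs (span-• gs a s) (span-• gs m t)) (span-neg gs (span-• gs b s)))
      where
      m : ℕ
      m = suc e
      swap : ∀ c → c • (m • g) ≈ m • (c • g)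
      swap c = trans (×-assocˡ g c m) (trans (×-congˡ (ℕ.*-comm c m)) (sym (×-assocˡ g m c)))

    module _ (indep : ¬ (∃[ e ] Span gs (suc e • g))) where
      -- Two different coefficients would leave a positive multiple of `g` in the span of `gs`,
      -- which `indep` forbids.
      unique-≤ : ∀ {c d y z} → c ℕ.≤ d → Span gs y → Span gs z → c • g + y ≈ d • g + z → c ≡ d
      unique-≤ {c} {d} {y} {z} c≤d s t eq with d ℕ.∸ c in d-c
      ... | zero  = ℕ.≤-antisym c≤d (ℕ.m∸n≡0⇒m≤n d-c)
      ... | suc e = ⊥-elim (indep (e , span-resp gs (begin
        y - z ≈⟨ solve 3 (λ c y z → y :- z := ((c :+ y) :- c) :- z) refl (c • g) y z ⟩
        c • g + y - c • g - z                    ≈⟨ +-congʳ (+-congʳ eq) ⟩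
        d • g + z - c • g - z                    ≈⟨ +-congʳ (+-congʳ (+-congʳ (×-congˡ d≡))) ⟩
        (c ℕ.+ suc e) • g + z - c • g - z ≈⟨ +-congʳ (+-congʳ (+-congʳ (×-homo-+ g c (suc e)))) ⟩
        c • g + suc e • g + z - c • g - z
          ≈⟨ solve 3 (λ c e z → (((c :+ e) :+ z) :- c) :- z := e) refl (c • g) (suc e • g) z ⟩
        suc e • g                                ∎) (span-+ gs s (span-neg gs t))))
        where
        d≡ : d ≡ c ℕ.+ suc e
        d≡ = ≡.trans (≡.sym (ℕ.m+[n∸m]≡n c≤d)) (≡.cong (c ℕ.+_) d-c)

      unique : ∀ c d {y z} → Span gs y → Span gs z → c • g + y ≈ d • g + z → c ≡ d
      unique c d s t eq with ℕ.≤-total c d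
      ... | inj₁ c≤d = unique-≤ c≤d s t eq
      ... | inj₂ d≤c = ≡.sym (unique-≤ d≤c t s (sym eq))

      module _ a b p a′ b′ {y} {β} {y′} (eq : γ + b • g ≈ a • g + y)
               (eq′ : β + b′ • g ≈ a′ • g + y′) (γ≈pβ : γ ≈ p • β) where
        compared : (a ℕ.+ p ℕ.* b′) • g + y ≈ (b ℕ.+ p ℕ.* a′) • g + p • y′
        compared = begin
          (a ℕ.+ p ℕ.* b′) • g + y          ≈⟨ +-congʳ (×-homo-+ g a (p ℕ.* b′)) ⟩
          a • g + (p ℕ.* b′) • g + y ≈⟨ solve 3 (λ a b y → (a :+ b) :+ y := (a :+ y) :+ b) refl
            (a • g) ((p ℕ.* b′) • g) y ⟩
          a • g + y + (p ℕ.* b′) • g ≈⟨ +-cong (trans (sym eq) (+-congʳ γ≈pβ))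
            (sym (×-assocˡ g p b′)) ⟩
          p • β + b • g + p • (b′ • g)
            ≈⟨ solve 3 (λ a b y → (a :+ b) :+ y := b :+ (a :+ y)) refl (p • β) (b • g)
            (p • (b′ • g)) ⟩
          b • g + (p • β + p • (b′ • g))    ≈⟨ +-congˡ (×-distrib-+ β (b′ • g) p) ⟨
          b • g + p • (β + b′ • g)          ≈⟨ +-congˡ (×-congʳ p eq′) ⟩
          b • g + p • (a′ • g + y′)         ≈⟨ +-congˡ (×-distrib-+ (a′ • g) y′ p) ⟩
          b • g + (p • (a′ • g) + p • y′)   ≈⟨ +-assoc _ _ _ ⟨
          b • g + p • (a′ • g) + p • y′     ≈⟨ +-congʳ (+-congˡ (×-assocˡ g p a′)) ⟩
          b • g + (p ℕ.* a′) • g + p • y′   ≈⟨ +-congʳ (×-homo-+ g b (p ℕ.* a′)) ⟨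
          (b ℕ.+ p ℕ.* a′) • g + p • y′     ∎

      independent : ∀ a b y → Span gs y → γ + b • g ≈ a • g + y → ⊥
      independent a b y s eq with a ℕ.≟ b
      ... | yes ≡.refl = eventuallyIndivisible gs (λ y≈0 → γ≉0 (trans γ≈y y≈0)) λ (B , h) →
        k (B , λ p B<p {β} (a′ , b′ , y′ , s′ , eq′) γ≈pβ →
          let cmp = compared a b p a′ b′ eq eq′ γ≈pβ
              coeffs = unique (a ℕ.+ p ℕ.* b′) (b ℕ.+ p ℕ.* a′) s (span-• gs p s′) cmp
          in h p B<p s′ (+-cancelˡ _ _ _ (trans cmp (+-congʳ (×-congˡ (≡.sym coeffs))))))
        where
        γ≈y : γ ≈ y
        γ≈y = +-cancelˡ (a • g) _ _ (trans (+-comm _ _) eq)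
      -- The coefficients give `a + p * b′ ≡ b + p * a′`; once `p` exceeds `a + b`, congruence of
      -- `a` and `b` modulo `p` means equality.
      ... | no a≢b = k (a ℕ.+ b , λ p B<p {β} (a′ , b′ , y′ , s′ , eq′) γ≈pβ →
        a≢b (congruent⇒equal p (ℕ.≤-<-trans (ℕ.m≤m+n a b) B<p) (ℕ.≤-<-trans (ℕ.m≤n+m b a) B<p)
          (unique (a ℕ.+ p ℕ.* b′) (b ℕ.+ p ℕ.* a′) s (span-• gs p s′)
            (compared a b p a′ b′ eq eq′ γ≈pβ))))

-- Elementary number theory

module NumberTheory where
  open import Data.Nat.Base using (_+_; _*_; _∸_; _≤_; _<_; z≤n; s≤s; z<s; _!)
  open import Data.Nat.Properties
  open ≡ using (refl; sym; trans; cong; subst; module ≡-Reasoning)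

  ∣m+n∣n⇒∣m : ∀ {d m n} → d ∣ m + n → d ∣ n → d ∣ m
  ∣m+n∣n⇒∣m {d} {m} {n} h = ∣m+n∣m⇒∣n (subst (d ∣_) (+-comm m n) h)

  prime∤! : ∀ {p} m → Prime p → m < p → p ∤ m !
  prime∤! zero pr m<p p∣1 = ¬prime[1] (subst Prime (∣1⇒≡1 p∣1) pr)
  prime∤! (suc m) pr m<p p∣ with euclidsLemma (suc m) (m !) pr p∣
  ... | inj₁ p∣1+m = <⇒≱ m<p (∣⇒≤ p∣1+m)
  ... | inj₂ p∣m!  = prime∤! m pr (<-trans (n<1+n m) m<p) p∣m!

  -- The prime divides `p !`, which is `p C k` times two smaller factorials, and it divides neither
  -- of these.
  prime∣choose : ∀ {p k} → Prime p → 0 < k → k < p → p ∣ p C k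
  prime∣choose {p@(suc p-1)} {k@(suc k-1)} pr 0<k k<p with euclidsLemma (p C k)
    (k ! * (p ∸ k) !) pr p∣
    where
    instance
      _ = (k) !* (p ∸ k) !≢0
    p∣ : p ∣ (p C k) * (k ! * (p ∸ k) !)
    p∣ = subst (p ∣_) (sym (trans (cong (_* (k ! * (p ∸ k) !)) (nCk≡n!/k![n-k]! (<⇒≤ k<p)))
      (ℕ.m/n*n≡m (k![n∸k]!∣n! (<⇒≤ k<p))))) (m∣m*n (p-1 !))
  ... | inj₁ h = h
  ... | inj₂ h with euclidsLemma (k !) ((p ∸ k) !) pr h
  ...   | inj₁ h₁ = ⊥-elim (prime∤! k pr k<p h₁)
  ...   | inj₂ h₂ = ⊥-elim (prime∤! (p ∸ k) pr (s≤s (m∸n≤m p-1 k-1)) h₂)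

  prime∤⇒coprime : ∀ {p t} → Prime p → p ∤ t → Coprime p t
  prime∤⇒coprime pr p∤t (d∣p , d∣t) with prime⇒irreducible pr d∣p
  ... | inj₁ d≡1 = d≡1
  ... | inj₂ refl = ⊥-elim (p∤t d∣t)

  -- With such an `s`, a prime up to `B` divides exactly one of `t` and `s`. If moreover `t` is
  -- coprime to `N`, it divides exactly one of `t` and `N * s`, hence not their sum. The witness is
  -- the product of the numbers up to `B` that are coprime to `t`.
  coprimePart : ∀ t B → ∃[ s ] (∀ {q} → Prime q → q ≤ B → q ∤ t → q ∣ s) ×
    (∀ {q} → Prime q → q ∣ s → q ∤ t)
  coprimePart t zero = 1 , (λ { pr z≤n _ → ⊥-elim (¬prime[0] pr) }) , λ pr q∣1 _ →
    ¬prime[1] (subst Prime (∣1⇒≡1 q∣1) pr)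
  coprimePart t (suc B) with coprimePart t B | coprime? (suc B) t
  ... | s , f , g | yes c = suc B * s , f′ , g′
    where
    f′ : ∀ {q} → Prime q → q ≤ suc B → q ∤ t → q ∣ suc B * s
    f′ pr q≤ q∤t with m≤n⇒m<n∨m≡n q≤
    ... | inj₁ (s≤s q≤B) = ∣n⇒∣m*n (suc B) (f pr q≤B q∤t)
    ... | inj₂ refl = m∣m*n s
    g′ : ∀ {q} → Prime q → q ∣ suc B * s → q ∤ t
    g′ pr q∣ q∣t with euclidsLemma (suc B) s pr q∣
    ... | inj₁ h = ¬prime[1] (subst Prime (c (h , q∣t)) pr)
    ... | inj₂ h = g pr h q∣t
  ... | s , f , g | no ¬c = s , f′ , g
    where
    f′ : ∀ {q} → Prime q → q ≤ suc B → q ∤ t → q ∣ s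
    f′ pr q≤ q∤t with m≤n⇒m<n∨m≡n q≤
    ... | inj₁ (s≤s q≤B) = f pr q≤B q∤t
    ... | inj₂ refl = ⊥-elim (¬c (prime∤⇒coprime pr q∤t))

  -- Cheap substitute for Dirichlet's theorem on primes in progressions.
  avoidSmallPrimes : ∀ {t N} → Coprime t N → ∀ B → ∃[ s ] ∀ {q} → Prime q → q ∣ t + N * s → B < q
  avoidSmallPrimes {t} {N} c B with coprimePart t B
  ... | s , f , g = s , λ {q} pr q∣ → ≰⇒> λ q≤B → small pr q≤B q∣
    where
    small : ∀ {q} → Prime q → q ≤ B → q ∤ t + N * s
    small {q} pr q≤B q∣ with q ∣? t
    ... | no q∤t = q∤t (∣m+n∣n⇒∣m q∣ (∣n⇒∣m*n N (f pr q≤B q∤t)))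
    ... | yes q∣t with euclidsLemma N s pr (∣m+n∣m⇒∣n q∣ q∣t)
    ...   | inj₁ q∣N = ¬prime[1] (subst Prime (c (q∣t , q∣N)) pr)
    ...   | inj₂ q∣s = g pr q∣s q∣t

  primeDivisor : ∀ n → 1 < n → ∃[ p ] Prime p × p ∣ n
  primeDivisor n@(suc _) 1<n with factorise n
  ... | record { factors = [] ; isFactorisation = eq } = ⊥-elim (<-irrefl (sym eq) 1<n)
  ... | record { factors = p ∷ ps ; isFactorisation = eq ; factorsPrime = pr ∷ _ } =
    p , pr , subst (p ∣_) (sym eq) (m∣m*n _)

  noPrimeDivisor⇒coprime : ∀ {m n} → 0 < n → (∀ {q} → Prime q → q ∣ m → q ∤ n) → Coprime m n
  noPrimeDivisor⇒coprime {m} {n} 0<n h {d} (d∣m , d∣n) with d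
  ... | zero  = ⊥-elim (<-irrefl (sym (0∣⇒≡0 d∣n)) 0<n)
  ... | suc zero = refl
  ... | suc (suc e) = let q , pr , q∣d = primeDivisor _ (s≤s z<s) in ⊥-elim (h pr (∣-trans q∣d d∣m) (∣-trans q∣d d∣n))

  cofactor : ∀ {N g} p k k′ → N ≡ k * g → k ≡ k′ * p → N ≡ p * (k′ * g)
  cofactor {N} {g} p k k′ N≡ k≡ = begin
    N               ≡⟨ N≡ ⟩
    k * g           ≡⟨ cong (_* g) (trans k≡ (*-comm k′ p)) ⟩
    p * k′ * g      ≡⟨ *-assoc p k′ g ⟩
    p * (k′ * g)    ∎
    where open ≡-Reasoning

  -- The prime is taken from the quotient of `N` by `gcd N 6`. If it divides 6, it divides the gcd
  -- as well, and the gcd is a factor of `M`.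
  primeStep : ∀ N → 0 < N → N ∣ 6 ⊎ (∃[ p ] ∃[ M ] Prime p × N ≡ p * M × (p ∣ M ⊎ p ∤ 6))
  primeStep N 0<N with gcd[m,n]∣m N 6 | gcd[m,n]∣n N 6
  ... | divides zero eq | _ = ⊥-elim (<-irrefl (sym eq) 0<N)
  ... | divides 1 eq | g∣6 = inj₁ (subst (_∣ 6) (sym (trans eq (*-identityˡ _))) g∣6)
  ... | divides k@(suc (suc _)) eq | _ with primeDivisor k (s≤s z<s)
  ...   | p , pr , divides k′ k≡ with p ∣? 6
  ...     | no p∤6  = inj₂ (p , k′ * gcd N 6 , pr , cofactor {N} {gcd N 6} p k k′ eq k≡ , inj₂ p∤6)
  ...     | yes p∣6 = inj₂ (p , k′ * gcd N 6 , pr , cofactor {N} {gcd N 6} p k k′ eq k≡ ,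
    inj₁ (∣n⇒∣m*n k′ (gcd-greatest
      (subst (p ∣_) (sym (cofactor {N} {gcd N 6} p k k′ eq k≡)) (m∣m*n _)) p∣6)))

  ∣12 : ∀ j → j < 4 → suc j ∣ 12
  ∣12 0 _ = divides 12 refl
  ∣12 1 _ = divides 6 refl
  ∣12 2 _ = divides 4 refl
  ∣12 3 _ = divides 3 refl
  ∣12 (suc (suc (suc (suc _)))) (s≤s (s≤s (s≤s (s≤s ()))))

  -- Four exponents that agree modulo `M`: enough to eliminate three terms in `sixthRoots`.
  fourUnits : ∀ {p M} → Prime p → 0 < p * M → p ∣ M ⊎ p ∤ 6 →
    ∃[ t ] ∀ j → j < 4 → Coprime (t + j * M) (p * M)
  fourUnits {p} {M} pr 0<pM h with p ∣? M | h
  -- Every prime factor of `p * M` divides `M` here, hence not `1 + j * M`.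
  ... | yes p∣M | _ = 1 , λ j _ → noPrimeDivisor⇒coprime 0<pM λ {q} qr q∣ q∣pM →
    ¬prime[1] (subst Prime (∣1⇒≡1 (∣m+n∣n⇒∣m q∣ (∣n⇒∣m*n j (q∣M qr q∣pM)))) qr)
    where
    q∣M : ∀ {q} → Prime q → q ∣ p * M → q ∣ M
    q∣M qr q∣pM with euclidsLemma p M qr q∣pM
    ... | inj₁ q∣p = ∣-trans q∣p p∣M
    ... | inj₂ q∣M = q∣M
  ... | no p∤M | inj₁ p∣M = ⊥-elim (p∤M p∣M)
  -- Starting at `p + M` produces the numbers `p + suc j * M`. A prime factor of `M` differs from
  -- `p`, so it divides only the second summand; `p` divides only the first, because `suc j` divides
  -- 12 and `p` does not.
  ... | no p∤M | inj₂ p∤6 = p + M , λ j j<4 → noPrimeDivisor⇒coprime 0<pM λ {q} qr q∣ q∣pM →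
    bad j j<4 qr (subst (q ∣_) (+-assoc p M (j * M)) q∣) q∣pM
    where
    p∤1+j : ∀ j → j < 4 → p ∤ suc j
    p∤1+j j j<4 p∣1+j with euclidsLemma 2 6 pr (∣-trans p∣1+j (∣12 j j<4))
    ... | inj₁ p∣2 = p∤6 (∣m⇒∣m*n 3 p∣2)
    ... | inj₂ p∣6 = p∤6 p∣6
    p∤ : ∀ j → j < 4 → p ∤ suc j * M
    p∤ j j<4 p∣ with euclidsLemma (suc j) M pr p∣
    ... | inj₁ x = p∤1+j j j<4 x
    ... | inj₂ x = p∤M x
    bad : ∀ j → j < 4 → ∀ {q} → Prime q → q ∣ p + suc j * M → q ∤ p * M
    bad j j<4 {q} qr q∣ q∣pM with q ≟ p
    ... | yes refl = p∤ j j<4 (∣m+n∣m⇒∣n q∣ ∣-refl)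
    ... | no q≢p with euclidsLemma p M qr q∣pM
    ...   | inj₁ q∣p with prime⇒irreducible pr q∣p
    ...     | inj₁ refl = ¬prime[1] qr
    ...     | inj₂ q≡p = q≢p q≡p
    bad j j<4 {q} qr q∣ q∣pM | no q≢p | inj₂ q∣M with prime⇒irreducible pr
      (∣m+n∣n⇒∣m q∣ (∣n⇒∣m*n (suc j) q∣M))
    ... | inj₁ refl = ¬prime[1] qr
    ... | inj₂ q≡p = q≢p q≡p

open NumberTheory

-- Conjugation of relations between roots of unity

module Galois (R : CharZeroDomain) where
  open CharZeroDomain R
  open IntegerSolver commutativeRing
  open DomainProperties R
  open RingProperties ring
  open Mult semiring using (×-congʳ; ×-congˡ; ×-assocˡ)
  open CMult +-commutativeMonoid using (×-distrib-+)
  open Exp semiring using (_^_; ^-congˡ; ^-congʳ; ^-homo-*; ^-assocʳ)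
  open Sum semiring using (sum; sum-init-last)
  open Binomial commutativeSemiring using (binomialTerm; theorem)
  open SetoidReasoning setoid
  open Membership setoid using (_∈_)

  1^n≈1 : ∀ n → 1# ^ n ≈ 1#
  1^n≈1 zero    = refl
  1^n≈1 (suc n) = trans (*-identityˡ _) (1^n≈1 n)

  0^n≈0 : ∀ n → NonZero n → 0# ^ n ≈ 0#
  0^n≈0 (suc n) _ = zeroˡ _

  ^-root : ∀ {ω N} → ω ^ N ≈ 1# → ∀ k → ω ^ (k ℕ.* N) ≈ 1#
  ^-root {ω} {N} h k = begin
    ω ^ (k ℕ.* N) ≡⟨ ≡.cong (ω ^_) (ℕ.*-comm k N) ⟩
    ω ^ (N ℕ.* k) ≈⟨ ^-assocʳ ω N k ⟨
    (ω ^ N) ^ k   ≈⟨ ^-congˡ k h ⟩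
    1# ^ k        ≈⟨ 1^n≈1 k ⟩
    1#            ∎

  ^-periodic : ∀ {ω N} → ω ^ N ≈ 1# → ∀ a k → ω ^ (a ℕ.+ k ℕ.* N) ≈ ω ^ a
  ^-periodic {ω} {N} h a k = begin
    ω ^ (a ℕ.+ k ℕ.* N)     ≈⟨ ^-homo-* ω a (k ℕ.* N) ⟩
    ω ^ a * ω ^ (k ℕ.* N)   ≈⟨ *-congˡ (^-root h k) ⟩
    ω ^ a * 1#              ≈⟨ *-identityʳ _ ⟩
    ω ^ a                   ∎

  ^-mod : ∀ {ω N} .{{_ : NonZero N}} → ω ^ N ≈ 1# → ∀ a → ω ^ a ≈ ω ^ (a ℕ.% N)
  ^-mod {ω} {N} h a = begin
    ω ^ a                             ≡⟨ ≡.cong (ω ^_) (ℕ.m≡m%n+[m/n]*n a N) ⟩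
    ω ^ (a ℕ.% N ℕ.+ a ℕ./ N ℕ.* N)   ≈⟨ ^-periodic h (a ℕ.% N) (a ℕ./ N) ⟩
    ω ^ (a ℕ.% N)                     ∎

  record Subring (V : Carrier → Set) : Set where
    field
      resp : ∀ {x y} → x ≈ y → V x → V y
      ∈-0  : V 0#
      ∈-1  : V 1#
      ∈-+  : ∀ {x y} → V x → V y → V (x + y)
      ∈-*  : ∀ {x y} → V x → V y → V (x * y)
      ∈--  : ∀ {x} → V x → V (- x)

    ∈-• : ∀ n {x} → V x → V (n • x)
    ∈-• zero    v = ∈-0
    ∈-• (suc n) v = ∈-+ v (∈-• n v)

    ∈-^ : ∀ n {x} → V x → V (x ^ n)
    ∈-^ zero    v = ∈-1
    ∈-^ (suc n) v = ∈-* v (∈-^ n v)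

    -- The congruence `x ^ p ≡ y` modulo `p V`. Membership of `x` in `V` travels along because
    -- `freshman` asks for it when congruences are added.
    Frob : ℕ → Carrier → Carrier → Set
    Frob p x y = V x × ∃[ β ] V β × x ^ p ≈ y + p • β

    module _ {p} (pr : Prime p) where
      middle : ∀ {n} (f : Fin n → Carrier) → (∀ i → ∃[ β ] V β × f i ≈ p • β) →
        ∃[ β ] V β × sum f ≈ p • β
      middle {zero}  f h = 0# , ∈-0 , sym (n•0≈0 p)
      middle {suc n} f h with h Fin.zero | middle (λ i → f (Fin.suc i)) (λ i → h (Fin.suc i))
      ... | β , v , eq | γ , w , eq′ = β + γ , ∈-+ v w , trans (+-cong eq eq′)
        (sym (×-distrib-+ β γ p))

      -- The inner binomial coefficients are multiples of `p`, so the inner terms add up to `p`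
      -- times an element of `V`. The auxiliary `expand` exposes `p` as a successor, so that the
      -- last term can be split off.
      freshman : ∀ {x y} → V x → V y → ∃[ β ] V β × (x + y) ^ p ≈ x ^ p + y ^ p + p • β
      freshman {x} {y} vx vy = expand p ≡.refl
        where
        binomial-∈ : ∀ n k → V (x ^ k * y ^ (n ℕ.∸ k))
        binomial-∈ n k = ∈-* (∈-^ k vx) (∈-^ (n ℕ.∸ k) vy)

        multiple : ∀ k → 0 ℕ.< k → k ℕ.< p → ∃[ β ] V β × (p C k) • (x ^ k * y ^ (p ℕ.∸ k)) ≈ p • β
        multiple k 0<k k<p with prime∣choose pr 0<k k<p
        ... | divides q eq = q • (x ^ k * y ^ (p ℕ.∸ k)) , ∈-• q (binomial-∈ p k) ,
          trans (×-congˡ (≡.trans eq (ℕ.*-comm q p))) (sym (×-assocˡ _ p q))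

        expand : ∀ n → n ≡ p → ∃[ β ] V β × (x + y) ^ p ≈ x ^ p + y ^ p + p • β
        expand zero ≡.refl = ⊥-elim (¬prime[0] pr)
        expand (suc n) ≡.refl with middle (λ i → binomialTerm x y p (Fin.suc (inject₁ i)))
            (λ i → multiple (toℕ (Fin.suc (inject₁ i))) ℕ.z<s
              (ℕ.s<s (≡.subst (ℕ._< n) (≡.sym (Fin.toℕ-inject₁ i)) (Fin.toℕ<n i))))
        ... | β , v , eq = β , v , (begin
          (x + y) ^ p                                              ≈⟨ theorem p x y ⟩
          t Fin.zero + sum (λ i → t (Fin.suc i))
            ≈⟨ +-cong first (sum-init-last {n} (λ i → t (Fin.suc i))) ⟩
          y ^ p + (sum (λ i → t (Fin.suc (inject₁ i))) + t (Fin.suc (Fin.fromℕ n)))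
            ≈⟨ +-congˡ (+-cong eq final) ⟩
          y ^ p + (p • β + x ^ p) ≈⟨ solve 3 (λ a b c → a :+ (b :+ c) := c :+ a :+ b) refl (y ^ p)
            (p • β) (x ^ p) ⟩
          x ^ p + y ^ p + p • β                                    ∎)
          where
          t : Fin (suc p) → Carrier
          t = binomialTerm x y p
          first : t Fin.zero ≈ y ^ p
          first = trans (+-identityʳ _) (*-identityˡ _)
          final : t (Fin.suc (Fin.fromℕ n)) ≈ x ^ p
          final = begin
            (p C suc (toℕ (Fin.fromℕ n))) •
              (x ^ suc (toℕ (Fin.fromℕ n)) * y ^ (n ℕ.∸ toℕ (Fin.fromℕ n)))
              ≡⟨ ≡.cong (λ k → (p C suc k) • (x ^ suc k * y ^ (n ℕ.∸ k))) (Fin.toℕ-fromℕ n) ⟩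
            (p C p) • (x ^ p * y ^ (n ℕ.∸ n))
              ≡⟨ ≡.cong₂ (λ c k → c • (x ^ p * y ^ k)) (nCn≡1 p) (ℕ.n∸n≡0 n) ⟩
            1 • (x ^ p * 1#)
              ≈⟨ trans (+-identityʳ _) (*-identityʳ _) ⟩
            x ^ p ∎

      frob-+ : ∀ {x y x′ y′} → Frob p x y → Frob p x′ y′ → Frob p (x + x′) (y + y′)
      frob-+ {x} {y} {x′} {y′} (vx , β , vβ , eq) (vx′ , β′ , vβ′ , eq′) with freshman vx vx′
      ... | γ , vγ , e = ∈-+ vx vx′ , β + β′ + γ , ∈-+ (∈-+ vβ vβ′) vγ , (begin
        (x + x′) ^ p                               ≈⟨ e ⟩
        x ^ p + x′ ^ p + p • γ                     ≈⟨ +-congʳ (+-cong eq eq′) ⟩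
        y + p • β + (y′ + p • β′) + p • γ
          ≈⟨ solve 5 (λ y b y′ b′ g → y :+ b :+ (y′ :+ b′) :+ g := y :+ y′ :+ (b :+ b′ :+ g)) refl y
          (p • β) y′ (p • β′) (p • γ) ⟩
        y + y′ + (p • β + p • β′ + p • γ)          ≈⟨ +-congˡ (+-congʳ (×-distrib-+ β β′ p)) ⟨
        y + y′ + (p • (β + β′) + p • γ)            ≈⟨ +-congˡ (×-distrib-+ (β + β′) γ p) ⟨
        y + y′ + p • (β + β′ + γ)                  ∎)

      frob-0 : Frob p 0# 0#
      frob-0 = ∈-0 , 0# , ∈-0 , (begin
        0# ^ p         ≈⟨ 0^n≈0 p (prime⇒nonZero pr) ⟩
        0#             ≈⟨ +-identityˡ 0# ⟨
        0# + 0#        ≈⟨ +-congˡ (n•0≈0 p) ⟨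
        0# + p • 0#    ∎)

      -- This contains Fermat's little theorem for the coefficient `m`: a multiple is a repeated
      -- sum, and the congruence is additive.
      frob-• : ∀ m {x y} → Frob p x y → Frob p (m • x) (m • y)
      frob-• zero    f = frob-0
      frob-• (suc m) f = frob-+ f (frob-• m f)

      frob-^ : ∀ {x} → V x → Frob p x (x ^ p)
      frob-^ {x} v = v , 0# , ∈-0 , sym (trans (+-congˡ (n•0≈0 p)) (+-identityʳ _))

  -- Closure under products turns the additive span of `gs` into a ring that is still finitely
  -- generated as a group, as `eventuallyIndivisible` requires.
  record FiniteMonoid (gs : List Carrier) : Set where
    field
      one∈ : 1# ∈ gs
      mul∈ : ∀ {g h} → g ∈ gs → h ∈ gs → g * h ∈ gs

  span-∈ : ∀ {gs g} → g ∈ gs → Span gs g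
  span-∈ {h ∷ gs} {g} (here g≈h) = 1 , 0 , 0# , span-0 gs , (begin
    g + 0#            ≈⟨ +-congʳ (trans g≈h (sym (+-identityʳ h))) ⟩
    1 • h + 0#        ∎)
  span-∈ {h ∷ gs} {g} (there g∈) = 0 , 0 , g , span-∈ g∈ , +-comm g 0#

  span-⊆ : ∀ {gs} {P : Carrier → Set} → (∀ {x y} → x ≈ y → P x → P y) → P 0# →
    (∀ {x y} → P x → P y → P (x + y)) → (∀ {x} → P x → P (- x)) → All P gs → ∀ {x} → Span gs x → P x
  span-⊆ resp p0 p+ p- [] s = resp (sym s) p0
  span-⊆ {g ∷ gs} {P} resp p0 p+ p- (pg ∷ pgs) {x} (a , b , y , s , eq) =
    resp (trans (+-congʳ (sym eq)) (solve 2 (λ x y → (x :+ y) :- y := x) refl x (b • g)))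
      (p+ (p+ (p• a) (span-⊆ resp p0 p+ p- pgs s)) (p- (p• b)))
    where
    p• : ∀ n → P (n • g)
    p• zero    = p0
    p• (suc n) = p+ pg (p• n)

  -- By additivity in each factor separately, a product of integer combinations reduces to products
  -- of generators, which `mul∈` covers.
  span-subring : ∀ {gs} → FiniteMonoid gs → Subring (Span gs)
  span-subring {gs} fm = record
    { resp = span-resp gs
    ; ∈-0  = span-0 gs
    ; ∈-1  = span-∈ one∈
    ; ∈-+  = span-+ gs
    ; ∈-*  = λ {x} {y} s t → span-⊆ {P = λ x → Span gs (x * y)}
               (λ e → span-resp gs (*-congʳ e))
               (span-resp gs (sym (zeroˡ y)) (span-0 gs))
               (λ s s′ → span-resp gs (sym (distribʳ y _ _)) (span-+ gs s s′))
               (λ s → span-resp gs (-‿distribˡ-* _ y) (span-neg gs s))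
               (All.tabulateₛ setoid λ {g} g∈ → span-⊆ {P = λ y → Span gs (g * y)}
                 (λ e → span-resp gs (*-congˡ e))
                 (span-resp gs (sym (zeroʳ _)) (span-0 gs))
                 (λ s s′ → span-resp gs (sym (distribˡ _ _ _)) (span-+ gs s s′))
                 (λ s → span-resp gs (-‿distribʳ-* _ _) (span-neg gs s))
                 (All.tabulateₛ setoid λ h∈ → span-∈ (mul∈ g∈ h∈)) t)
               s
    ; ∈--  = span-neg gs
    }
    where open FiniteMonoid fm

  powers : ℕ → Carrier → List Carrier
  powers N ω = map (ω ^_) (upTo N)

  -- If each `ω` satisfies `ω ^ N ≈ 1#`, exponents below `N` suffice for closure under products; the
  -- span is then the ring ℤ[ω₁, ..., ω_k].
  monomials : ℕ → List Carrier → List Carrier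
  monomials N []       = 1# ∷ []
  monomials N (ω ∷ ωs) = cartesianProductWith _*_ (powers N ω) (monomials N ωs)

  module _ {N} .{{_ : NonZero N}} where
    power∈ : ∀ {ω} → ω ^ N ≈ 1# → ∀ a → ω ^ a ∈ powers N ω
    power∈ {ω} h a = Membershipₚ.∈-resp-≈ setoid (sym (^-mod h a))
      (Membershipₚ.∈-map⁺ (≡.setoid ℕ) setoid (λ { ≡.refl → refl }) (∈ₚ.∈-upTo⁺ (ℕ.m%n<n a N)))

    power-mul∈ : ∀ {ω} → ω ^ N ≈ 1# → ∀ {x y} → x ∈ powers N ω → y ∈ powers N ω → x * y ∈ powers N ω
    power-mul∈ {ω} h x∈ y∈ with Membershipₚ.∈-map⁻ (≡.setoid ℕ) setoid x∈ | Membershipₚ.∈-map⁻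
      (≡.setoid ℕ) setoid y∈
    ... | a , _ , x≈ | b , _ , y≈ = Membershipₚ.∈-resp-≈ setoid
      (trans (^-homo-* ω a b) (sym (*-cong x≈ y≈))) (power∈ h (a ℕ.+ b))

    product∈ : ∀ {xs ys a b} → a ∈ xs → b ∈ ys → a * b ∈ cartesianProductWith _*_ xs ys
    product∈ = Membershipₚ.∈-cartesianProductWith⁺ setoid setoid setoid *-cong

    monomials-monoid : ∀ ωs → All (λ ω → ω ^ N ≈ 1#) ωs → FiniteMonoid (monomials N ωs)
    monomials-monoid [] [] = record
      { one∈ = here refl
      ; mul∈ = λ { (here g≈1) (here h≈1) → here (trans (*-cong g≈1 h≈1) (*-identityʳ 1#)) } }
    monomials-monoid (ω ∷ ωs) (h ∷ hs) = record
      { one∈ = Membershipₚ.∈-resp-≈ setoid (*-identityʳ 1#) (product∈ (power∈ h 0) one∈)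
      ; mul∈ = mul∈′ }
      where
      open FiniteMonoid (monomials-monoid ωs hs)
      mul∈′ : ∀ {x y} → x ∈ monomials N (ω ∷ ωs) → y ∈ monomials N (ω ∷ ωs) →
        x * y ∈ monomials N (ω ∷ ωs)
      mul∈′ x∈ y∈ with Membershipₚ.∈-cartesianProductWith⁻ setoid setoid setoid _*_ (powers N ω)
        (monomials N ωs) x∈
                     | Membershipₚ.∈-cartesianProductWith⁻ setoid setoid setoid _*_ (powers N ω)
                       (monomials N ωs) y∈
      ... | a , b , a∈ , b∈ , x≈ | c , d , c∈ , d∈ , y≈ = Membershipₚ.∈-resp-≈ setoid
        (trans (interchange a c b d) (sym (*-cong x≈ y≈)))
        (product∈ (power-mul∈ h a∈ c∈) (mul∈ b∈ d∈))
        where open import Algebra.Properties.CommutativeSemigroup *-commutativeSemigroup using (interchange)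

    roots∈ : ∀ ωs → All (λ ω → ω ^ N ≈ 1#) ωs → All (_∈ monomials N ωs) ωs
    roots∈ [] [] = []
    roots∈ (ω ∷ ωs) (h ∷ hs) =
      Membershipₚ.∈-resp-≈ setoid (trans (*-identityʳ _) (*-identityʳ ω))
        (product∈ (power∈ h 1) one∈)
      ∷ All.map (λ g∈ → Membershipₚ.∈-resp-≈ setoid (*-identityˡ _) (product∈ (power∈ h 0) g∈))
        (roots∈ ωs hs)
      where open FiniteMonoid (monomials-monoid ωs hs)

  -- Natural coefficients are enough: a minus sign goes into the root, since the negative of a root
  -- of unity is again one. A relation is the power sum at exponent 1, and its conjugates are the
  -- power sums at exponents coprime to `N`.
  Terms : Set
  Terms = List (ℕ × Carrier)

  powerSum : Terms → ℕ → Carrier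
  powerSum []             t = 0#
  powerSum ((m , ω) ∷ ts) t = m • ω ^ t + powerSum ts t

  Roots : ℕ → Terms → Set
  Roots N = All (λ (_ , ω) → ω ^ N ≈ 1#)

  powerSum-mod : ∀ {N} .{{_ : NonZero N}} ts → Roots N ts → ∀ t k →
    powerSum ts (t ℕ.+ N ℕ.* k) ≈ powerSum ts t
  powerSum-mod [] [] t k = refl
  powerSum-mod {N} ((m , ω) ∷ ts) (h ∷ hs) t k = +-cong
    (×-congʳ m (trans (^-congʳ ω (≡.cong (t ℕ.+_) (ℕ.*-comm N k))) (^-periodic h t k)))
    (powerSum-mod ts hs t k)

  -- Double negation commutes with a conjunction over `t < n`, and monotonicity lets the maximum of
  -- the bounds serve for all. Since exponents matter only modulo `N`, one bound then covers all
  -- power sums.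
  bounded¬¬ : ∀ (P : ℕ → ℕ → Set) → (∀ {t B B′} → B ℕ.≤ B′ → P t B → P t B′) →
    (∀ t → ¬ ¬ (∃[ B ] P t B)) → ∀ n → ¬ ¬ (∃[ B ] ∀ t → t ℕ.< n → P t B)
  bounded¬¬ P mono h zero    k = k (0 , λ _ ())
  bounded¬¬ P mono h (suc n) k = bounded¬¬ P mono h n λ (B , f) → h n λ (B′ , p) →
    k (B ℕ.⊔ B′ , λ t t<1+n → case t B B′ f p (ℕ.m≤n⇒m<n∨m≡n (ℕ.s≤s⁻¹ t<1+n)))
    where
    case : ∀ t B B′ → (∀ t → t ℕ.< n → P t B) → P n B′ → t ℕ.< n ⊎ t ≡ n → P t (B ℕ.⊔ B′)
    case t B B′ f p (inj₁ t<n)    = mono (ℕ.m≤m⊔n B B′) (f t t<n)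
    case t B B′ f p (inj₂ ≡.refl) = mono (ℕ.m≤n⊔m B B′) p

  module Conjugation {N} .{{_ : NonZero N}} (ts : Terms) (roots : Roots N ts) where
    ωs : List Carrier
    ωs = map proj₂ ts

    hs : All (λ ω → ω ^ N ≈ 1#) ωs
    hs = Allₚ.map⁺ roots

    gs : List Carrier
    gs = monomials N ωs

    open Subring (span-subring (monomials-monoid ωs hs))

    frobenius : ∀ {p} → Prime p → ∀ t → Frob p (powerSum ts t) (powerSum ts (p ℕ.* t))
    frobenius {p} pr t = go ts (Allₚ.map⁻ (roots∈ ωs hs))
      where
      go : ∀ us → All (λ (_ , ω) → ω ∈ gs) us → Frob p (powerSum us t) (powerSum us (p ℕ.* t))
      go [] [] = frob-0 pr
      go ((m , ω) ∷ us) (ω∈ ∷ us∈) = frob-+ pr (frob-• pr m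
        (power (frob-^ pr (∈-^ t (span-∈ ω∈))))) (go us us∈)
        where
        power : Frob p (ω ^ t) ((ω ^ t) ^ p) → Frob p (ω ^ t) (ω ^ (p ℕ.* t))
        power (v , β , vβ , eq) = v , β , vβ ,
          trans eq (+-congʳ (trans (^-assocʳ ω t p) (^-congʳ ω (ℕ.*-comm t p))))

    Large : ℕ → ℕ → Set
    Large t B = ¬ (powerSum ts t ≈ 0#) → IndivisibleBeyond gs (powerSum ts t) B

    largeBound : ¬ ¬ (∃[ B ] ∀ t → t ℕ.< N → Large t B)
    largeBound = bounded¬¬ Large (λ B≤B′ l ≉0 p B′<p → l ≉0 p (ℕ.≤-<-trans B≤B′ B′<p)) large N
      where
      large : ∀ t → ¬ ¬ (∃[ B ] Large t B)
      large t k = ¬¬-excluded-middle {A = powerSum ts t ≈ 0#} λ where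
        (yes ≈0) → k (0 , λ ≉0 → ⊥-elim (≉0 ≈0))
        (no ≉0)  → eventuallyIndivisible gs ≉0 λ (B , h) → k (B , λ _ → h)

    -- The Frobenius congruence gives divisibility by p, and nothing but 0 is
    -- divisible by a prime beyond the bound.
    largePrimeStep : ∀ {B} → (∀ t → t ℕ.< N → Large t B) → ∀ {p} → Prime p → B ℕ.< p → ∀ t →
      powerSum ts t ≈ 0# → powerSum ts (p ℕ.* t) ≈ 0#
    largePrimeStep {B} large {p} pr B<p t ≈0 = stable λ ≉0 →
      let r≈ = reduce (p ℕ.* t)
          _ , β , vβ , eq = frobenius pr t
      in large (p ℕ.* t ℕ.% N) (ℕ.m%n<n (p ℕ.* t) N) (λ r≈0 → ≉0 (trans r≈ r≈0)) p B<p
           (∈-- vβ) (trans (sym r≈) (divisible β eq))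
      where
      reduce : ∀ u → powerSum ts u ≈ powerSum ts (u ℕ.% N)
      reduce u = trans (reflexive (≡.cong (powerSum ts)
        (≡.trans (ℕ.m≡m%n+[m/n]*n u N) (≡.cong (u ℕ.% N ℕ.+_) (ℕ.*-comm (u ℕ./ N) N)))))
        (powerSum-mod ts roots (u ℕ.% N) (u ℕ./ N))
      divisible : ∀ β → powerSum ts t ^ p ≈ powerSum ts (p ℕ.* t) + p • β →
        powerSum ts (p ℕ.* t) ≈ p • (- β)
      divisible β eq = begin
        powerSum ts (p ℕ.* t) ≈⟨ solve 2 (λ a b → a := (a :+ b) :- b) refl _ (p • β) ⟩
        powerSum ts (p ℕ.* t) + p • β - p • β        ≈⟨ +-congʳ eq ⟨
        powerSum ts t ^ p - p • β ≈⟨ +-congʳ (trans (^-congˡ p ≈0) (0^n≈0 p (prime⇒nonZero pr))) ⟩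
        0# - p • β                                   ≈⟨ +-identityˡ _ ⟩
        - (p • β)                                    ≈⟨ •-neg p β ⟨
        p • (- β)                                    ∎

    conjugate : ∀ {t} → Coprime t N → powerSum ts 1 ≈ 0# → powerSum ts t ≈ 0#
    -- Only `N ≡ 1` makes 0 coprime to `N`, and then the exponents 0 and 1 agree modulo `N`.
    conjugate {zero} c ≈0 = begin
      powerSum ts 0             ≈⟨ powerSum-mod ts roots 0 1 ⟨
      powerSum ts (N ℕ.* 1) ≡⟨ ≡.cong (powerSum ts)
        (≡.trans (ℕ.*-identityʳ N) (c (divides 0 ≡.refl , divides 1 (≡.sym (ℕ.*-identityˡ N))))) ⟩
      powerSum ts 1             ≈⟨ ≈0 ⟩
      0#                        ∎
    conjugate {t@(suc _)} c ≈0 = stable λ ≉0 → largeBound λ (B , large) →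
      let s , big = avoidSmallPrimes c B
          open PrimeFactorisation (factorise (t ℕ.+ N ℕ.* s))
      in ≉0 (begin
        powerSum ts t                   ≈⟨ powerSum-mod ts roots t s ⟨
        powerSum ts (t ℕ.+ N ℕ.* s)     ≡⟨ ≡.cong (powerSum ts) isFactorisation ⟩
        powerSum ts (product factors)   ≈⟨ primes large factors factorsPrime
                                             (divides-all factors factorsPrime
                                               (divides 1 (≡.trans isFactorisation
                                               (≡.sym (ℕ.*-identityˡ _)))) big) ⟩
        0#                              ∎)
      where
      -- The empty product is the exponent 1 of the given relation; each large prime multiplies the
      -- exponent in turn.
      primes : ∀ {B} → (∀ t → t ℕ.< N → Large t B) → ∀ ps → All Prime ps → All (B ℕ.<_) ps →
        powerSum ts (product ps) ≈ 0#
      primes large [] [] [] = ≈0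
      primes large (p ∷ ps) (pr ∷ prs) (b ∷ bs) = largePrimeStep large pr b (product ps)
        (primes large ps prs bs)
      divides-all : ∀ {B u} ps → All Prime ps → product ps ∣ u →
        (∀ {q} → Prime q → q ∣ u → B ℕ.< q) → All (B ℕ.<_) ps
      divides-all [] [] _ _ = []
      divides-all (p ∷ ps) (pr ∷ prs) d big =
        big pr (∣-trans (m∣m*n _) d) ∷ divides-all ps prs (∣-trans (n∣m*n p) d) big

-- Mann's theorem for four terms

-- Both sides carry a multiple of `N` in place of a subtraction, in the shape that `powerSum-mod`
-- removes.
inverseMod : ∀ {t N} → Coprime t N → ∃[ u ] ∃[ k ] ∃[ l ] t ℕ.* u ℕ.+ N ℕ.* k ≡ 1 ℕ.+ N ℕ.* l
inverseMod {t} {N} c with coprime-Bézout c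
... | Bézout.+- x y eq = x , 0 , y , (begin
  t ℕ.* x ℕ.+ N ℕ.* 0   ≡⟨ solve 3 (λ t x N → t :* x :+ N :* con 0 := x :* t) ≡.refl t x N ⟩
  x ℕ.* t               ≡⟨ eq ⟨
  1 ℕ.+ y ℕ.* N         ≡⟨ ≡.cong suc (ℕ.*-comm y N) ⟩
  1 ℕ.+ N ℕ.* y         ∎)
  where open ℕ.+-*-Solver
        open ≡.≡-Reasoning
-- Here `1 + x * t ≡ y * N`, so `x * t` is -1 modulo `N`, and its square `t * (x * x * t)` is 1.
... | Bézout.-+ x y eq = x ℕ.* x ℕ.* t , 2 ℕ.* y , y ℕ.* y ℕ.* N , ℕ.+-cancelʳ-≡ 1 _ _ (begin
  t ℕ.* (x ℕ.* x ℕ.* t) ℕ.+ N ℕ.* (2 ℕ.* y) ℕ.+ 1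
    ≡⟨ solve 4 (λ t x y N → t :* (x :* x :* t) :+ N :* (con 2 :* y) :+ con 1 := (x :* t) :* (x :* t)
      :+ con 2 :* (y :* N) :+ con 1) ≡.refl t x y N ⟩
  (x ℕ.* t) ℕ.* (x ℕ.* t) ℕ.+ 2 ℕ.* (y ℕ.* N) ℕ.+ 1
    ≡⟨ ≡.cong (λ z → (x ℕ.* t) ℕ.* (x ℕ.* t) ℕ.+ 2 ℕ.* z ℕ.+ 1) eq ⟨
  (x ℕ.* t) ℕ.* (x ℕ.* t) ℕ.+ 2 ℕ.* (1 ℕ.+ x ℕ.* t) ℕ.+ 1
    ≡⟨ solve 1 (λ s → s :* s :+ con 2 :* (con 1 :+ s) :+ con 1 := con 1 :+ (con 1 :+ s)
      :* (con 1 :+ s) :+ con 1) ≡.refl (x ℕ.* t) ⟩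
  1 ℕ.+ (1 ℕ.+ x ℕ.* t) ℕ.* (1 ℕ.+ x ℕ.* t) ℕ.+ 1
    ≡⟨ ≡.cong (λ z → 1 ℕ.+ z ℕ.* z ℕ.+ 1) eq ⟩
  1 ℕ.+ (y ℕ.* N) ℕ.* (y ℕ.* N) ℕ.+ 1
    ≡⟨ solve 2 (λ y N → con 1 :+ (y :* N) :* (y :* N) :+ con 1 := con 1 :+ N :* (y :* y :* N) :+ con
      1) ≡.refl y N ⟩
  1 ℕ.+ N ℕ.* (y ℕ.* y ℕ.* N) ℕ.+ 1 ∎)
  where open ℕ.+-*-Solver
        open ≡.≡-Reasoning

-- Splitting a list by a property decided under double negation

module Selection {A : Set} {P : A → Set} where
  -- The decisions are an argument, one for each entry: for equality of complex numbers they exist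
  -- only under `¬ ¬`, as supplied by `decideAll`.
  select reject : ∀ {xs} → All (λ x → Dec (P x)) xs → List A
  select [] = []
  select (_∷_ {x} (yes _) ds) = x ∷ select ds
  select (_∷_ {x} (no  _) ds) = select ds
  reject [] = []
  reject (_∷_ {x} (yes _) ds) = reject ds
  reject (_∷_ {x} (no  _) ds) = x ∷ reject ds

  reject-length : ∀ {xs} (ds : All (λ x → Dec (P x)) xs) → length (reject ds) ℕ.≤ length xs
  reject-length [] = ℕ.z≤n
  reject-length (yes _ ∷ ds) = ℕ.m≤n⇒m≤1+n (reject-length ds)
  reject-length (no _ ∷ ds) = ℕ.s≤s (reject-length ds)

  select-All : ∀ {xs} {Q : A → Set} (ds : All (λ x → Dec (P x)) xs) → All Q xs → All Q (select ds)
  select-All [] [] = []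
  select-All (yes _ ∷ ds) (q ∷ qs) = q ∷ select-All ds qs
  select-All (no _ ∷ ds) (q ∷ qs) = select-All ds qs

  reject-¬ : ∀ {xs} (ds : All (λ x → Dec (P x)) xs) → All (λ x → ¬ P x) (reject ds)
  reject-¬ [] = []
  reject-¬ (yes _ ∷ ds) = reject-¬ ds
  reject-¬ (no ¬p ∷ ds) = ¬p ∷ reject-¬ ds

  decideAll : ∀ xs → ¬ ¬ All (λ x → Dec (P x)) xs
  decideAll [] k = k []
  decideAll (x ∷ xs) k = ¬¬-excluded-middle λ d → decideAll xs λ ds → k (d ∷ ds)

open Selection

module Mann (R : CharZeroDomain) where
  open CharZeroDomain R
  open IntegerSolver commutativeRing
  open DomainProperties R
  open Galois R
  open RingProperties ring
  open Mult semiring using (×-congʳ)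
  open Exp semiring using (_^_; ^-congʳ; ^-homo-*; ^-assocʳ)
  open SetoidReasoning setoid

  -- The monic polynomial with the roots `bs`.
  weight : List Carrier → Carrier → Carrier
  weight []       x = 1#
  weight (b ∷ bs) x = (x - b) * weight bs x

  weight-cong : ∀ bs {x y} → x ≈ y → weight bs x ≈ weight bs y
  weight-cong []       x≈y = refl
  weight-cong (b ∷ bs) x≈y = *-cong (+-congʳ x≈y) (weight-cong bs x≈y)

  weight≉0 : ∀ bs {x} → All (λ b → ¬ (b ≈ x)) bs → ¬ (weight bs x ≈ 0#)
  weight≉0 [] [] 1≈0 = 1+n•1≉0 0 (trans (+-identityʳ 1#) 1≈0)
  weight≉0 (b ∷ bs) {x} (b≉x ∷ bs≉x) ≈0 = weight≉0 bs bs≉x (x*y≈0⇒y≈0 (λ x-b≈0 → b≉x (sym (begin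
    x             ≈⟨ solve 2 (λ x b → x := (x :- b) :+ b) refl x b ⟩
    x - b + b     ≈⟨ +-congʳ x-b≈0 ⟩
    0# + b        ≈⟨ +-identityˡ b ⟩
    b             ∎))) ≈0)

  module _ {A : Set} where
    ∑ : List A → (A → Carrier) → Carrier
    ∑ []       f = 0#
    ∑ (x ∷ xs) f = f x + ∑ xs f

    ∑-cong : ∀ xs {f g} → (∀ x → f x ≈ g x) → ∑ xs f ≈ ∑ xs g
    ∑-cong []       h = refl
    ∑-cong (x ∷ xs) h = +-cong (h x) (∑-cong xs h)

    ∑-linear : ∀ xs b {f g} → ∑ xs f - b * ∑ xs g ≈ ∑ xs (λ x → f x - b * g x)
    ∑-linear []       b = trans (+-congˡ (-‿cong (zeroʳ b))) (trans (+-identityˡ _) -0#≈0#)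
    ∑-linear (x ∷ xs) b {f} {g} = trans
      (solve 5 (λ fx F b gx G → (fx :+ F) :- b :* (gx :+ G) := (fx :- b :* gx) :+ (F :- b :* G))
        refl (f x) (∑ xs f) b (g x) (∑ xs g))
      (+-congˡ (∑-linear xs b))

    -- `weight bs` is a polynomial of degree `length bs`, so the sum is a combination of the
    -- vanishing ones. The induction moves one factor `ε x - b` into the coefficient, at the price
    -- of one exponent.
    vandermonde : ∀ xs (ε : A → Carrier) bs c →
      (∀ j → j ℕ.≤ length bs → ∑ xs (λ x → c x * ε x ^ j) ≈ 0#) →
      ∑ xs (λ x → c x * weight bs (ε x)) ≈ 0#
    vandermonde xs ε []       c h = h 0 ℕ.z≤n
    vandermonde xs ε (b ∷ bs) c h = trans
      (∑-cong xs (λ x → sym (*-assoc (c x) (ε x - b) (weight bs (ε x)))))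
      (vandermonde xs ε bs (λ x → c x * (ε x - b)) λ j j≤ → begin
        ∑ xs (λ x → c x * (ε x - b) * ε x ^ j)
          ≈⟨ ∑-cong xs (λ x → solve 4 (λ c e b p →
            c :* (e :- b) :* p := c :* (e :* p) :- b :* (c :* p)) refl (c x) (ε x) b (ε x ^ j)) ⟩
        ∑ xs (λ x → c x * ε x ^ suc j - b * (c x * ε x ^ j))
          ≈⟨ ∑-linear xs b ⟨
        ∑ xs (λ x → c x * ε x ^ suc j) - b * ∑ xs (λ x → c x * ε x ^ j)
          ≈⟨ +-cong (h (suc j) (ℕ.s≤s j≤)) (-‿cong (*-congˡ (h j (ℕ.m≤n⇒m≤1+n j≤)))) ⟩
        0# - b * 0#
          ≈⟨ solve 1 (λ b → con (+ 0) :- b :* con (+ 0) := con (+ 0)) refl b ⟩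
        0# ∎)

    module _ (ε : A → Carrier) where
      private
        P : A → Set
        P x = ε x ≈ 1#

      collapse : ∀ {xs} bs c (ds : All (λ x → Dec (P x)) xs) →
        All (λ x → weight bs (ε x) ≈ 0#) (reject ds) →
        ∑ xs (λ x → c x * weight bs (ε x)) ≈ weight bs 1# * ∑ (select ds) c
      collapse bs c [] [] = sym (zeroʳ _)
      collapse bs c (_∷_ {x} (yes p) ds) ws = trans
        (+-cong (trans (*-congˡ (weight-cong bs p)) (*-comm _ _)) (collapse bs c ds ws))
        (sym (distribˡ _ _ _))
      collapse bs c (_∷_ {x} (no _) ds) (w ∷ ws) = trans
        (+-cong (trans (*-congˡ w) (zeroʳ _)) (collapse bs c ds ws)) (+-identityˡ _)

      weight-zero : ∀ xs → All (λ x → weight (map ε xs) (ε x) ≈ 0#) xs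
      weight-zero [] = []
      weight-zero (x ∷ xs) = trans (*-congʳ (-‿inverseʳ (ε x))) (zeroˡ _) ∷ All.map
        (λ h → trans (*-congˡ h) (zeroʳ _)) (weight-zero xs)

      -- The weight with roots at the rejected values of `ε` annihilates the rejected terms and
      -- takes the same nonzero value, at 1, on all selected ones. It does the work of inverting a
      -- Vandermonde matrix, and repeated values among the rejected do no harm.
      isolate : ∀ {xs} c (ds : All (λ x → Dec (P x)) xs) →
        (∀ j → j ℕ.≤ length (reject ds) → ∑ xs (λ x → c x * ε x ^ j) ≈ 0#) → ∑ (select ds) c ≈ 0#
      isolate {xs} c ds h = x*y≈0⇒y≈0 (weight≉0 bs (Allₚ.map⁺ (reject-¬ ds)))
        (trans (sym (collapse bs c ds (weight-zero (reject ds))))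
          (vandermonde xs ε bs c (λ j j≤ →
            h j (≡.subst (j ℕ.≤_) (List.length-map ε (reject ds)) j≤))))
        where
        bs : List Carrier
        bs = map ε (reject ds)

  -- Writing `ω ^ (t + j * M)` as `ω ^ t` times the `j`-th power of `ω ^ M` gives the conjugated
  -- relations the shape that `isolate` takes, with `ω ^ M` as its `ε`.
  powerSum-∑ : ∀ ts t M j → ∑ ts (λ (m , ω) → m • ω ^ t * (ω ^ M) ^ j) ≈ powerSum ts (t ℕ.+ j ℕ.* M)
  powerSum-∑ [] t M j = refl
  powerSum-∑ ((m , ω) ∷ ts) t M j = +-cong (begin
    m • ω ^ t * (ω ^ M) ^ j ≈⟨ *-cong (x•y≈x1*y m _)
      (trans (^-assocʳ ω M j) (^-congʳ ω (ℕ.*-comm M j))) ⟩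
    m • 1# * ω ^ t * ω ^ (j ℕ.* M)    ≈⟨ *-assoc _ _ _ ⟩
    m • 1# * (ω ^ t * ω ^ (j ℕ.* M))  ≈⟨ *-congˡ (^-homo-* ω t (j ℕ.* M)) ⟨
    m • 1# * ω ^ (t ℕ.+ j ℕ.* M)      ≈⟨ x•y≈x1*y m _ ⟨
    m • ω ^ (t ℕ.+ j ℕ.* M)           ∎) (powerSum-∑ ts t M j)

  powerSum-∑₀ : ∀ ts t → ∑ ts (λ (m , ω) → m • ω ^ t) ≈ powerSum ts t
  powerSum-∑₀ [] t = refl
  powerSum-∑₀ (_ ∷ ts) t = +-congˡ (powerSum-∑₀ ts t)

  powerSum-scale : ∀ ts t u → powerSum (map (λ (m , ω) → m , ω ^ t) ts) u ≈ powerSum ts (t ℕ.* u)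
  powerSum-scale [] t u = refl
  powerSum-scale ((m , ω) ∷ ts) t u = +-cong (×-congʳ m (^-assocʳ ω t u)) (powerSum-scale ts t u)

  -- Isolation yields a relation at exponent `t`. It is a relation at exponent 1 between the powers
  -- `ω ^ t`, and conjugating these by an inverse of `t` modulo `N` recovers the original roots.
  unconjugate : ∀ {N} .{{_ : NonZero N}} ts → Roots N ts → ∀ {t} → Coprime t N →
    powerSum ts t ≈ 0# → powerSum ts 1 ≈ 0#
  unconjugate {N} ts roots {t} c ≈0 with inverseMod c
  ... | u , k , l , eq = begin
    powerSum ts 1                           ≈⟨ powerSum-mod ts roots 1 l ⟨
    powerSum ts (1 ℕ.+ N ℕ.* l)             ≡⟨ ≡.cong (powerSum ts) eq ⟨
    powerSum ts (t ℕ.* u ℕ.+ N ℕ.* k)       ≈⟨ powerSum-mod ts roots (t ℕ.* u) k ⟩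
    powerSum ts (t ℕ.* u)                   ≈⟨ powerSum-scale ts t u ⟨
    powerSum us u                           ≈⟨ Conjugation.conjugate us us-roots u-coprime us≈0 ⟩
    0#                                      ∎
    where
    us : Terms
    us = map (λ (m , ω) → m , ω ^ t) ts
    us-roots : Roots N us
    us-roots = Allₚ.map⁺ (All.map
      (λ {(_ , ω)} h → trans (^-assocʳ ω t N) (^-root {ω} {N} h t)) roots)
    us≈0 : powerSum us 1 ≈ 0#
    us≈0 = trans (powerSum-scale ts t 1)
      (trans (reflexive (≡.cong (powerSum ts) (ℕ.*-identityʳ t))) ≈0)
    u-coprime : Coprime u N
    u-coprime {d} (d∣u , d∣N) = ∣1⇒≡1
      (∣m+n∣n⇒∣m (≡.subst (d ∣_) eq (∣m∣n⇒∣m+n (∣n⇒∣m*n t d∣u) (∣m⇒∣m*n k d∣N))) (∣m⇒∣m*n l d∣N))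

  -- Only vanishing subsums through the first term have to be excluded: the subsum isolated in
  -- `sixthRoots` consists of the roots with `ω ^ M ≈ 1#`, and the first root is 1.
  Indecomposable : ℕ × Carrier → Terms → Set₁
  Indecomposable t₀ ts = ∀ {P : ℕ × Carrier → Set} (ds : All (λ t → Dec (P t)) (t₀ ∷ ts)) →
    P t₀ → powerSum (select ds) 1 ≈ 0# → All P (t₀ ∷ ts)

  -- The isolated terms form a vanishing subsum that contains the first term, so by
  -- indecomposability they are all the terms, and `N` may be replaced by the smaller `M`.
  sixthRoots : ∀ {m₀} ts → length ts ℕ.≤ 3 → Indecomposable (m₀ , 1#) ts →
    powerSum ((m₀ , 1#) ∷ ts) 1 ≈ 0# →
    ∀ N → 0 ℕ.< N → Roots N ((m₀ , 1#) ∷ ts) → ¬ ¬ Roots 6 ((m₀ , 1#) ∷ ts)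
  sixthRoots {m₀} ts len≤3 indec ≈0 = <-rec _ descend
    where
    us : Terms
    us = (m₀ , 1#) ∷ ts
    descend : ∀ N → (∀ {M} → M ℕ.< N → 0 ℕ.< M → Roots M us → ¬ ¬ Roots 6 us) → 0 ℕ.< N →
      Roots N us → ¬ ¬ Roots 6 us
    descend N rec 0<N roots k with primeStep N 0<N
    ... | inj₁ (divides q 6≡) = k
      (All.map (λ {(_ , ω)} h → trans (reflexive (≡.cong (ω ^_) 6≡)) (^-root h q)) roots)
    ... | inj₂ (p , M , pr , ≡.refl , h) = decideAll us λ ds →
      rec M<pM 0<M (indec ds (1^n≈1 M)
        (unconjugate (select ds) (select-All ds roots) (t-coprime ds) (vanish ds))) k
      where
      instance
        pM≢0 : NonZero (p ℕ.* M)
        pM≢0 = ℕ.>-nonZero 0<N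
        M≢0 : NonZero M
        M≢0 = ℕ.m*n≢0⇒n≢0 p
      0<M : 0 ℕ.< M
      0<M = ℕ.>-nonZero⁻¹ M
      M<pM : M ℕ.< p ℕ.* M
      M<pM = ≡.subst (M ℕ.<_) (ℕ.*-comm M p) (ℕ.m<m*n M p (prime⇒1< pr))
        where
        prime⇒1< : ∀ {p} → Prime p → 1 ℕ.< p
        prime⇒1< {p} pr = ℕ.nonTrivial⇒n>1 p {{prime⇒nonTrivial pr}}
      units : ∃[ t ] ∀ j → j ℕ.< 4 → Coprime (t ℕ.+ j ℕ.* M) (p ℕ.* M)
      units = fourUnits pr 0<N h
      t = proj₁ units
      -- The first root is 1, so its term is selected, and at most the three others are rejected.
      -- The exponents for `j` from 0 to 3 therefore suffice.
      few : (ds : All (λ (_ , ω) → Dec (ω ^ M ≈ 1#)) us) → length (reject ds) ℕ.≤ 3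
      few (yes _ ∷ ds)  = ℕ.≤-trans (reject-length ds) len≤3
      few (no 1≉1 ∷ _)  = ⊥-elim (1≉1 (1^n≈1 M))
      module _ (ds : All (λ (_ , ω) → Dec (ω ^ M ≈ 1#)) us) where
        t-coprime : Coprime t (p ℕ.* M)
        t-coprime = ≡.subst (λ s → Coprime s (p ℕ.* M)) (ℕ.+-identityʳ t) (proj₂ units 0 ℕ.z<s)
        vanish : powerSum (select ds) t ≈ 0#
        vanish = trans (sym (powerSum-∑₀ (select ds) t))
          (isolate (λ (_ , ω) → ω ^ M) (λ (m , ω) → m • ω ^ t) ds λ j j≤ →
          trans (powerSum-∑ us t M j) (Conjugation.conjugate us roots
            (proj₂ units j (ℕ.s≤s (ℕ.≤-trans j≤ (few ds)))) ≈0))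

-- Decompositions into two rational multiples of roots of unity

module TwoLegPaths (R : CharZeroDomain) where
  open import Data.Fin.Patterns using (0F; 1F; 2F; 3F; 4F; 5F)
  open import Data.Vec.Base as Vec using (Vec; []; _∷_)
  open CharZeroDomain R
  open IntegerSolver commutativeRing
  open DomainProperties R
  open Galois R
  open Mann R
  open RingProperties ring
  open Mult semiring using (×-congʳ; ×-congˡ; ×-assocˡ; ×-assoc-*)
  open CMult +-commutativeMonoid using (×-distrib-+)
  open Exp semiring using (_^_; ^-congˡ; ^-congʳ; ^-assocʳ)
  open CExp commutativeSemiring using (^-distrib-*)
  open SetoidReasoning setoid

  x+y≈0⇒x≈-y : ∀ {x y} → x + y ≈ 0# → x ≈ - y
  x+y≈0⇒x≈-y h = x-y≈0⇒x≈y (trans (+-congˡ (-‿involutive _)) h)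

  zeroFactor : ∀ {x y} → x * y ≈ 0# → ¬ ¬ (x ≈ 0# ⊎ y ≈ 0#)
  zeroFactor {x} {y} h k = k (inj₂ (x*y≈0⇒y≈0 (λ x≈0 → k (inj₁ x≈0)) h))

  cyclotomic₃ : Carrier → Carrier
  cyclotomic₃ x = x * x + x + 1#

  -- The last factor is `x² - x + 1`, whose roots are the negatives of the primitive cube roots of
  -- unity.
  unityFactors : ∀ x → x ^ 6 ≈ 1# → (x - 1#) * ((x + 1#) * (cyclotomic₃ x * cyclotomic₃ (- x))) ≈ 0#
  unityFactors x h = begin
    (x - 1#) * ((x + 1#) * (cyclotomic₃ x * cyclotomic₃ (- x)))
      ≈⟨ *-cong (+-congˡ (-‿cong one)) (*-cong (+-congˡ one) (*-cong (+-congˡ one) (+-congˡ one))) ⟩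
    (x - ι (+ 1)) * ((x + ι (+ 1)) * ((x * x + x + ι (+ 1)) * (- x * - x - x + ι (+ 1))))
      ≈⟨ solve 1 (λ x → (x :- con (+ 1))
        :* ((x :+ con (+ 1)) :* ((x :* x :+ x :+ con (+ 1)) :* (:- x :* :- x :+ :- x :+ con (+ 1))))
                 := x :* (x :* (x :* (x :* (x :* (x :* con (+ 1)))))) :- con (+ 1)) refl x ⟩
    x * (x * (x * (x * (x * (x * ι (+ 1)))))) - ι (+ 1)
      ≈⟨ +-cong (*-congˡ (*-congˡ (*-congˡ (*-congˡ (*-congˡ (*-congˡ (sym one)))))))
        (-‿cong (sym one)) ⟩
    x ^ 6 - 1#
      ≈⟨ x≈y⇒x-y≈0 h ⟩
    0# ∎
    where
    -- The solver reads its constant 1 as `1# + 0#`, so the unit is exchanged before and after the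
    -- call.
    one : 1# ≈ ι (+ 1)
    one = sym (+-identityʳ 1#)

  otherRoot : ∀ {ζ x} → cyclotomic₃ ζ ≈ 0# → cyclotomic₃ x ≈ 0# → (x - ζ) * (x + 1# + ζ) ≈ 0#
  otherRoot {ζ} {x} hζ hx = begin
    (x - ζ) * (x + 1# + ζ) ≈⟨ solve 3
      (λ x z o → (x :- z) :* (x :+ o :+ z) := (x :* x :+ x :* o) :- (z :* z :+ z :* o)) refl x ζ 1#
      ⟩
    (x * x + x * 1#) - (ζ * ζ + ζ * 1#)
      ≈⟨ +-cong (+-congˡ (*-identityʳ x)) (-‿cong (+-congˡ (*-identityʳ ζ))) ⟩
    (x * x + x) - (ζ * ζ + ζ) ≈⟨ solve 3 (λ x z o → x :- z := (x :+ o) :- (z :+ o)) refl (x * x + x)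
      (ζ * ζ + ζ) 1# ⟩
    cyclotomic₃ x - cyclotomic₃ ζ     ≈⟨ +-cong hx (-‿cong hζ) ⟩
    0# - 0#                           ≈⟨ -‿inverseʳ 0# ⟩
    0#                                ∎

  -- With a primitive cube root `ζ` the candidates are 1, `ζ`, `- (1# + ζ)` and their negatives.
  -- Without one they are 1 and -1 only, and the vector is padded to keep the length 6.
  sixRoots : ¬ ¬ (∃ λ (g : Vec Carrier 6) → ∀ x → x ^ 6 ≈ 1# → ¬ ¬ (∃[ i ] x ≈ Vec.lookup g i))
  sixRoots k = ¬¬-excluded-middle {A = ∃[ ζ ] cyclotomic₃ ζ ≈ 0#} λ where
    (no none) → k ((1# ∷ - 1# ∷ 1# ∷ 1# ∷ 1# ∷ 1# ∷ []) , λ x h k′ → zeroFactor (unityFactors x h) λ where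
      (inj₁ e) → k′ (0F , x-y≈0⇒x≈y e)
      (inj₂ e) → zeroFactor e λ where
        (inj₁ e) → k′ (1F , x+y≈0⇒x≈-y e)
        (inj₂ e) → zeroFactor e λ where
          (inj₁ e) → none (x , e)
          (inj₂ e) → none (- x , e))
    (yes (ζ , hζ)) → k ((1# ∷ - 1# ∷ ζ ∷ - (1# + ζ) ∷ - ζ ∷ - (- (1# + ζ)) ∷ []) ,
      λ x h k′ → zeroFactor (unityFactors x h) λ where
      (inj₁ e) → k′ (0F , x-y≈0⇒x≈y e)
      (inj₂ e) → zeroFactor e λ where
        (inj₁ e) → k′ (1F , x+y≈0⇒x≈-y e)
        (inj₂ e) → zeroFactor e λ where
          (inj₁ e) → zeroFactor (otherRoot hζ e) λ where
            (inj₁ e) → k′ (2F , x-y≈0⇒x≈y e)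
            (inj₂ e) → k′ (3F , x+y≈0⇒x≈-y (trans (sym (+-assoc x 1# ζ)) e))
          (inj₂ e) → zeroFactor (otherRoot hζ e) λ where
            (inj₁ e) → k′ (4F , trans (sym (-‿involutive x)) (-‿cong (x-y≈0⇒x≈y e)))
            (inj₂ e) → k′ (5F , trans (sym (-‿involutive x))
              (-‿cong (x+y≈0⇒x≈-y (trans (sym (+-assoc (- x) 1# ζ)) e)))))

  neg-^-even : ∀ z k → (- z) ^ (2 ℕ.* k) ≈ z ^ (2 ℕ.* k)
  neg-^-even z k = begin
    (- z) ^ (2 ℕ.* k)     ≈⟨ ^-assocʳ (- z) 2 k ⟨
    ((- z) ^ 2) ^ k ≈⟨ ^-congˡ k (trans (*-congˡ (*-identityʳ _))
      (trans (solve 1 (λ z → :- z :* :- z := z :* z) refl z) (*-congˡ (sym (*-identityʳ z))))) ⟩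
    (z ^ 2) ^ k           ≈⟨ ^-assocʳ z 2 k ⟩
    z ^ (2 ℕ.* k)         ∎

  -- x is a positive rational multiple of a root of unity.
  record Leg (x : Carrier) : Set where
    field
      coefficient direction           : Carrier
      numerator-1 denominator-1 order-1 : ℕ
      ratio    : suc denominator-1 • coefficient ≈ suc numerator-1 • 1#
      root     : direction ^ suc order-1 ≈ 1#
      factored : x ≈ coefficient * direction
    numerator denominator order : ℕ
    numerator   = suc numerator-1
    denominator = suc denominator-1
    order       = suc order-1

    direction⁻¹ : Carrier
    direction⁻¹ = direction ^ order-1

    direction-inverse : direction⁻¹ * direction ≈ 1#
    direction-inverse = trans (*-comm _ _) root

    scaled : ∀ k → (k ℕ.* denominator) • x ≈ (k ℕ.* numerator) • direction
    scaled k = begin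
      (k ℕ.* denominator) • x                      ≈⟨ ×-assocˡ x k denominator ⟨
      k • (denominator • x)                        ≈⟨ ×-congʳ k (×-congʳ denominator factored) ⟩
      k • (denominator • (coefficient * direction))
        ≈⟨ ×-congʳ k (×-assoc-* denominator coefficient direction) ⟨
      k • (denominator • coefficient * direction)  ≈⟨ ×-congʳ k (*-congʳ ratio) ⟩
      k • (numerator • 1# * direction)             ≈⟨ ×-congʳ k (x•y≈x1*y numerator direction) ⟨
      k • (numerator • direction)                  ≈⟨ ×-assocˡ direction k numerator ⟩
      (k ℕ.* numerator) • direction                ∎

    direction≉0 : ¬ (direction ≈ 0#)
    direction≉0 h = 1+n•1≉0 0 (trans (+-identityʳ 1#)
      (trans (sym direction-inverse) (trans (*-congˡ h) (zeroʳ _))))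

    leg≉0 : ¬ (x ≈ 0#)
    leg≉0 x≈0 = direction≉0 (torsionFree numerator-1
      (trans (×-congˡ (≡.sym (ℕ.*-identityˡ numerator)))
      (trans (sym (scaled 1)) (trans (×-congʳ (1 ℕ.* denominator) x≈0)
        (n•0≈0 (1 ℕ.* denominator))))))
  open Leg

  leg-resp : ∀ {x y} → x ≈ y → Leg x → Leg y
  leg-resp x≈y X = record { Leg X ; factored = trans (sym x≈y) (factored X) }

  leg-neg : ∀ {x} → Leg x → Leg (- x)
  leg-neg {x} X = record
    { coefficient = coefficient X ; direction = - direction X
    ; numerator-1 = numerator-1 X ; denominator-1 = denominator-1 X ; order-1 = ℕ.pred
      (2 ℕ.* order X)
    ; ratio = ratio X
    ; root = trans (neg-^-even (direction X) (order X)) (^-root {direction X} {order X} (root X) 2)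
    ; factored = trans (-‿cong (factored X)) (-‿distribʳ-* _ _) }

  module _ {x₀ y₀ x y} (X₀ : Leg x₀) (Y₀ : Leg y₀) (X : Leg x) (Y : Leg y)
           (sum≈ : x + y ≈ x₀ + y₀) (sum≉0 : ¬ (x₀ + y₀ ≈ 0#)) (x≉x₀ : ¬ (x ≈ x₀)) (x≉y₀ : ¬ (x ≈ y₀)) where
    private
      d₀ e₀ d e D m₀ n₀ m n N : ℕ
      d₀ = denominator X₀
      e₀ = denominator Y₀
      d  = denominator X
      e  = denominator Y
      D  = d₀ ℕ.* e₀ ℕ.* d ℕ.* e
      m₀ = e₀ ℕ.* d ℕ.* e ℕ.* numerator X₀
      n₀ = d₀ ℕ.* d ℕ.* e ℕ.* numerator Y₀
      m  = d₀ ℕ.* e₀ ℕ.* e ℕ.* numerator X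
      n  = d₀ ℕ.* e₀ ℕ.* d ℕ.* numerator Y
      N  = 2 ℕ.* (order X₀ ℕ.* order Y₀ ℕ.* order X ℕ.* order Y)

      u : Carrier
      u = direction⁻¹ X₀

      -- The relation `x₀ + y₀ - x - y ≈ 0` after two normalisations: multiplication by the common
      -- denominator `D` makes the coefficients natural, and division by the direction of `X₀` turns
      -- the first root into 1. The signs sit inside the roots, whence the factor 2 in `N`.
      ts : Terms
      ts = (n₀ , u * direction Y₀) ∷ (m , - (u * direction X)) ∷ (n , - (u * direction Y)) ∷ []

      unrotate : ∀ k z → k • ((u * z) ^ 1) * direction X₀ ≈ k • z
      unrotate k z = trans (×-assoc-* k _ _) (×-congʳ k (begin
        u * z * 1# * direction X₀     ≈⟨ *-congʳ (*-identityʳ _) ⟩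
        u * z * direction X₀ ≈⟨ solve 3 (λ u z d → u :* z :* d := u :* d :* z) refl u z
          (direction X₀) ⟩
        u * direction X₀ * z          ≈⟨ *-congʳ (direction-inverse X₀) ⟩
        1# * z                        ≈⟨ *-identityˡ z ⟩
        z                             ∎))

      unrotate- : ∀ k z → k • ((- (u * z)) ^ 1) * direction X₀ ≈ k • (- z)
      unrotate- k z = begin
        k • ((- (u * z)) ^ 1) * direction X₀   ≈⟨ *-congʳ (×-congʳ k (-‿distribˡ-* (u * z) 1#)) ⟨
        k • (- ((u * z) ^ 1)) * direction X₀   ≈⟨ *-congʳ (•-neg k _) ⟩
        - (k • ((u * z) ^ 1)) * direction X₀   ≈⟨ -‿distribˡ-* _ _ ⟨
        - (k • ((u * z) ^ 1) * direction X₀)   ≈⟨ -‿cong (unrotate k z) ⟩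
        - (k • z)                              ≈⟨ •-neg k z ⟨
        k • (- z)                              ∎

      negated : ∀ k {z} (Z : Leg z) → D ≡ k ℕ.* denominator Z →
        (k ℕ.* numerator Z) • (- direction Z) ≈ D • (- z)
      negated k {z} Z D≡ = begin
        (k ℕ.* numerator Z) • (- direction Z)    ≈⟨ •-neg (k ℕ.* numerator Z) _ ⟩
        - ((k ℕ.* numerator Z) • direction Z)    ≈⟨ -‿cong (scaled Z k) ⟨
        - ((k ℕ.* denominator Z) • z)            ≈⟨ -‿cong (×-congˡ D≡) ⟨
        - (D • z)                                ≈⟨ •-neg D z ⟨
        D • (- z)                                ∎

      D≡ : D ≡ e₀ ℕ.* d ℕ.* e ℕ.* d₀ × D ≡ d₀ ℕ.* d ℕ.* e ℕ.* e₀ × D ≡ d₀ ℕ.* e₀ ℕ.* e ℕ.* d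
      D≡ = NS.solve 4 (λ a b c d → a NS.:* b NS.:* c NS.:* d NS.:= b NS.:* c NS.:* d NS.:* a) ≡.refl
        d₀ e₀ d e
         , NS.solve 4 (λ a b c d → a NS.:* b NS.:* c NS.:* d NS.:= a NS.:* c NS.:* d NS.:* b) ≡.refl
           d₀ e₀ d e
         , NS.solve 4 (λ a b c d → a NS.:* b NS.:* c NS.:* d NS.:= a NS.:* b NS.:* d NS.:* c) ≡.refl
           d₀ e₀ d e
        where module NS = ℕ.+-*-Solver

      t₀ t₁ t₂ t₃ : Carrier
      t₀ = m₀ • (1# ^ 1)
      t₁ = n₀ • ((u * direction Y₀) ^ 1)
      t₂ = m • ((- (u * direction X)) ^ 1)
      t₃ = n • ((- (u * direction Y)) ^ 1)

      E₀ : t₀ * direction X₀ ≈ D • x₀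
      E₀ = begin
        t₀ * direction X₀     ≈⟨ *-congʳ (×-congʳ m₀ (*-identityʳ 1#)) ⟩
        m₀ • 1# * direction X₀ ≈⟨ x•y≈x1*y m₀ _ ⟨
        m₀ • direction X₀     ≈⟨ scaled X₀ (e₀ ℕ.* d ℕ.* e) ⟨
        _                     ≈⟨ ×-congˡ (proj₁ D≡) ⟨
        D • x₀                ∎
      E₁ : t₁ * direction X₀ ≈ D • y₀
      E₁ = trans (unrotate n₀ _) (trans (sym (scaled Y₀ (d₀ ℕ.* d ℕ.* e)))
        (×-congˡ (≡.sym (proj₁ (proj₂ D≡)))))
      E₂ : t₂ * direction X₀ ≈ D • (- x)
      E₂ = trans (unrotate- m _) (negated (d₀ ℕ.* e₀ ℕ.* e) X (proj₂ (proj₂ D≡)))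
      E₃ : t₃ * direction X₀ ≈ D • (- y)
      E₃ = trans (unrotate- n _) (negated (d₀ ℕ.* e₀ ℕ.* d) Y ≡.refl)

      _⊕_ : ∀ {t t′ z z′} → t * direction X₀ ≈ D • z → t′ * direction X₀ ≈ D • z′ →
        (t + t′) * direction X₀ ≈ D • (z + z′)
      E ⊕ E′ = trans (distribʳ _ _ _) (trans (+-cong E E′) (sym (×-distrib-+ _ _ D)))

      E∅ : 0# * direction X₀ ≈ D • 0#
      E∅ = trans (zeroˡ _) (sym (n•0≈0 D))

      vanishes : ∀ {t z} → t * direction X₀ ≈ D • z → t ≈ 0# → z ≈ 0#
      vanishes E t≈0 = torsionFree (ℕ.pred D) (trans (sym E) (trans (*-congʳ t≈0) (zeroˡ _)))

      infixr 5 _⊕_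

      relation : powerSum ((m₀ , 1#) ∷ ts) 1 ≈ 0#
      relation = x*y≈0⇒y≈0 (direction≉0 X₀)
        (trans (*-comm _ _) (trans (E₀ ⊕ E₁ ⊕ E₂ ⊕ E₃ ⊕ E∅) (trans (×-congʳ D (begin
        x₀ + (y₀ + (- x + (- y + 0#)))
          ≈⟨ solve 4 (λ a b c d → a :+ (b :+ (:- c :+ (:- d :+ con (+ 0)))) := a :+ b :- (c :+ d))
          refl x₀ y₀ x y ⟩
        x₀ + y₀ - (x + y)               ≈⟨ x≈y⇒x-y≈0 (sym sum≈) ⟩
        0#                              ∎)) (n•0≈0 D))))

      -- A vanishing single term makes `x₀` zero, and three vanishing terms make the leg of the
      -- fourth zero. The two-term subsums through `x₀` amount to `x₀ + y₀ ≈ 0`, `x ≈ x₀` and, as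
      -- `x₀ ≈ y` gives it, `x ≈ y₀`; all three are excluded by hypothesis.
      indecomposable : Indecomposable (m₀ , 1#) ts
      indecomposable (no ¬p ∷ _) p _ = ⊥-elim (¬p p)
      indecomposable (yes p ∷ yes q ∷ yes r ∷ yes s ∷ []) _ h = p ∷ q ∷ r ∷ s ∷ []
      indecomposable (yes p ∷ no _ ∷ no _ ∷ no _ ∷ []) _ h =
        ⊥-elim (leg≉0 X₀ (trans (sym (+-identityʳ x₀)) (vanishes (E₀ ⊕ E∅) h)))
      indecomposable (yes p ∷ yes _ ∷ no _ ∷ no _ ∷ []) _ h =
        ⊥-elim (sum≉0 (trans (+-congˡ (sym (+-identityʳ y₀))) (vanishes (E₀ ⊕ E₁ ⊕ E∅) h)))
      indecomposable (yes p ∷ no _ ∷ yes _ ∷ no _ ∷ []) _ h =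
        ⊥-elim (x≉x₀ (sym (x-y≈0⇒x≈y
          (trans (+-congˡ (sym (+-identityʳ _))) (vanishes (E₀ ⊕ E₂ ⊕ E∅) h)))))
      indecomposable (yes p ∷ no _ ∷ no _ ∷ yes _ ∷ []) _ h = ⊥-elim (x≉y₀ (x-y≈0⇒x≈y (begin
        x - y₀ ≈⟨ solve 4 (λ a b c d → c :- b := (c :+ d :- (a :+ b)) :+ (a :+ (:- d :+ con (+ 0))))
          refl x₀ y₀ x y ⟩
        (x + y - (x₀ + y₀)) + (x₀ + (- y + 0#))
          ≈⟨ +-cong (x≈y⇒x-y≈0 sum≈) (vanishes (E₀ ⊕ E₃ ⊕ E∅) h) ⟩
        0# + 0#                                      ≈⟨ +-identityˡ 0# ⟩
        0#                                           ∎)))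
      indecomposable (yes p ∷ yes _ ∷ yes _ ∷ no _ ∷ []) _ h = ⊥-elim (leg≉0 Y (begin
        y ≈⟨ solve 4 (λ a b c d → d := (c :+ d :- (a :+ b)) :+ (a :+ (b :+ (:- c :+ con (+ 0)))))
          refl x₀ y₀ x y ⟩
        (x + y - (x₀ + y₀)) + (x₀ + (y₀ + (- x + 0#)))
          ≈⟨ +-cong (x≈y⇒x-y≈0 sum≈) (vanishes (E₀ ⊕ E₁ ⊕ E₂ ⊕ E∅) h) ⟩
        0# + 0#                                      ≈⟨ +-identityˡ 0# ⟩
        0#                                           ∎))
      indecomposable (yes p ∷ yes _ ∷ no _ ∷ yes _ ∷ []) _ h = ⊥-elim (leg≉0 X (begin
        x ≈⟨ solve 4 (λ a b c d → c := (c :+ d :- (a :+ b)) :+ (a :+ (b :+ (:- d :+ con (+ 0)))))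
          refl x₀ y₀ x y ⟩
        (x + y - (x₀ + y₀)) + (x₀ + (y₀ + (- y + 0#)))
          ≈⟨ +-cong (x≈y⇒x-y≈0 sum≈) (vanishes (E₀ ⊕ E₁ ⊕ E₃ ⊕ E∅) h) ⟩
        0# + 0#                                      ≈⟨ +-identityˡ 0# ⟩
        0#                                           ∎))
      indecomposable (yes p ∷ no _ ∷ yes _ ∷ yes _ ∷ []) _ h = ⊥-elim (leg≉0 Y₀ (begin
        y₀ ≈⟨ solve 4 (λ a b c d → b
          := :- ((c :+ d :- (a :+ b)) :+ (a :+ (:- c :+ (:- d :+ con (+ 0))))) ) refl x₀ y₀ x y ⟩
        - ((x + y - (x₀ + y₀)) + (x₀ + (- x + (- y + 0#))))
          ≈⟨ -‿cong (+-cong (x≈y⇒x-y≈0 sum≈) (vanishes (E₀ ⊕ E₂ ⊕ E₃ ⊕ E∅) h)) ⟩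
        - (0# + 0#)                                  ≈⟨ -‿cong (+-identityˡ 0#) ⟩
        - 0#                                         ≈⟨ -0#≈0# ⟩
        0#                                           ∎))

      rotatedRoot : ∀ {z} (Z : Leg z) k → N ≡ k ℕ.* order Z → (u * direction Z) ^ N ≈ 1#
      rotatedRoot Z k N≡ = begin
        (u * direction Z) ^ N         ≈⟨ ^-distrib-* u (direction Z) N ⟩
        u ^ N * direction Z ^ N ≈⟨ *-cong u^N
          (trans (^-congʳ _ N≡) (^-root {direction Z} {order Z} (root Z) k)) ⟩
        1# * 1#                       ≈⟨ *-identityˡ 1# ⟩
        1#                            ∎
        where
        u^order : u ^ order X₀ ≈ 1#
        u^order = trans (^-assocʳ (direction X₀) (order-1 X₀) (order X₀))
          (^-root {direction X₀} {order X₀} (root X₀) (order-1 X₀))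
        u^N : u ^ N ≈ 1#
        u^N = trans (^-congʳ u (NS.solve 4
          (λ a b c d → NS.con 2 NS.:* (a NS.:* b NS.:* c NS.:* d)
          NS.:= (NS.con 2 NS.:* b NS.:* c NS.:* d) NS.:* a) ≡.refl (order X₀) (order Y₀) (order X)
          (order Y)))
          (^-root {u} {order X₀} u^order (2 ℕ.* order Y₀ ℕ.* order X ℕ.* order Y))
          where module NS = ℕ.+-*-Solver

    secondPath : ¬ ¬ ((direction⁻¹ X₀ * direction X) ^ 6 ≈ 1# ×
      (direction⁻¹ X₀ * direction Y) ^ 6 ≈ 1#)
    secondPath k = sixthRoots ts ℕ.≤-refl indecomposable relation N ℕ.z<s
      (1^n≈1 N ∷ rotatedRoot Y₀ (2 ℕ.* order X₀ ℕ.* order X ℕ.* order Y)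
        (NS.solve 4 (λ a b c d → NS.con 2 NS.:* (a NS.:* b NS.:* c NS.:* d)
        NS.:= (NS.con 2 NS.:* a NS.:* c NS.:* d) NS.:* b) ≡.refl (order X₀) (order Y₀) (order X)
        (order Y))
        ∷ trans (neg-^-even (u * direction X) (order X₀ ℕ.* order Y₀ ℕ.* order X ℕ.* order Y))
          (rotatedRoot X (2 ℕ.* order X₀ ℕ.* order Y₀ ℕ.* order Y)
          (NS.solve 4 (λ a b c d → NS.con 2 NS.:* (a NS.:* b NS.:* c NS.:* d)
          NS.:= (NS.con 2 NS.:* a NS.:* b NS.:* d) NS.:* c) ≡.refl (order X₀) (order Y₀) (order X)
          (order Y)))
        ∷ trans (neg-^-even (u * direction Y) (order X₀ ℕ.* order Y₀ ℕ.* order X ℕ.* order Y))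
          (rotatedRoot Y (2 ℕ.* order X₀ ℕ.* order Y₀ ℕ.* order X)
          (NS.solve 4 (λ a b c d → NS.con 2 NS.:* (a NS.:* b NS.:* c NS.:* d)
          NS.:= (NS.con 2 NS.:* a NS.:* b NS.:* c) NS.:* d) ≡.refl (order X₀) (order Y₀) (order X)
          (order Y))) ∷ [])
      -- The exponent 6 is even, so the minus signs put into the roots disappear.
      λ { (_ ∷ _ ∷ X⁶ ∷ Y⁶ ∷ []) → k
        (trans (sym (neg-^-even (u * direction X) 3)) X⁶ , trans
        (sym (neg-^-even (u * direction Y) 3)) Y⁶) }
      where
      module NS = ℕ.+-*-Solver

  record Path (z : Carrier) : Set where
    field
      {x y} : Carrier
      X     : Leg x
      Y     : Leg y
      x+y≈z : x + y ≈ z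
  open Path

  -- Against a reference path, every other path takes one of two shapes or has
  -- both directions among the sixth roots of unity: 2 + 6 * 6 = 38 codes.
  module _ {z} (z≉0 : ¬ z ≈ 0#) (P₀ : Path z) (g : Vec Carrier 6) where
    private
      u : Carrier
      u = direction⁻¹ (X P₀)

    HasCode : Path z → Fin 2 ⊎ Fin 36 → Set
    HasCode P (inj₁ 0F) = x P ≈ x P₀
    HasCode P (inj₁ 1F) = x P ≈ y P₀
    HasCode P (inj₂ st) = u * direction (X P) ≈ Vec.lookup g
      (proj₁ (Fin.remQuot {6} 6 st)) × u * direction (Y P) ≈ Vec.lookup g
      (proj₂ (Fin.remQuot {6} 6 st))

    coded : (∀ x → x ^ 6 ≈ 1# → ¬ ¬ (∃[ i ] x ≈ Vec.lookup g i)) → ∀ P →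
      ¬ ¬ (∃[ c ] HasCode P (Fin.splitAt 2 c))
    coded roots P k = ¬¬-excluded-middle λ where
      (yes x≈x₀) → k (0F , x≈x₀)
      (no x≉x₀)  → ¬¬-excluded-middle λ where
        (yes x≈y₀) → k (1F , x≈y₀)
        (no x≉y₀) → secondPath (X P₀) (Y P₀) (X P) (Y P) (trans (x+y≈z P) (sym (x+y≈z P₀)))
          (λ ≈0 → z≉0 (trans (sym (x+y≈z P₀)) ≈0)) x≉x₀ x≉y₀
          λ (X⁶ , Y⁶) → roots (u * direction (X P)) X⁶ λ (s , X≈) →
            roots (u * direction (Y P)) Y⁶ λ (t , Y≈) →
            k (2 Fin.↑ʳ Fin.combine s t , ≡.subst (HasCode P)
              (≡.sym (Fin.splitAt-↑ʳ 2 36 (Fin.combine s t)))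
              (≡.subst (λ st → u * direction (X P) ≈ Vec.lookup g (proj₁ st) × u * direction
                (Y P) ≈ Vec.lookup g (proj₂ st)) (≡.sym (Fin.remQuot-combine {6} {6} s t))
                (X≈ , Y≈)))

    -- A code of the third shape records directions only. That the directions determine the lengths
    -- is true for legs that are not parallel, and enters here as a hypothesis.
    Rigid : Path z → Path z → Set
    Rigid P Q = direction (X P) ≈ direction (X Q) → direction (Y P) ≈ direction (Y Q) → x P ≈ x Q

    code-injective : ∀ {P Q} → Rigid P Q → ∀ c → HasCode P c → HasCode Q c → x P ≈ x Q
    code-injective rigid (inj₁ 0F) p q = trans p (sym q)
    code-injective rigid (inj₁ 1F) p q = trans p (sym q)
    code-injective rigid (inj₂ st) (p , p′) (q , q′) = rigid (cancel (trans p (sym q)))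
      (cancel (trans p′ (sym q′)))
      where
      cancel : ∀ {v w} → u * v ≈ u * w → v ≈ w
      cancel {v} {w} eq = begin
        v                            ≈⟨ *-identityˡ v ⟨
        1# * v                       ≈⟨ *-congʳ (root (X P₀)) ⟨
        direction (X P₀) * u * v     ≈⟨ *-assoc _ u v ⟩
        direction (X P₀) * (u * v)   ≈⟨ *-congˡ eq ⟩
        direction (X P₀) * (u * w)   ≈⟨ *-assoc _ u w ⟨
        direction (X P₀) * u * w     ≈⟨ *-congʳ (root (X P₀)) ⟩
        1# * w                       ≈⟨ *-identityˡ w ⟩
        w                            ∎

  fewPaths : ∀ {z k} → ¬ z ≈ 0# → (P : Fin k → Path z) →
    (∀ i j → direction (X (P i)) ≈ direction (X (P j)) → direction (Y (P i)) ≈ direction (Y (P j)) →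
      x (P i) ≈ x (P j)) →
    (∀ i j → x (P i) ≈ x (P j) → i ≡ j) → k ℕ.≤ 38
  fewPaths {z} {zero}  z≉0 P rigid distinct = ℕ.z≤n
  -- The first path is the reference for all codes, its own included; with more than 38 paths two of
  -- them share a code.
  fewPaths {z} {suc k} z≉0 P rigid distinct = ℕ.≮⇒≥ λ 38<k → sixRoots λ (g , roots) →
    ¬¬-Fin (λ i → coded z≉0 (P Fin.zero) g roots (P i)) λ codes →
    let i , j , i<j , same = Fin.pigeonhole 38<k (λ i → proj₁ (codes i))
    in Fin.<⇒≢ i<j (distinct i j (code-injective z≉0 (P Fin.zero) g {P i} {P j} (rigid i j) (Fin.splitAt 2 (proj₁ (codes i)))
         (proj₂ (codes i)) (≡.subst (λ c → HasCode z≉0 (P Fin.zero) g (P j) (Fin.splitAt 2 c))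
           (≡.sym same) (proj₂ (codes j)))))

-- Real and complex numbers

module RationalArithmetic where
  open import Data.Rational.Base
  open import Data.Rational.Properties
  open ℚ.+-*-Solver using (solve; _:-_; :-_; _:=_)
  open ≡ using (refl; sym; trans; cong; cong₂; subst; subst₂)

  nat : ℕ → ℚ
  nat n = + n / 1

  private
    nat-≃ : ∀ n → toℚᵘ (nat n) ℚᵘ.≃ ℚᵘ.mkℚᵘ (+ n) 0
    nat-≃ n = toℚᵘ-fromℚᵘ (ℚᵘ.mkℚᵘ (+ n) 0)

  nat-+ : ∀ m n → nat (m ℕ.+ n) ≡ nat m + nat n
  nat-+ m n = toℚᵘ-injective (begin
    toℚᵘ (nat (m ℕ.+ n))                         ≈⟨ nat-≃ (m ℕ.+ n) ⟩
    ℚᵘ.mkℚᵘ (+ (m ℕ.+ n)) 0 ≡⟨ cong (λ i → ℚᵘ.mkℚᵘ i 0)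
      (cong₂ ℤ._+_ (ℤ.*-identityʳ (+ m)) (ℤ.*-identityʳ (+ n))) ⟨
    ℚᵘ.mkℚᵘ (+ m) 0 ℚᵘ.+ ℚᵘ.mkℚᵘ (+ n) 0         ≈⟨ ℚᵘ.+-cong (nat-≃ m) (nat-≃ n) ⟨
    toℚᵘ (nat m) ℚᵘ.+ toℚᵘ (nat n)               ≈⟨ toℚᵘ-homo-+ (nat m) (nat n) ⟨
    toℚᵘ (nat m + nat n)                         ∎)
    where open ℚᵘ.≃-Reasoning

  nat-* : ∀ m n → nat (m ℕ.* n) ≡ nat m * nat n
  nat-* m n = toℚᵘ-injective (begin
    toℚᵘ (nat (m ℕ.* n))                         ≈⟨ nat-≃ (m ℕ.* n) ⟩
    ℚᵘ.mkℚᵘ (+ (m ℕ.* n)) 0                      ≡⟨ cong (λ i → ℚᵘ.mkℚᵘ i 0) (ℤ.pos-* m n) ⟩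
    ℚᵘ.mkℚᵘ (+ m) 0 ℚᵘ.* ℚᵘ.mkℚᵘ (+ n) 0         ≈⟨ ℚᵘ.*-cong (nat-≃ m) (nat-≃ n) ⟨
    toℚᵘ (nat m) ℚᵘ.* toℚᵘ (nat n)               ≈⟨ toℚᵘ-homo-* (nat m) (nat n) ⟨
    toℚᵘ (nat m * nat n)                         ∎)
    where open ℚᵘ.≃-Reasoning

  nat-mono-≤ : ∀ {m n} → m ℕ.≤ n → nat m ≤ nat n
  nat-mono-≤ {m} {n} m≤n = toℚᵘ-cancel-≤
    (ℚᵘ.≤-respˡ-≃ (ℚᵘ.≃-sym (nat-≃ m)) (ℚᵘ.≤-respʳ-≃ (ℚᵘ.≃-sym (nat-≃ n))
    (ℚᵘ.*≤* (subst₂ ℤ._≤_ (sym (ℤ.*-identityʳ (+ m))) (sym (ℤ.*-identityʳ (+ n))) (ℤ.+≤+ m≤n)))))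

  nat-mono-< : ∀ {m n} → m ℕ.< n → nat m < nat n
  nat-mono-< {m} {n} m<n = toℚᵘ-cancel-<
    (ℚᵘ.<-respˡ-≃ (ℚᵘ.≃-sym (nat-≃ m)) (ℚᵘ.<-respʳ-≃ (ℚᵘ.≃-sym (nat-≃ n))
    (ℚᵘ.*<* (subst₂ ℤ._<_ (sym (ℤ.*-identityʳ (+ m))) (sym (ℤ.*-identityʳ (+ n))) (ℤ.+<+ m<n)))))

  <⇒0<- : ∀ {p q} → p < q → 0ℚ < q - p
  <⇒0<- {p} {q} p<q = subst (_< q - p) (+-inverseʳ p) (+-monoˡ-< (- p) p<q)

  ≤⇒0≤- : ∀ {p q} → p ≤ q → 0ℚ ≤ q - p
  ≤⇒0≤- {p} {q} p≤q = subst (_≤ q - p) (+-inverseʳ p) (+-monoˡ-≤ (- p) p≤q)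

  -- Many inequalities below are proved in this form: `d` is a sum of positive quantities, and
  -- `q ≡ p + d` is left to the ring solver.
  0<⇒< : ∀ {p q d} → 0ℚ < d → q ≡ p + d → p < q
  0<⇒< {p} {q} {d} 0<d q≡ = subst₂ _<_ (+-identityʳ p) (sym q≡) (+-monoʳ-< p 0<d)

  0≤⇒≤ : ∀ {p q d} → 0ℚ ≤ d → q ≡ p + d → p ≤ q
  0≤⇒≤ {p} {q} {d} 0≤d q≡ = subst₂ _≤_ (+-identityʳ p) (sym q≡) (+-monoʳ-≤ p 0≤d)

  0<+ : ∀ {p q} → 0ℚ < p → 0ℚ < q → 0ℚ < p + q
  0<+ = +-mono-<

  0≤+ : ∀ {p q} → 0ℚ ≤ p → 0ℚ ≤ q → 0ℚ ≤ p + q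
  0≤+ = +-mono-≤

  0<+≤ : ∀ {p q} → 0ℚ < p → 0ℚ ≤ q → 0ℚ < p + q
  0<+≤ = +-mono-<-≤

  0<* : ∀ {p q} → 0ℚ < p → 0ℚ < q → 0ℚ < p * q
  0<* {p} {q} 0<p 0<q = positive⁻¹ _ {{pos*pos⇒pos p {{positive 0<p}} q {{positive 0<q}}}}

  0≤* : ∀ {p q} → 0ℚ ≤ p → 0ℚ ≤ q → 0ℚ ≤ p * q
  0≤* {p} {q} 0≤p 0≤q = nonNegative⁻¹ _
    {{nonNeg*nonNeg⇒nonNeg p {{nonNegative 0≤p}} q {{nonNegative 0≤q}}}}

  *-mono-≤-nonNeg : ∀ {p q r s} → 0ℚ ≤ r → 0ℚ ≤ q → p ≤ q → r ≤ s → p * r ≤ q * s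
  *-mono-≤-nonNeg {p} {q} {r} {s} 0≤r 0≤q p≤q r≤s = ≤-trans
    (*-monoʳ-≤-nonNeg r {{nonNegative 0≤r}} p≤q) (*-monoˡ-≤-nonNeg q {{nonNegative 0≤q}} r≤s)

  0<1 : 0ℚ < 1ℚ
  0<1 = positive⁻¹ 1ℚ

  0<½ : 0ℚ < ½
  0<½ = positive⁻¹ ½

  neg-involutive : ∀ p → - (- p) ≡ p
  neg-involutive = solve 1 (λ p → :- (:- p) := p) refl

  p≤∣p∣ : ∀ p → p ≤ ∣ p ∣
  p≤∣p∣ p with ∣p∣≡p∨∣p∣≡-p p
  ... | inj₁ eq = ≤-reflexive (sym eq)
  ... | inj₂ eq = ≤-trans (subst (_≤ 0ℚ) (neg-involutive p)
    (neg-antimono-≤ (subst (0ℚ ≤_) eq (0≤∣p∣ p)))) (0≤∣p∣ p)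

  -∣p∣≤p : ∀ p → - ∣ p ∣ ≤ p
  -∣p∣≤p p = subst (- ∣ p ∣ ≤_) (neg-involutive p)
    (neg-antimono-≤ (subst (- p ≤_) (∣-p∣≡∣p∣ p) (p≤∣p∣ (- p))))

  ∣p∣<e⇒p<e : ∀ {p e} → ∣ p ∣ < e → p < e
  ∣p∣<e⇒p<e {p} = ≤-<-trans (p≤∣p∣ p)

  ∣p∣<e⇒-e<p : ∀ {p e} → ∣ p ∣ < e → - e < p
  ∣p∣<e⇒-e<p {p} h = <-≤-trans (neg-antimono-< h) (-∣p∣≤p p)

  inverse : ∀ {p} → 0ℚ < p → ∃[ r ] 0ℚ < r × p * r ≡ 1ℚ
  inverse {p} 0<p = (1/ p) , positive⁻¹ _ {{1/pos⇒pos p}} , *-inverseʳ p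
    where instance
      _ = positive 0<p
      _ = pos⇒nonZero p

  archimedean : ∀ p → ∃[ n ] p < nat n
  archimedean (mkℚ (+ n) d-1 c) = suc n , toℚᵘ-cancel-< (ℚᵘ.<-respʳ-≃ (ℚᵘ.≃-sym (nat-≃ (suc n)))
    (ℚᵘ.*<* (subst₂ ℤ._<_ (sym (ℤ.*-identityʳ (+ n))) (ℤ.pos-* (suc n) (suc d-1))
      (ℤ.+<+ (ℕ.≤-trans (ℕ.n<1+n n) (ℕ.m≤m*n (suc n) (suc d-1)))))))
  archimedean p@(mkℚ -[1+ n ] d-1 c) = 0 , negative⁻¹ p

  archimedean-scaled : ∀ X {ε} → 0ℚ < ε → ∃[ n ] X < nat n * ε
  archimedean-scaled X {ε} 0<ε with inverse 0<ε
  ... | r , 0<r , εr≡1 with archimedean (X * r)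
  ... | n , Cr<n = n , subst (_< nat n * ε)
    (trans (*-assoc X r ε) (trans (cong (X *_) (trans (*-comm r ε) εr≡1)) (*-identityʳ X)))
          (*-monoˡ-<-pos ε {{positive 0<ε}} Cr<n)

open RationalArithmetic

-- Cauchy reals: ring structure, signs and apartness

module RealNumbers where
  open import Data.Rational.Base
  open import Data.Rational.Properties
  open ≡ using (refl; sym; trans; cong; cong₂; subst; subst₂; module ≡-Reasoning)

  Eventually : (ℕ → Set) → Set
  Eventually P = ∃[ N ] ∀ n → N ℕ.≤ n → P n

  always : ∀ {P} → (∀ n → P n) → Eventually P
  always h = 0 , λ n _ → h n

  eventually-map : ∀ {P Q} → (∀ {n} → P n → Q n) → Eventually P → Eventually Q
  eventually-map f (N , h) = N , λ n N≤n → f (h n N≤n)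

  eventually-zip : ∀ {P Q R} → (∀ {n} → P n → Q n → R n) → Eventually P → Eventually Q →
    Eventually R
  eventually-zip f (M , g) (N , h) = M ℕ.⊔ N , λ n MN≤n →
    f (g n (ℕ.m⊔n≤o⇒m≤o M N MN≤n)) (h n (ℕ.m⊔n≤o⇒n≤o M N MN≤n))

  eventually-zip₃ : ∀ {P Q R S} → (∀ {n} → P n → Q n → R n → S n) → Eventually P → Eventually Q →
    Eventually R → Eventually S
  eventually-zip₃ f p q r = eventually-zip (λ g x → g x) (eventually-zip f p q) r

  witness : ∀ {P} → Eventually P → ∃ P
  witness (N , h) = N , h N ℕ.≤-refl

  halves : ∀ ε → ½ * ε + ½ * ε ≡ ε
  halves ε = trans (sym (*-distribʳ-+ ε ½ ½)) (*-identityˡ ε)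

  0<½* : ∀ {ε} → 0ℚ < ε → 0ℚ < ½ * ε
  0<½* = 0<* 0<½

  IsNull IsBounded : (ℕ → ℚ) → Set
  IsNull s    = ∀ ε → 0ℚ < ε → Eventually λ n → ∣ s n ∣ < ε
  IsBounded s = ∃[ B ] 0ℚ < B × Eventually λ n → ∣ s n ∣ ≤ B

  null-cong : ∀ {s t} → (∀ n → s n ≡ t n) → IsNull s → IsNull t
  null-cong s≗t h ε 0<ε = eventually-map (λ {n} → subst (λ p → ∣ p ∣ < ε) (s≗t n)) (h ε 0<ε)

  null-0 : IsNull (λ _ → 0ℚ)
  null-0 ε 0<ε = always λ _ → 0<ε

  null-+ : ∀ {s t} → IsNull s → IsNull t → IsNull (λ n → s n + t n)
  null-+ {s} {t} hs ht ε 0<ε = eventually-zip (λ {n} p q → subst (∣ s n + t n ∣ <_) (halves ε)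
      (≤-<-trans (∣p+q∣≤∣p∣+∣q∣ (s n) (t n)) (+-mono-< p q)))
    (hs (½ * ε) (0<½* 0<ε)) (ht (½ * ε) (0<½* 0<ε))

  null-neg : ∀ {s} → IsNull s → IsNull (λ n → - s n)
  null-neg {s} h ε 0<ε = eventually-map (λ {n} → subst (_< ε) (sym (∣-p∣≡∣p∣ (s n)))) (h ε 0<ε)

  bounded*null : ∀ {s t} → IsBounded s → IsNull t → IsNull (λ n → s n * t n)
  bounded*null {s} {t} (B , 0<B , hs) ht ε 0<ε with inverse 0<B
  ... | r , 0<r , Br≡1 = eventually-zip (λ {n} p q → begin-strict
      ∣ s n * t n ∣       ≡⟨ ∣p*q∣≡∣p∣*∣q∣ (s n) (t n) ⟩
      ∣ s n ∣ * ∣ t n ∣   ≤⟨ *-monoʳ-≤-nonNeg ∣ t n ∣ {{nonNegative (0≤∣p∣ (t n))}} p ⟩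
      B * ∣ t n ∣         <⟨ *-monoʳ-<-pos B {{positive 0<B}} q ⟩
      B * (r * ε)         ≡⟨ *-assoc B r ε ⟨
      B * r * ε           ≡⟨ cong (_* ε) Br≡1 ⟩
      1ℚ * ε              ≡⟨ *-identityˡ ε ⟩
      ε                   ∎)
    hs (ht (r * ε) (0<* 0<r 0<ε))
    where open ≤-Reasoning

  bounded : ∀ x → IsBounded (seq x)
  bounded x with cauchy x 1ℚ 0<1
  ... | N , h = 1ℚ + ∣ seq x N ∣ , 0<+≤ 0<1 (0≤∣p∣ (seq x N)) , N , λ n N≤n → begin
      ∣ seq x n ∣ ≡⟨ cong ∣_∣ (solve 2 (λ a b → a := (a :- b) :+ b) refl (seq x n) (seq x N)) ⟩
      ∣ (seq x n - seq x N) + seq x N ∣   ≤⟨ ∣p+q∣≤∣p∣+∣q∣ (seq x n - seq x N) (seq x N) ⟩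
      ∣ seq x n - seq x N ∣ + ∣ seq x N ∣ ≤⟨ +-monoˡ-≤ ∣ seq x N ∣ (<⇒≤ (h n N N≤n ℕ.≤-refl)) ⟩
      1ℚ + ∣ seq x N ∣                    ∎
    where open ≤-Reasoning
          open ℚ.+-*-Solver

  pointwise : ∀ {x y} → (∀ n → seq x n ≡ seq y n) → x ≈ᴿ y
  pointwise {x} {y} h = null-cong
    (λ n → sym (trans (cong (_- seq y n) (h n)) (+-inverseʳ (seq y n)))) null-0

  ℝ-commutativeRing : CommutativeRing 0ℓ 0ℓ
  ℝ-commutativeRing = record
    { Carrier = ℝ ; _≈_ = _≈ᴿ_ ; _+_ = _+ᴿ_ ; _*_ = _*ᴿ_ ; -_ = -ᴿ_ ; 0# = 0ᴿ ; 1# = 1ᴿ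
    ; isCommutativeRing = record
      { isRing = record
        { +-isAbelianGroup = record
          { isGroup = record
            { isMonoid = record
              { isSemigroup = record
                { isMagma = record
                  { isEquivalence = record
                    { refl  = λ {x} → ≈-refl {x}
                    ; sym   = λ {x y} → ≈-sym {x} {y}
                    ; trans = λ {x y z} → ≈-trans {x} {y} {z} }
                  ; ∙-cong = λ {x y u v} → +-cong {x} {y} {u} {v} }
                ; assoc = λ x y z → pointwise {x +ᴿ y +ᴿ z} {x +ᴿ (y +ᴿ z)} λ n →
                  +-assoc (seq x n) (seq y n) (seq z n) }
              ; identity = (λ x → pointwise {0ᴿ +ᴿ x} {x} λ n → +-identityˡ (seq x n)) ,
                (λ x → pointwise {x +ᴿ 0ᴿ} {x} λ n → +-identityʳ (seq x n)) }
            ; inverse = (λ x → pointwise { -ᴿ x +ᴿ x} {0ᴿ} λ n → +-inverseˡ (seq x n)) ,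
              (λ x → pointwise {x +ᴿ -ᴿ x} {0ᴿ} λ n → +-inverseʳ (seq x n))
            ; ⁻¹-cong = λ {x y} → neg-cong {x} {y} }
          ; comm = λ x y → pointwise {x +ᴿ y} {y +ᴿ x} λ n → +-comm (seq x n) (seq y n) }
        ; *-cong = λ {x y u v} → *-cong {x} {y} {u} {v}
        ; *-assoc = λ x y z → pointwise {x *ᴿ y *ᴿ z} {x *ᴿ (y *ᴿ z)} λ n →
          *-assoc (seq x n) (seq y n) (seq z n)
        ; *-identity = (λ x → pointwise {1ᴿ *ᴿ x} {x} λ n → *-identityˡ (seq x n)) ,
          (λ x → pointwise {x *ᴿ 1ᴿ} {x} λ n → *-identityʳ (seq x n))
        ; distrib = (λ x y z → pointwise {x *ᴿ (y +ᴿ z)} {x *ᴿ y +ᴿ x *ᴿ z} λ n →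
          *-distribˡ-+ (seq x n) (seq y n) (seq z n))
                  , (λ x y z → pointwise {(y +ᴿ z) *ᴿ x} {y *ᴿ x +ᴿ z *ᴿ x} λ n →
                    *-distribʳ-+ (seq x n) (seq y n) (seq z n)) }
      ; *-comm = λ x y → pointwise {x *ᴿ y} {y *ᴿ x} λ n → *-comm (seq x n) (seq y n) } }
    where
    open ℚ.+-*-Solver
    ≈-refl : ∀ {x} → x ≈ᴿ x
    ≈-refl {x} = pointwise {x} {x} λ _ → refl
    ≈-sym : ∀ {x y} → x ≈ᴿ y → y ≈ᴿ x
    ≈-sym {x} {y} h = null-cong (λ n →
      solve 2 (λ a b → :- (a :- b) := b :- a) refl (seq x n) (seq y n)) (null-neg h)
    ≈-trans : ∀ {x y z} → x ≈ᴿ y → y ≈ᴿ z → x ≈ᴿ z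
    ≈-trans {x} {y} {z} h k = null-cong
      (λ n → solve 3 (λ a b c → (a :- b) :+ (b :- c) := a :- c) refl (seq x n) (seq y n) (seq z n))
      (null-+ h k)
    +-cong : ∀ {x y u v} → x ≈ᴿ y → u ≈ᴿ v → x +ᴿ u ≈ᴿ y +ᴿ v
    +-cong {x} {y} {u} {v} h k = null-cong
      (λ n → solve 4 (λ x y u v → (x :- y) :+ (u :- v) := (x :+ u) :- (y :+ v)) refl (seq x n)
      (seq y n) (seq u n) (seq v n)) (null-+ h k)
    neg-cong : ∀ {x y} → x ≈ᴿ y → -ᴿ x ≈ᴿ -ᴿ y
    neg-cong {x} {y} h = null-cong
      (λ n → solve 2 (λ a b → :- (a :- b) := :- a :- :- b) refl (seq x n) (seq y n)) (null-neg h)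
    *-cong : ∀ {x y u v} → x ≈ᴿ y → u ≈ᴿ v → x *ᴿ u ≈ᴿ y *ᴿ v
    *-cong {x} {y} {u} {v} h k = null-cong
      (λ n → solve 4 (λ x y u v → x :* (u :- v) :+ v :* (x :- y) := x :* u :- y :* v) refl (seq x n)
        (seq y n) (seq u n) (seq v n))
      (null-+ (bounded*null (bounded x) k) (bounded*null (bounded v) h))

  module ℝR = CommutativeRing ℝ-commutativeRing

  quarter : ℚ
  quarter = ½ * ½

  private
    quarters : ∀ ε → quarter * ε + quarter * ε ≡ ½ * ε
    quarters ε = trans (cong₂ _+_ (*-assoc ½ ½ ε) (*-assoc ½ ½ ε)) (halves (½ * ε))

  -- Beyond `N` the sequence moves by less than a quarter of `ε`, so the comparison of the single
  -- rational `seq x N` with half of `ε` and its negative decides the matter. This is the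
  -- constructive remnant of trichotomy.
  smallOrSigned : ∀ x {ε} → 0ℚ < ε → Eventually (λ n → ∣ seq x n ∣ < ε) ⊎ 0ᴿ <ᴿ x ⊎ x <ᴿ 0ᴿ
  smallOrSigned x {ε} 0<ε with cauchy x (quarter * ε) (0<* (0<* 0<½ 0<½) 0<ε)
  ... | N , h with ½ * ε <? seq x N | seq x N <? - (½ * ε)
  ...   | yes big | _ = inj₂ (inj₁ (quarter * ε , 0<* (0<* 0<½ 0<½) 0<ε , N , λ n N≤n →
          0<⇒< (0<+ (<⇒0<- big) (<⇒0<- (∣p∣<e⇒p<e (h N n ℕ.≤-refl N≤n)))) (begin
            seq x n
              -- The solver treats `quarter * ε` and `½ * ε` as independent; the last summand, which
              -- is zero, carries their relation.
              ≡⟨ solve 4 (λ xn xN q h → xn := con 0ℚ :+ q :+ ((xN :- h) :+ (q :- (xN :- xn)))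
                :+ (h :- (q :+ q))) refl (seq x n) (seq x N) (quarter * ε) (½ * ε) ⟩
            0ℚ + quarter * ε + (seq x N - ½ * ε + (quarter * ε - (seq x N - seq x n))) +
              (½ * ε - (quarter * ε + quarter * ε))
              ≡⟨ cong (λ z → 0ℚ + quarter * ε +
                (seq x N - ½ * ε + (quarter * ε - (seq x N - seq x n))) + (½ * ε - z))
                (quarters ε) ⟩
            0ℚ + quarter * ε + (seq x N - ½ * ε + (quarter * ε - (seq x N - seq x n))) +
              (½ * ε - ½ * ε)
              ≡⟨ solve 2 (λ a h → a :+ (h :- h) := a) refl _ (½ * ε) ⟩
            0ℚ + quarter * ε + (seq x N - ½ * ε + (quarter * ε - (seq x N - seq x n))) ∎)))
    where open ≡-Reasoning
          open ℚ.+-*-Solver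
  ...   | no _ | yes small = inj₂ (inj₂ (quarter * ε , 0<* (0<* 0<½ 0<½) 0<ε , N , λ n N≤n →
          0<⇒< (0<+ (<⇒0<- small) (<⇒0<- (∣p∣<e⇒p<e (h n N N≤n ℕ.≤-refl)))) (begin
            0ℚ
              ≡⟨ solve 4 (λ xn xN q h → con 0ℚ := (xn :+ q) :+ ((:- h :- xN) :+ (q :- (xn :- xN)))
                :+ (h :- (q :+ q))) refl (seq x n) (seq x N) (quarter * ε) (½ * ε) ⟩
            seq x n + quarter * ε + (- (½ * ε) - seq x N + (quarter * ε - (seq x n - seq x N))) +
              (½ * ε - (quarter * ε + quarter * ε))
              ≡⟨ cong (λ z → seq x n + quarter * ε +
                (- (½ * ε) - seq x N + (quarter * ε - (seq x n - seq x N))) + (½ * ε - z))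
                (quarters ε) ⟩
            seq x n + quarter * ε + (- (½ * ε) - seq x N + (quarter * ε - (seq x n - seq x N))) +
              (½ * ε - ½ * ε)
              ≡⟨ solve 2 (λ a h → a :+ (h :- h) := a) refl _ (½ * ε) ⟩
            seq x n + quarter * ε + (- (½ * ε) - seq x N + (quarter * ε - (seq x n - seq x N))) ∎)))
    where open ≡-Reasoning
          open ℚ.+-*-Solver
  ...   | no ≤½ε | no ≥-½ε = inj₁ (N , λ n N≤n → begin-strict
      ∣ seq x n ∣ ≡⟨ cong ∣_∣ (solve 2 (λ a b → a := (a :- b) :+ b) refl (seq x n) (seq x N)) ⟩
      ∣ (seq x n - seq x N) + seq x N ∣   ≤⟨ ∣p+q∣≤∣p∣+∣q∣ (seq x n - seq x N) (seq x N) ⟩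
      ∣ seq x n - seq x N ∣ + ∣ seq x N ∣ <⟨ +-mono-<-≤ (h n N N≤n ℕ.≤-refl) ∣xN∣≤ ⟩
      quarter * ε + ½ * ε                 <⟨ +-monoˡ-< (½ * ε) quarter<½ ⟩
      ½ * ε + ½ * ε                       ≡⟨ halves ε ⟩
      ε                                   ∎)
    where
    open ≤-Reasoning
    open ℚ.+-*-Solver
    ∣xN∣≤ : ∣ seq x N ∣ ≤ ½ * ε
    ∣xN∣≤ with ∣p∣≡p∨∣p∣≡-p (seq x N)
    ... | inj₁ eq = subst (_≤ ½ * ε) (sym eq) (≮⇒≥ ≤½ε)
    ... | inj₂ eq = subst₂ _≤_ (sym eq) (neg-involutive (½ * ε)) (neg-antimono-≤ (≮⇒≥ ≥-½ε))
    quarter<½ : quarter * ε < ½ * ε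
    quarter<½ = 0<⇒< (0<* (0<* 0<½ 0<½) 0<ε) (sym (quarters ε))

  positive≉0 : ∀ {x} → 0ᴿ <ᴿ x → ¬ x ≈ᴿ 0ᴿ
  positive≉0 {x} (δ , 0<δ , pos) null with witness (eventually-zip _,_ pos (null δ 0<δ))
  ... | n , δ<x , ∣x∣<δ = <-asym (subst (_< seq x n) (+-identityˡ δ) δ<x)
    (subst (_< δ) (+-identityʳ _) (∣p∣<e⇒p<e ∣x∣<δ))

  negative≉0 : ∀ {x} → x <ᴿ 0ᴿ → ¬ x ≈ᴿ 0ᴿ
  negative≉0 {x} (δ , 0<δ , neg) null with witness (eventually-zip _,_ neg (null δ 0<δ))
  ... | n , x+δ<0 , ∣x∣<δ = <-asym x+δ<0
    (0<⇒< (<⇒0<- (∣p∣<e⇒-e<p ∣x∣<δ))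
    (solve 2 (λ x d → x :+ d := con 0ℚ :+ (x :- con 0ℚ :- :- d)) refl (seq x n) δ))
    where open ℚ.+-*-Solver

  -- With both signs refuted, `smallOrSigned` leaves smallness for every `ε`. Stability of equality
  -- follows, since either strict sign refutes `x ≈ᴿ 0ᴿ`.
  ≈0-by-sign : ∀ {x} → ¬ 0ᴿ <ᴿ x → ¬ x <ᴿ 0ᴿ → x ≈ᴿ 0ᴿ
  ≈0-by-sign {x} x≯0 x≮0 ε 0<ε with smallOrSigned x 0<ε
  ... | inj₁ small = eventually-map
    (λ {n} → subst (λ p → ∣ p ∣ < ε) (sym (+-identityʳ (seq x n)))) small
  ... | inj₂ (inj₁ x>0) = ⊥-elim (x≯0 x>0)
  ... | inj₂ (inj₂ x<0) = ⊥-elim (x≮0 x<0)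

  trichotomy₀ : ∀ x → ¬ ¬ (0ᴿ <ᴿ x ⊎ x ≈ᴿ 0ᴿ ⊎ x <ᴿ 0ᴿ)
  trichotomy₀ x k = k (inj₂ (inj₁ (≈0-by-sign {x} (λ p → k (inj₁ p)) (λ n → k (inj₂ (inj₂ n))))))

  ≈0-stable : ∀ {x} → ¬ ¬ x ≈ᴿ 0ᴿ → x ≈ᴿ 0ᴿ
  ≈0-stable {x} h = ≈0-by-sign {x} (λ p → h (positive≉0 {x} p)) (λ n → h (negative≉0 {x} n))

  x-y≈0 : ∀ {x y} → x ≈ᴿ y → x -ᴿ y ≈ᴿ 0ᴿ
  x-y≈0 {x} {y} = null-cong (λ n → sym (+-identityʳ (seq x n - seq y n)))

  ≈-x-y : ∀ {x y} → x -ᴿ y ≈ᴿ 0ᴿ → x ≈ᴿ y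
  ≈-x-y {x} {y} = null-cong (λ n → +-identityʳ (seq x n - seq y n))

  ℝ-stable : ∀ {x y} → ¬ ¬ x ≈ᴿ y → x ≈ᴿ y
  ℝ-stable {x} {y} h = ≈-x-y {x} {y} (≈0-stable {x -ᴿ y} (λ k → h (λ e → k (x-y≈0 {x} {y} e))))

  -- The refutation of `x ≈ᴿ 0ᴿ` carries no bound; under `¬ ¬` a bound away from zero can be had,
  -- and bounds of this kind multiply, which gives cancellation in ℝ.
  Apart : ℝ → Set
  Apart x = ∃[ δ ] 0ℚ < δ × Eventually λ n → δ ≤ ∣ seq x n ∣

  positive-apart : ∀ {x} → 0ᴿ <ᴿ x → Apart x
  positive-apart {x} (δ , 0<δ , pos) = δ , 0<δ , eventually-map
    (λ {n} h → ≤-trans (<⇒≤ (subst (_< seq x n) (+-identityˡ δ) h)) (p≤∣p∣ (seq x n))) pos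

  negative-apart : ∀ {x} → x <ᴿ 0ᴿ → Apart x
  negative-apart {x} (δ , 0<δ , neg) = δ , 0<δ , eventually-map (λ {n} h → begin
      δ ≤⟨ 0≤⇒≤ (<⇒≤ (<⇒0<- h)) (solve 2 (λ x d → :- x := d :+ (con 0ℚ :- (x :+ d))) refl
        (seq x n) δ) ⟩
      - seq x n      ≤⟨ p≤∣p∣ (- seq x n) ⟩
      ∣ - seq x n ∣  ≡⟨ ∣-p∣≡∣p∣ (seq x n) ⟩
      ∣ seq x n ∣    ∎) neg
    where open ≤-Reasoning
          open ℚ.+-*-Solver

  ≉0⇒apart : ∀ {x} → ¬ x ≈ᴿ 0ᴿ → ¬ ¬ Apart x
  ≉0⇒apart {x} x≉0 k = trichotomy₀ x λ where
    (inj₁ p)        → k (positive-apart {x} p)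
    (inj₂ (inj₁ z)) → x≉0 z
    (inj₂ (inj₂ n)) → k (negative-apart {x} n)

  apart⇒≉0 : ∀ {x} → Apart x → ¬ x ≈ᴿ 0ᴿ
  apart⇒≉0 {x} (δ , 0<δ , a) null with witness (eventually-zip _,_ a (null δ 0<δ))
  ... | n , δ≤ , <δ = <-irrefl refl
    (≤-<-trans δ≤ (subst (λ p → ∣ p ∣ < δ) (+-identityʳ (seq x n)) <δ))

  apart-* : ∀ {x y} → Apart x → Apart y → Apart (x *ᴿ y)
  apart-* {x} {y} (δ , 0<δ , a) (η , 0<η , b) = δ * η , 0<* 0<δ 0<η , eventually-zip (λ {n} p q →
    subst (δ * η ≤_) (sym (∣p*q∣≡∣p∣*∣q∣ (seq x n) (seq y n)))
      (*-mono-≤-nonNeg (<⇒≤ 0<η) (0≤∣p∣ (seq x n)) p q)) a b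

  ℝ-noZeroDivisors : ∀ {x y} → ¬ x ≈ᴿ 0ᴿ → x *ᴿ y ≈ᴿ 0ᴿ → y ≈ᴿ 0ᴿ
  ℝ-noZeroDivisors {x} {y} x≉0 xy≈0 = ≈0-stable {y} λ y≉0 → ≉0⇒apart {x} x≉0 λ a →
    ≉0⇒apart {y} y≉0 λ b →
    apart⇒≉0 {x *ᴿ y} (apart-* {x} {y} a b) xy≈0

open RealNumbers

-- Adjoining a square root of -1 to a commutative ring

module Complexification (R : CommutativeRing 0ℓ 0ℓ) where
  open CommutativeRing R
  open IntegerSolver R
  open RingProperties ring
  open SetoidReasoning setoid

  private
    Pair : Set
    Pair = Carrier × Carrier

  _≋_ : Pair → Pair → Set
  (a , b) ≋ (c , d) = a ≈ c × b ≈ d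

  infixl 6 _⊕_
  infixl 7 _⊗_
  _⊕_ _⊗_ : Pair → Pair → Pair
  (a , b) ⊕ (c , d) = a + c , b + d
  (a , b) ⊗ (c , d) = a * c - b * d , a * d + b * c

  ⊖_ : Pair → Pair
  ⊖ (a , b) = - a , - b

  ⊗-cong : ∀ {x y u v} → x ≋ y → u ≋ v → (x ⊗ u) ≋ (y ⊗ v)
  ⊗-cong (p , q) (r , s) = +-cong (*-cong p r) (-‿cong (*-cong q s)) , +-cong (*-cong p s)
    (*-cong q r)

  ⊗-assoc : ∀ x y z → (x ⊗ y ⊗ z) ≋ (x ⊗ (y ⊗ z))
  ⊗-assoc (a , b) (c , d) (e , f) =
      solve 6 (λ a b c d e f → (a :* c :- b :* d) :* e :- (a :* d :+ b :* c) :* f := a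
        :* (c :* e :- d :* f) :- b :* (c :* f :+ d :* e)) refl a b c d e f
    , solve 6 (λ a b c d e f → (a :* c :- b :* d) :* f :+ (a :* d :+ b :* c) :* e := a
      :* (c :* f :+ d :* e) :+ b :* (c :* e :- d :* f)) refl a b c d e f

  ⊗-comm : ∀ x y → (x ⊗ y) ≋ (y ⊗ x)
  ⊗-comm (a , b) (c , d) =
      +-cong (*-comm a c) (-‿cong (*-comm b d))
    , trans (+-comm (a * d) (b * c)) (+-cong (*-comm b c) (*-comm a d))

  ⊗-identityˡ : ∀ x → ((1# , 0#) ⊗ x) ≋ x
  ⊗-identityˡ (a , b) =
      (begin 1# * a - 0# * b ≈⟨ +-cong (*-identityˡ a) (-‿cong (zeroˡ b)) ⟩
             a - 0#          ≈⟨ trans (+-congˡ -0#≈0#) (+-identityʳ a) ⟩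
             a               ∎)
    , (begin 1# * b + 0# * a ≈⟨ +-cong (*-identityˡ b) (zeroˡ a) ⟩
             b + 0#          ≈⟨ +-identityʳ b ⟩
             b               ∎)

  ⊗-distribˡ : ∀ x y z → (x ⊗ (y ⊕ z)) ≋ (x ⊗ y ⊕ x ⊗ z)
  ⊗-distribˡ (a , b) (c , d) (e , f) =
      solve 6 (λ a b c d e f → a :* (c :+ e) :- b :* (d :+ f) := (a :* c :- b :* d)
        :+ (a :* e :- b :* f)) refl a b c d e f
    , solve 6 (λ a b c d e f → a :* (d :+ f) :+ b :* (c :+ e) := (a :* d :+ b :* c)
      :+ (a :* f :+ b :* e)) refl a b c d e f

  normSq-⊗ : ∀ a b c d → (a * c - b * d) * (a * c - b * d) + (a * d + b * c) * (a * d + b * c) ≈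
    (a * a + b * b) * (c * c + d * d)
  normSq-⊗ = solve 4 (λ a b c d →
    (a :* c :- b :* d) :* (a :* c :- b :* d) :+ (a :* d :+ b :* c) :* (a :* d :+ b :* c)
    := (a :* a :+ b :* b) :* (c :* c :+ d :* d)) refl

  commutativeRing : CommutativeRing 0ℓ 0ℓ
  commutativeRing = record
    { Carrier = Pair ; _≈_ = _≋_ ; _+_ = _⊕_ ; _*_ = _⊗_ ; -_ = ⊖_ ; 0# = 0# , 0# ; 1# = 1# , 0#
    ; isCommutativeRing = record
      { isRing = record
        { +-isAbelianGroup = record
          { isGroup = record
            { isMonoid = record
              { isSemigroup = record
                { isMagma = record
                  { isEquivalence = record
                    { refl  = refl , refl
                    ; sym   = λ (p , q) → sym p , sym q
                    ; trans = λ (p , q) (r , s) → trans p r , trans q s }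
                  ; ∙-cong = λ (p , q) (r , s) → +-cong p r , +-cong q s }
                ; assoc = λ (a , b) (c , d) (e , f) → +-assoc a c e , +-assoc b d f }
              ; identity = (λ (a , b) → +-identityˡ a , +-identityˡ b) ,
                (λ (a , b) → +-identityʳ a , +-identityʳ b) }
            ; inverse = (λ (a , b) → -‿inverseˡ a , -‿inverseˡ b) ,
              (λ (a , b) → -‿inverseʳ a , -‿inverseʳ b)
            ; ⁻¹-cong = λ (p , q) → -‿cong p , -‿cong q }
          ; comm = λ (a , b) (c , d) → +-comm a c , +-comm b d }
        ; *-cong = λ {x} {y} {u} {v} → ⊗-cong {x} {y} {u} {v}
        ; *-assoc = ⊗-assoc
        ; *-identity = ⊗-identityˡ , λ x → ≋-trans (⊗-comm x (1# , 0#)) (⊗-identityˡ x)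
        ; distrib = ⊗-distribˡ , λ x y z →
          ≋-trans (⊗-comm (y ⊕ z) x) (≋-trans (⊗-distribˡ x y z) (⊕-cong (⊗-comm x y) (⊗-comm x z)))
          }
      ; *-comm = ⊗-comm } }
    where
    ≋-trans : ∀ {x y z} → x ≋ y → y ≋ z → x ≋ z
    ≋-trans (p , q) (r , s) = trans p r , trans q s
    ⊕-cong : ∀ {x y u v} → x ≋ y → u ≋ v → (x ⊕ u) ≋ (y ⊕ v)
    ⊕-cong (p , q) (r , s) = +-cong p r , +-cong q s

private
  module ℝ² = Complexification ℝ-commutativeRing
  module ℝ²R = CommutativeRing ℝ².commutativeRing

  pair : ℂ → ℝ × ℝ
  pair z = re z , im z

ℂ-commutativeRing : CommutativeRing 0ℓ 0ℓ
ℂ-commutativeRing = record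
  { Carrier = ℂ ; _≈_ = _≈ᶜ_ ; _+_ = _+ᶜ_ ; _*_ = _*ᶜ_ ; -_ = λ z →
    (-ᴿ re z) +i (-ᴿ im z) ; 0# = 0ᴿ +i 0ᴿ ; 1# = 1ᴿ +i 0ᴿ
  ; isCommutativeRing = record
    { isRing = record
      { +-isAbelianGroup = record
        { isGroup = record
          { isMonoid = record
            { isSemigroup = record
              { isMagma = record
                { isEquivalence = record
                  { refl = λ {x} → ℝ²R.refl {pair x}
                  ; sym = λ {x y} → ℝ²R.sym {pair x} {pair y}
                  ; trans = λ {x y z} → ℝ²R.trans {pair x} {pair y} {pair z} }
                ; ∙-cong = λ {x y u v} → ℝ²R.+-cong {pair x} {pair y} {pair u} {pair v} }
              ; assoc = λ x y z → ℝ²R.+-assoc (pair x) (pair y) (pair z) }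
            ; identity = (λ x → ℝ²R.+-identityˡ (pair x)) , (λ x → ℝ²R.+-identityʳ (pair x)) }
          ; inverse = (λ x → ℝ²R.-‿inverseˡ (pair x)) , (λ x → ℝ²R.-‿inverseʳ (pair x))
          ; ⁻¹-cong = λ {x y} → ℝ²R.-‿cong {pair x} {pair y} }
        ; comm = λ x y → ℝ²R.+-comm (pair x) (pair y) }
      ; *-cong = λ {x y u v} → ℝ²R.*-cong {pair x} {pair y} {pair u} {pair v}
      ; *-assoc = λ x y z → ℝ²R.*-assoc (pair x) (pair y) (pair z)
      ; *-identity = (λ x → ℝ²R.*-identityˡ (pair x)) , (λ x → ℝ²R.*-identityʳ (pair x))
      ; distrib = (λ x y z → ℝ²R.distribˡ (pair x) (pair y) (pair z)) ,
        (λ x y z → ℝ²R.distribʳ (pair x) (pair y) (pair z)) }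
    ; *-comm = λ x y → ℝ²R.*-comm (pair x) (pair y) } }

module ℂR = CommutativeRing ℂ-commutativeRing

0ᶜ 1ᶜ : ℂ
0ᶜ = 0ᴿ +i 0ᴿ
1ᶜ = 1ᴿ +i 0ᴿ

ℂ-stable : ∀ {z w} → ¬ ¬ z ≈ᶜ w → z ≈ᶜ w
ℂ-stable {z} {w} h = ℝ-stable {re z} {re w} (λ k → h (λ e → k (proj₁ e))) , ℝ-stable {im z} {im w}
  (λ k → h (λ e → k (proj₂ e)))

normSq-cong : ∀ {z w} → z ≈ᶜ w → normSq z ≈ᴿ normSq w
normSq-cong {z} {w} (p , q) = ℝR.+-cong {re z *ᴿ re z} {re w *ᴿ re w} {im z *ᴿ im z} {im w *ᴿ im w}
  (ℝR.*-cong {re z} {re w} {re z} {re w} p p) (ℝR.*-cong {im z} {im w} {im z} {im w} q q)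

normSq-* : ∀ z w → normSq (z *ᶜ w) ≈ᴿ normSq z *ᴿ normSq w
normSq-* z w = ℝ².normSq-⊗ (re z) (im z) (re w) (im w)

-- A nonzero `x` keeps its square away from zero, and adding the square of `y` can only increase it.
sumOfSquares : ∀ {x y} → x *ᴿ x +ᴿ y *ᴿ y ≈ᴿ 0ᴿ → x ≈ᴿ 0ᴿ
sumOfSquares {x} {y} h = ≈0-stable {x} λ x≉0 → ≉0⇒apart {x} x≉0 λ a → sq (apart-* {x} {x} a a)
  where
  sq : Apart (x *ᴿ x) → ⊥
  sq (δ , 0<δ , a) = apart⇒≉0 {x *ᴿ x +ᴿ y *ᴿ y} (δ , 0<δ , eventually-map (λ {n} p → begin
      δ                                        ≤⟨ p ⟩
      ℚ.∣ seq x n ℚ.* seq x n ∣                ≡⟨ ℚ.0≤p⇒∣p∣≡p (square (seq x n)) ⟩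
      seq x n ℚ.* seq x n ≤⟨ ℚ.≤-trans (ℚ.≤-reflexive (≡.sym (ℚ.+-identityʳ _)))
        (ℚ.+-monoʳ-≤ (seq x n ℚ.* seq x n) (square (seq y n))) ⟩
      seq x n ℚ.* seq x n ℚ.+ seq y n ℚ.* seq y n ≤⟨ p≤∣p∣ _ ⟩
      ℚ.∣ seq x n ℚ.* seq x n ℚ.+ seq y n ℚ.* seq y n ∣ ∎) a) h
    where
    open ℚ.≤-Reasoning
    square : ∀ p → 0ℚ ℚ.≤ p ℚ.* p
    square p = ≡.subst (0ℚ ℚ.≤_) ∣p∣² (0≤* (ℚ.0≤∣p∣ p) (ℚ.0≤∣p∣ p))
      where
      ∣p∣² : ℚ.∣ p ∣ ℚ.* ℚ.∣ p ∣ ≡ p ℚ.* p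
      ∣p∣² with ℚ.∣p∣≡p∨∣p∣≡-p p
      ... | inj₁ eq = ≡.cong₂ ℚ._*_ eq eq
      ... | inj₂ eq = ≡.trans (≡.cong₂ ℚ._*_ eq eq)
        (solve 1 (λ p → :- p :* :- p := p :* p) ≡.refl p)
        where open ℚ.+-*-Solver

normSq≈0⇒≈0 : ∀ {z} → normSq z ≈ᴿ 0ᴿ → z ≈ᶜ 0ᶜ
normSq≈0⇒≈0 {z} h = sumOfSquares {re z} {im z} h
  , sumOfSquares {im z} {re z} (ℝR.trans {im z *ᴿ im z +ᴿ re z *ᴿ re z} {normSq z} {0ᴿ}
    (ℝR.+-comm (im z *ᴿ im z) (re z *ᴿ re z)) h)

≈0⇒normSq≈0 : ∀ {z} → z ≈ᶜ 0ᶜ → normSq z ≈ᴿ 0ᴿ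
≈0⇒normSq≈0 {z} h = ℝR.trans {normSq z} {normSq 0ᶜ} {0ᴿ} (normSq-cong {z} {0ᶜ} h)
  (pointwise {normSq 0ᶜ} {0ᴿ} λ _ → ≡.refl)

-- The squared norm is multiplicative and vanishes only at zero, so the property descends to ℝ.
ℂ-noZeroDivisors : ∀ {z w} → ¬ z ≈ᶜ 0ᶜ → z *ᶜ w ≈ᶜ 0ᶜ → w ≈ᶜ 0ᶜ
ℂ-noZeroDivisors {z} {w} z≉0 h = normSq≈0⇒≈0 {w}
  (ℝ-noZeroDivisors {normSq z} {normSq w} (λ e → z≉0 (normSq≈0⇒≈0 {z} e))
  (ℝR.trans {normSq z *ᴿ normSq w} {normSq (z *ᶜ w)} {0ᴿ}
    (ℝR.sym {normSq (z *ᶜ w)} {normSq z *ᴿ normSq w} (normSq-* z w)) (≈0⇒normSq≈0 {z *ᶜ w} h)))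

module ℂ× = Mult ℂR.semiring

fromℚᶜ : ℚ → ℂ
fromℚᶜ q = fromℚ q +i 0ᴿ

n×1 : ∀ n → (n ℂ×.× 1ᶜ) ≈ᶜ fromℚᶜ (nat n)
n×1 zero = ℂR.refl {0ᶜ}
n×1 (suc n) = ℂR.trans {1ᶜ +ᶜ (n ℂ×.× 1ᶜ)} {1ᶜ +ᶜ fromℚᶜ (nat n)} {fromℚᶜ (nat (suc n))}
  (ℂR.+-congˡ {1ᶜ} {n ℂ×.× 1ᶜ} {fromℚᶜ (nat n)} (n×1 n))
  (pointwise {re (1ᶜ +ᶜ fromℚᶜ (nat n))} {fromℚ (nat (suc n))} (λ _ → ≡.sym (nat-+ 1 n)) , pointwise
    {im (1ᶜ +ᶜ fromℚᶜ (nat n))} {0ᴿ} λ _ → ≡.refl)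

fromℚ≈0 : ∀ {q} → fromℚ q ≈ᴿ 0ᴿ → q ≡ 0ℚ
fromℚ≈0 {q} h with ℚ.<-cmp 0ℚ q
... | tri< 0<q _ _ = ⊥-elim (apart⇒≉0 {fromℚ q} (q , 0<q , always λ _ → p≤∣p∣ q) h)
... | tri≈ _ eq _  = ≡.sym eq
... | tri> _ _ q<0 = ⊥-elim (negative≉0 {fromℚ q}
  (ℚ.- (½ ℚ.* q) , ≡.subst (ℚ._< ℚ.- (½ ℚ.* q)) ≡.refl
  (ℚ.neg-antimono-< {½ ℚ.* q} {0ℚ} half<0) , always λ _ →
  ≡.subst (ℚ._< 0ℚ) (≡.trans (solve 1 (λ h → h := (h :+ h) :- h) ≡.refl (½ ℚ.* q))
  (≡.cong (ℚ._- ½ ℚ.* q) (halves q))) half<0) h)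
  where
  open ℚ.+-*-Solver
  half<0 : ½ ℚ.* q ℚ.< 0ℚ
  half<0 = ℚ.<-respʳ-≡ (ℚ.*-zeroʳ ½) (ℚ.*-monoʳ-<-pos ½ q<0)

ℂ-domain : CharZeroDomain
ℂ-domain = record
  { commutativeRing = ℂ-commutativeRing
  ; stable    = λ {z w} → ℂ-stable {z} {w}
  ; x*y≈0⇒y≈0 = λ {z w} → ℂ-noZeroDivisors {z} {w}
  ; 1+n•1≉0 = λ n h → ℚ.<-irrefl
    (≡.sym (fromℚ≈0 (proj₁ (ℂR.trans {fromℚᶜ (nat (suc n))} {suc n ℂ×.× 1ᶜ} {0ᶜ}
    (ℂR.sym {suc n ℂ×.× 1ᶜ} {fromℚᶜ (nat (suc n))} (n×1 (suc n))) h))))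
    (nat-mono-< {0} {suc n} ℕ.z<s)
  }

-- The exponential series

private
  module ℚ^ = Exp (CommutativeRing.semiring ℚ.+-*-commutativeRing)
  module ℚ^* = CExp (CommutativeRing.commutativeSemiring ℚ.+-*-commutativeRing)
open ℚ^ using () renaming (_^_ to _^ℚ_)

^ℚ-pos : ∀ {p} → 0ℚ ℚ.< p → ∀ n → 0ℚ ℚ.< p ^ℚ n
^ℚ-pos 0<p zero    = 0<1
^ℚ-pos 0<p (suc n) = 0<* 0<p (^ℚ-pos 0<p n)

^ℚ-nonNeg : ∀ {p} → 0ℚ ℚ.≤ p → ∀ n → 0ℚ ℚ.≤ p ^ℚ n
^ℚ-nonNeg 0≤p zero    = ℚ.<⇒≤ 0<1
^ℚ-nonNeg 0≤p (suc n) = 0≤* 0≤p (^ℚ-nonNeg 0≤p n)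

^ℚ-mono : ∀ {p q} → 0ℚ ℚ.≤ p → p ℚ.≤ q → ∀ n → p ^ℚ n ℚ.≤ q ^ℚ n
^ℚ-mono 0≤p p≤q zero    = ℚ.≤-refl
^ℚ-mono 0≤p p≤q (suc n) = *-mono-≤-nonNeg (^ℚ-nonNeg 0≤p n) (ℚ.≤-trans 0≤p p≤q) p≤q
  (^ℚ-mono 0≤p p≤q n)

nat-^ : ∀ m n → nat (m ℕ.^ n) ≡ nat m ^ℚ n
nat-^ m zero    = ≡.refl
nat-^ m (suc n) = ≡.trans (nat-* m (m ℕ.^ n)) (≡.cong (nat m ℚ.*_) (nat-^ m n))

0≤nat : ∀ n → 0ℚ ℚ.≤ nat n
0≤nat n = nat-mono-≤ {0} {n} ℕ.z≤n

1/!-inverse : ∀ k → nat (k !) ℚ.* 1/ k ! ≡ 1ℚ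
1/!-inverse k = lemma (k !) {{k ℕ.!≢0}}
  where
  lemma : ∀ n .{{_ : ℕ.NonZero n}} → nat n ℚ.* (+ 1 ℚ./ n) ≡ 1ℚ
  lemma n@(suc n-1) = ℚ.toℚᵘ-injective (begin
    ℚ.toℚᵘ (nat n ℚ.* (+ 1 ℚ./ n))               ≈⟨ ℚ.toℚᵘ-homo-* (nat n) (+ 1 ℚ./ n) ⟩
    ℚ.toℚᵘ (nat n) ℚᵘ.* ℚ.toℚᵘ (+ 1 ℚ./ n)
      ≈⟨ ℚᵘ.*-cong (ℚ.toℚᵘ-fromℚᵘ (ℚᵘ.mkℚᵘ (+ n) 0)) (ℚ.toℚᵘ-fromℚᵘ (ℚᵘ.mkℚᵘ (+ 1) n-1)) ⟩
    ℚᵘ.mkℚᵘ (+ n) 0 ℚᵘ.* ℚᵘ.mkℚᵘ (+ 1) n-1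
      ≈⟨ ℚᵘ.*≡* (≡.cong +_ (≡.trans (ℕ.*-identityʳ _)
      (≡.trans (ℕ.*-identityʳ n) (≡.trans (≡.sym (ℕ.*-identityˡ n))
      (≡.sym (ℕ.*-identityˡ (1 ℕ.* n))))))) ⟩
    ℚᵘ.1ℚᵘ                                       ∎)
    where
    open ℚᵘ.≃-Reasoning

0<1/! : ∀ k → 0ℚ ℚ.< 1/ k !
0<1/! k = ℚ.*-cancelˡ-<-nonNeg (nat (k !)) {{ℚ.nonNegative (0≤nat (k !))}}
  (≡.subst₂ ℚ._<_ (≡.sym (ℚ.*-zeroʳ (nat (k !)))) (≡.sym (1/!-inverse k)) 0<1)

1/!-unique : ∀ k {p q} → nat (k !) ℚ.* p ≡ nat (k !) ℚ.* q → p ≡ q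
1/!-unique k {p} {q} eq = begin
  p                                 ≡⟨ one p ⟨
  1/ k ! ℚ.* (nat (k !) ℚ.* p)      ≡⟨ ≡.cong (1/ k ! ℚ.*_) eq ⟩
  1/ k ! ℚ.* (nat (k !) ℚ.* q)      ≡⟨ one q ⟩
  q                                 ∎
  where
  open ≡.≡-Reasoning
  one : ∀ r → 1/ k ! ℚ.* (nat (k !) ℚ.* r) ≡ r
  one r = ≡.trans (≡.sym (ℚ.*-assoc (1/ k !) (nat (k !)) r))
    (≡.trans (≡.cong (ℚ._* r) (≡.trans (ℚ.*-comm (1/ k !) (nat (k !))) (1/!-inverse k)))
    (ℚ.*-identityˡ r))

choose/! : ∀ m k → k ℕ.≤ m → 1/ m ! ℚ.* nat (m C k) ≡ 1/ k ! ℚ.* 1/ (m ℕ.∸ k) !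
choose/! m k k≤m = 1/!-unique m (begin
  nat (m !) ℚ.* (1/ m ! ℚ.* nat (m C k)) ≡⟨ ℚ.*-assoc (nat (m !)) (1/ m !) (nat (m C k)) ⟨
  nat (m !) ℚ.* 1/ m ! ℚ.* nat (m C k)                ≡⟨ ≡.cong (ℚ._* nat (m C k)) (1/!-inverse m) ⟩
  1ℚ ℚ.* nat (m C k)                                  ≡⟨ ℚ.*-identityˡ (nat (m C k)) ⟩
  nat (m C k) ≡⟨ solve 1 (λ c → c := c :* (con 1ℚ :* con 1ℚ)) ≡.refl (nat (m C k)) ⟩
  nat (m C k) ℚ.* (1ℚ ℚ.* 1ℚ) ≡⟨ ≡.cong₂ (λ a b → nat (m C k) ℚ.* (a ℚ.* b)) (1/!-inverse k)
    (1/!-inverse (m ℕ.∸ k)) ⟨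
  nat (m C k) ℚ.* (nat (k !) ℚ.* 1/ k ! ℚ.* (nat ((m ℕ.∸ k) !) ℚ.* 1/ (m ℕ.∸ k) !))
    ≡⟨ solve 5 (λ c a x b y → c :* (a :* x :* (b :* y)) := (c :* (a :* b)) :* (x :* y)) ≡.refl
      (nat (m C k)) (nat (k !)) (1/ k !) (nat ((m ℕ.∸ k) !)) (1/ (m ℕ.∸ k) !) ⟩
  nat (m C k) ℚ.* (nat (k !) ℚ.* nat ((m ℕ.∸ k) !)) ℚ.* (1/ k ! ℚ.* 1/ (m ℕ.∸ k) !)
    ≡⟨ ≡.cong (ℚ._* (1/ k ! ℚ.* 1/ (m ℕ.∸ k) !))
      (≡.trans (≡.cong (nat (m C k) ℚ.*_) (≡.sym (nat-* (k !) ((m ℕ.∸ k) !))))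
      (≡.trans (≡.sym (nat-* (m C k) (k ! ℕ.* (m ℕ.∸ k) !))) (≡.cong nat m!≡))) ⟩
  nat (m !) ℚ.* (1/ k ! ℚ.* 1/ (m ℕ.∸ k) !)           ∎)
  where
  open ≡.≡-Reasoning
  open ℚ.+-*-Solver
  m!≡ : (m C k) ℕ.* (k ! ℕ.* (m ℕ.∸ k) !) ≡ m !
  m!≡ = ≡.trans (≡.cong (ℕ._* (k ! ℕ.* (m ℕ.∸ k) !)) (nCk≡n!/k![n-k]! k≤m))
    (ℕ.m/n*n≡m (k![n∸k]!∣n! k≤m))
    where instance _ = (k) ℕ.!* (m ℕ.∸ k) !≢0

-- The rate is a cube of ½: in `errorBound` two factors `½ ^ k` absorb the two factors `k`, and the
-- third tends to zero.
⅛ : ℚ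
⅛ = ½ ℚ.* (½ ℚ.* ½)

0<⅛ : 0ℚ ℚ.< ⅛
0<⅛ = 0<* 0<½ (0<* 0<½ 0<½)

-- Up to `j = b` the factor `b ^ b` alone suffices; from there on each further factor `b` is at most
-- the new factor of the factorial.
b^j≤b^b*j! : ∀ b j → 0 ℕ.< b → b ℕ.^ j ℕ.≤ b ℕ.^ b ℕ.* j !
b^j≤b^b*j! b@(suc _) zero 0<b = ℕ.≤-trans (ℕ.>-nonZero⁻¹ (b ℕ.^ b) {{ℕ.m^n≢0 b b}})
  (ℕ.≤-reflexive (≡.sym (ℕ.*-identityʳ (b ℕ.^ b))))
b^j≤b^b*j! b@(suc _) (suc j) 0<b with ℕ.≤-total b (suc j)
... | inj₁ b≤1+j = begin
  b ℕ.* b ℕ.^ j                     ≤⟨ ℕ.*-mono-≤ b≤1+j (b^j≤b^b*j! b j 0<b) ⟩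
  suc j ℕ.* (b ℕ.^ b ℕ.* j !)       ≡⟨ ℕ.*-assoc (suc j) (b ℕ.^ b) (j !) ⟨
  suc j ℕ.* b ℕ.^ b ℕ.* j !         ≡⟨ ≡.cong (ℕ._* j !) (ℕ.*-comm (suc j) (b ℕ.^ b)) ⟩
  b ℕ.^ b ℕ.* suc j ℕ.* j !         ≡⟨ ℕ.*-assoc (b ℕ.^ b) (suc j) (j !) ⟩
  b ℕ.^ b ℕ.* (suc j) !             ∎
  where open ℕ.≤-Reasoning
... | inj₂ 1+j≤b = ℕ.≤-trans (ℕ.^-monoʳ-≤ b 1+j≤b) (ℕ.m≤m*n (b ℕ.^ b) (suc j !) {{suc j ℕ.!≢0}})

-- c^j = (8c)^j / 8^j, and b^j ≤ b^b j! for b = 8c.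
termBound : ℕ → ℚ
termBound c = nat ((8 ℕ.* c) ℕ.^ (8 ℕ.* c))

1/!-bound : ∀ c j → 0 ℕ.< c → 1/ j ! ℚ.* nat c ^ℚ j ℚ.≤ termBound c ℚ.* ⅛ ^ℚ j
1/!-bound c j 0<c = begin
  1/ j ! ℚ.* nat c ^ℚ j                       ≡⟨ ≡.cong (1/ j ! ℚ.*_) c^j ⟩
  1/ j ! ℚ.* (nat (b ℕ.^ j) ℚ.* ⅛ ^ℚ j)       ≡⟨ ℚ.*-assoc (1/ j !) (nat (b ℕ.^ j)) (⅛ ^ℚ j) ⟨
  1/ j ! ℚ.* nat (b ℕ.^ j) ℚ.* ⅛ ^ℚ j
    ≤⟨ ℚ.*-monoʳ-≤-nonNeg (⅛ ^ℚ j) {{ℚ.nonNegative (^ℚ-nonNeg (ℚ.<⇒≤ 0<⅛) j)}} bound ⟩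
  termBound c ℚ.* ⅛ ^ℚ j                      ∎
  where
  open ℚ.≤-Reasoning
  b : ℕ
  b = 8 ℕ.* c
  c^j : nat c ^ℚ j ≡ nat (b ℕ.^ j) ℚ.* ⅛ ^ℚ j
  c^j = ≡.trans (ℚ^.^-congˡ j {nat c} {nat b ℚ.* ⅛} (≡.sym (≡.trans (≡.cong (ℚ._* ⅛) (nat-* 8 c))
          (ℚ.+-*-Solver.solve 1 (λ c →
            ℚ.+-*-Solver._:*_ (ℚ.+-*-Solver._:*_ (ℚ.+-*-Solver.con (nat 8)) c)
            (ℚ.+-*-Solver.con ⅛) ℚ.+-*-Solver.:= c) ≡.refl (nat c)))))
    (≡.trans (ℚ^*.^-distrib-* (nat b) ⅛ j) (≡.cong (ℚ._* ⅛ ^ℚ j) (≡.sym (nat-^ b j))))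
  bound : 1/ j ! ℚ.* nat (b ℕ.^ j) ℚ.≤ termBound c
  bound = begin
    1/ j ! ℚ.* nat (b ℕ.^ j) ≤⟨ ℚ.*-monoˡ-≤-nonNeg (1/ j !) {{ℚ.nonNegative (ℚ.<⇒≤ (0<1/! j))}}
      (nat-mono-≤ (b^j≤b^b*j! b j (ℕ.*-mono-< {0} {8} {0} {c} ℕ.z<s 0<c))) ⟩
    1/ j ! ℚ.* nat (b ℕ.^ b ℕ.* j !)          ≡⟨ ≡.cong (1/ j ! ℚ.*_) (nat-* (b ℕ.^ b) (j !)) ⟩
    1/ j ! ℚ.* (termBound c ℚ.* nat (j !))
      ≡⟨ solve 3 (λ x t n → x :* (t :* n) := t :* (n :* x)) ≡.refl (1/ j !) (termBound c)
      (nat (j !)) ⟩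
    termBound c ℚ.* (nat (j !) ℚ.* 1/ j !)    ≡⟨ ≡.cong (termBound c ℚ.*_) (1/!-inverse j) ⟩
    termBound c ℚ.* 1ℚ                        ≡⟨ ℚ.*-identityʳ _ ⟩
    termBound c                               ∎
    where open ℚ.+-*-Solver

nat*½^≤1 : ∀ k → nat k ℚ.* ½ ^ℚ k ℚ.≤ 1ℚ
nat*½^≤1 k = begin
  nat k ℚ.* ½ ^ℚ k ≤⟨ ℚ.*-monoʳ-≤-nonNeg (½ ^ℚ k) {{ℚ.nonNegative (^ℚ-nonNeg (ℚ.<⇒≤ 0<½) k)}}
    (nat-mono-≤ (k≤2^k k)) ⟩
  nat (2 ℕ.^ k) ℚ.* ½ ^ℚ k  ≡⟨ ≡.cong (ℚ._* ½ ^ℚ k) (nat-^ 2 k) ⟩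
  nat 2 ^ℚ k ℚ.* ½ ^ℚ k     ≡⟨ ℚ^*.^-distrib-* (nat 2) ½ k ⟨
  1ℚ ^ℚ k                   ≡⟨ 1^k k ⟩
  1ℚ                        ∎
  where
  open ℚ.≤-Reasoning
  1^k : ∀ k → 1ℚ ^ℚ k ≡ 1ℚ
  1^k zero = ≡.refl
  1^k (suc k) = ≡.trans (ℚ.*-identityˡ _) (1^k k)
  k≤2^k : ∀ k → k ℕ.≤ 2 ℕ.^ k
  k≤2^k zero = ℕ.z≤n
  k≤2^k (suc k) = ≡.subst (suc k ℕ.≤_) (≡.cong (2 ℕ.^ k ℕ.+_) (≡.sym (ℕ.+-identityʳ (2 ℕ.^ k))))
    (ℕ.+-mono-≤ (ℕ.>-nonZero⁻¹ (2 ℕ.^ k) {{ℕ.m^n≢0 2 k}}) (k≤2^k k))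

-- In a product of two partial sums with `k` terms, fewer than `k * k` products have total index `k`
-- or more; each of them is at most `X` times `⅛ ^ k`.
errorBound : ℚ → ℕ → ℚ
errorBound X k = nat k ℚ.* (nat k ℚ.* (X ℚ.* ⅛ ^ℚ k))

errorBound→0 : ∀ X → 0ℚ ℚ.≤ X → ∀ {ε} → 0ℚ ℚ.< ε → ∃[ K ] ∀ k → K ℕ.≤ k → errorBound X k ℚ.< ε
errorBound→0 X 0≤X {ε} 0<ε with archimedean-scaled X 0<ε
... | K , X<Kε = K , λ k K≤k → let h = ½ ^ℚ k ; n = nat k in begin-strict
  n ℚ.* (n ℚ.* (X ℚ.* ⅛ ^ℚ k))                ≡⟨ ≡.cong (λ e → n ℚ.* (n ℚ.* (X ℚ.* e))) (⅛^ k) ⟩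
  n ℚ.* (n ℚ.* (X ℚ.* (h ℚ.* (h ℚ.* h))))
    ≡⟨ solve 3 (λ n c h → n :* (n :* (c :* (h :* (h :* h)))) := (n :* h) :* ((n :* h) :* (c :* h)))
    ≡.refl n X h ⟩
  (n ℚ.* h) ℚ.* ((n ℚ.* h) ℚ.* (X ℚ.* h))     ≤⟨ below1 k (0≤* (0≤nh k) (0≤Xh k)) ⟩
  (n ℚ.* h) ℚ.* (X ℚ.* h)                     ≤⟨ below1 k (0≤Xh k) ⟩
  X ℚ.* h <⟨ ℚ.*-monoˡ-<-pos h {{ℚ.positive (^ℚ-pos 0<½ k)}} X<Kε ⟩
  nat K ℚ.* ε ℚ.* h ≤⟨ ℚ.*-monoʳ-≤-nonNeg h {{ℚ.nonNegative (0≤h k)}}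
    (ℚ.*-monoʳ-≤-nonNeg ε {{ℚ.nonNegative (ℚ.<⇒≤ 0<ε)}} (nat-mono-≤ K≤k)) ⟩
  n ℚ.* ε ℚ.* h ≡⟨ solve 3 (λ n e h → n :* e :* h := (n :* h) :* e) ≡.refl n ε h ⟩
  (n ℚ.* h) ℚ.* ε                             ≤⟨ below1 k (ℚ.<⇒≤ 0<ε) ⟩
  ε                                           ∎
  where
  open ℚ.≤-Reasoning
  open ℚ.+-*-Solver
  0≤h : ∀ k → 0ℚ ℚ.≤ ½ ^ℚ k
  0≤h = ^ℚ-nonNeg (ℚ.<⇒≤ 0<½)
  0≤nh : ∀ k → 0ℚ ℚ.≤ nat k ℚ.* ½ ^ℚ k
  0≤nh k = 0≤* (0≤nat k) (0≤h k)
  0≤Xh : ∀ k → 0ℚ ℚ.≤ X ℚ.* ½ ^ℚ k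
  0≤Xh k = 0≤* 0≤X (0≤h k)
  below1 : ∀ k {p} → 0ℚ ℚ.≤ p → nat k ℚ.* ½ ^ℚ k ℚ.* p ℚ.≤ p
  below1 k {p} 0≤p = ℚ.≤-trans (ℚ.*-monoʳ-≤-nonNeg p {{ℚ.nonNegative 0≤p}} (nat*½^≤1 k))
    (ℚ.≤-reflexive (ℚ.*-identityˡ p))
  ⅛^ : ∀ k → ⅛ ^ℚ k ≡ ½ ^ℚ k ℚ.* (½ ^ℚ k ℚ.* ½ ^ℚ k)
  ⅛^ k = ≡.trans (ℚ^*.^-distrib-* ½ (½ ℚ.* ½) k) (≡.cong (½ ^ℚ k ℚ.*_) (ℚ^*.^-distrib-* ½ ½ k))

-- Partial sums of the exponential series in a normed algebra over ℚ

record NormedℚAlgebra : Set₁ where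
  field
    commutativeRing : CommutativeRing 0ℓ 0ℓ
  open CommutativeRing commutativeRing public
  open Mult semiring public using () renaming (_×_ to _•_)
  field
    ∥_∥      : Carrier → ℚ
    ∥∥-cong  : ∀ {x y} → x ≈ y → ∥ x ∥ ≡ ∥ y ∥
    ∥x∥≥0    : ∀ x → 0ℚ ℚ.≤ ∥ x ∥
    ∥0∥≡0    : ∥ 0# ∥ ≡ 0ℚ
    ∥1∥≤1    : ∥ 1# ∥ ℚ.≤ 1ℚ
    ∥x+y∥≤   : ∀ x y → ∥ x + y ∥ ℚ.≤ ∥ x ∥ ℚ.+ ∥ y ∥
    ∥x*y∥≤   : ∀ x y → ∥ x * y ∥ ℚ.≤ ∥ x ∥ ℚ.* ∥ y ∥
    ∥-x∥≡    : ∀ x → ∥ - x ∥ ≡ ∥ x ∥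
    ofℚ      : ℚ → Carrier
    ofℚ-*    : ∀ p q → ofℚ (p ℚ.* q) ≈ ofℚ p * ofℚ q
    ofℚ-nat  : ∀ n → ofℚ (nat n) ≈ n • 1#
    ∥ofℚ∥    : ∀ {q} → 0ℚ ℚ.≤ q → ∥ ofℚ q ∥ ℚ.≤ q

module ExponentialSums (A : NormedℚAlgebra) where
  open NormedℚAlgebra A
  open IntegerSolver commutativeRing
  open RingProperties ring
  open Mult semiring using (×-congʳ; ×-assoc-*)
  open Exp semiring using (_^_)
  open Sum semiring using (sum; sum-cong-≋; *-distribˡ-sum)
  open Binomial commutativeSemiring using (binomialTerm; theorem)
  open SetoidReasoning setoid

  Sequence : Set
  Sequence = ℕ → Carrier

  partialSum : Sequence → ℕ → Carrier
  partialSum u zero    = 0#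
  partialSum u (suc k) = u 0 + partialSum (u ∘ suc) k

  convolution : Sequence → Sequence → Sequence
  convolution u v zero    = u 0 * v 0
  convolution u v (suc m) = u 0 * v (suc m) + convolution (u ∘ suc) v m

  -- The products `u i * v j` with `i + j < k`, collected by rows; `convolution` collects the same
  -- products by antidiagonals.
  triangle : Sequence → Sequence → ℕ → Carrier
  triangle u v zero    = 0#
  triangle u v (suc k) = u 0 * partialSum v (suc k) + triangle (u ∘ suc) v k

  partialSum-cong : ∀ {u v} → (∀ j → u j ≈ v j) → ∀ k → partialSum u k ≈ partialSum v k
  partialSum-cong h zero    = refl
  partialSum-cong h (suc k) = +-cong (h 0) (partialSum-cong (h ∘ suc) k)

  partialSum-linear : ∀ a u v k →
    partialSum (λ j → a * u j + v j) k ≈ a * partialSum u k + partialSum v k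
  partialSum-linear a u v zero    = sym (trans (+-congʳ (zeroʳ a)) (+-identityˡ 0#))
  partialSum-linear a u v (suc k) = trans (+-congˡ (partialSum-linear a (u ∘ suc) (v ∘ suc) k))
    (solve 5 (λ a u U v V → (a :* u :+ v) :+ (a :* U :+ V) := a :* (u :+ U) :+ (v :+ V)) refl a
      (u 0) _ (v 0) _)

  partialSum-convolution : ∀ u v k → partialSum (convolution u v) k ≈ triangle u v k
  partialSum-convolution u v zero    = refl
  partialSum-convolution u v (suc k) = begin
    u 0 * v 0 + partialSum (λ j → u 0 * v (suc j) + convolution (u ∘ suc) v j) k
      ≈⟨ +-congˡ (partialSum-linear (u 0) (v ∘ suc) (convolution (u ∘ suc) v) k) ⟩
    u 0 * v 0 + (u 0 * partialSum (v ∘ suc) k + partialSum (convolution (u ∘ suc) v) k)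
      ≈⟨ +-congˡ (+-congˡ (partialSum-convolution (u ∘ suc) v k)) ⟩
    u 0 * v 0 + (u 0 * partialSum (v ∘ suc) k + triangle (u ∘ suc) v k)
      ≈⟨ solve 4 (λ u v V t → u :* v :+ (u :* V :+ t) := u :* (v :+ V) :+ t) refl (u 0) (v 0) _ _ ⟩
    u 0 * partialSum v (suc k) + triangle (u ∘ suc) v k ∎

  Geometric : ℚ → Sequence → Set
  Geometric X u = ∀ j → ∥ u j ∥ ℚ.≤ X ℚ.* ⅛ ^ℚ j

  geometric-suc : ∀ {X u} → Geometric X u → Geometric (X ℚ.* ⅛) (u ∘ suc)
  geometric-suc {X} {u} h j = ≡.subst (∥ u (suc j) ∥ ℚ.≤_) (≡.sym (ℚ.*-assoc X ⅛ (⅛ ^ℚ j)))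
    (h (suc j))

  0≤X⅛ : ∀ {X} → 0ℚ ℚ.≤ X → 0ℚ ℚ.≤ X ℚ.* ⅛
  0≤X⅛ 0≤X = 0≤* 0≤X (ℚ.<⇒≤ 0<⅛)

  X⅛≤X : ∀ {X} → 0ℚ ℚ.≤ X → X ℚ.* ⅛ ℚ.≤ X
  X⅛≤X {X} 0≤X = ℚ.≤-trans (ℚ.*-monoˡ-≤-nonNeg X {{ℚ.nonNegative 0≤X}} ⅛≤1)
    (ℚ.≤-reflexive (ℚ.*-identityʳ X))
    where
    ⅛≤1 : ⅛ ℚ.≤ 1ℚ
    ⅛≤1 = ℚ.≤-trans (ℚ.<⇒≤ (0<⇒< {⅛} {1ℚ} {nat 7 ℚ.* ⅛}
      (0<* (nat-mono-< {0} {7} ℕ.z<s) 0<⅛) ≡.refl)) ℚ.≤-refl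

  nat-suc* : ∀ k p → p ℚ.+ nat k ℚ.* p ≡ nat (suc k) ℚ.* p
  nat-suc* k p = ≡.trans (solveℚ p (nat k)) (≡.cong (ℚ._* p) (≡.sym (nat-+ 1 k)))
    where
    solveℚ : ∀ p n → p ℚ.+ n ℚ.* p ≡ (1ℚ ℚ.+ n) ℚ.* p
    solveℚ = S.solve 2 (λ p n → p S.:+ n S.:* p S.:= (S.con 1ℚ S.:+ n) S.:* p) ≡.refl

  partialSum-bound : ∀ {X v} → 0ℚ ℚ.≤ X → Geometric X v → ∀ l → ∥ partialSum v l ∥ ℚ.≤ nat l ℚ.* X
  partialSum-bound {X} {v} 0≤X h zero    = ℚ.≤-reflexive (≡.trans ∥0∥≡0 (≡.sym (ℚ.*-zeroˡ X)))
  partialSum-bound {X} {v} 0≤X h (suc l) = ℚR.begin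
    ∥ v 0 + partialSum (v ∘ suc) l ∥               ℚR.≤⟨ ∥x+y∥≤ _ _ ⟩
    ∥ v 0 ∥ ℚ.+ ∥ partialSum (v ∘ suc) l ∥
      ℚR.≤⟨ ℚ.+-mono-≤ (ℚ.≤-trans (h 0) (ℚ.≤-reflexive (ℚ.*-identityʳ X)))
                                                       (ℚ.≤-trans (partialSum-bound (0≤X⅛ 0≤X)
                                                         (geometric-suc {X} h) l)
                                                         (ℚ.*-monoˡ-≤-nonNeg (nat l)
                                                           {{ℚ.nonNegative (0≤nat l)}} (X⅛≤X 0≤X)))
                                                           ⟩
    X ℚ.+ nat l ℚ.* X                              ℚR.≡⟨ nat-suc* l X ⟩
    nat (suc l) ℚ.* X                              ℚR.∎
    where module ℚR = ℚ.≤-Reasoning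

  -- At most `l` terms remain and each is below `X` times `⅛ ^ k`; this crude count spares the
  -- summation of a geometric series.
  tail-bound : ∀ {X v} → 0ℚ ℚ.≤ X → Geometric X v → ∀ {k l} → k ℕ.≤ l →
    ∥ partialSum v l - partialSum v k ∥ ℚ.≤ nat l ℚ.* (X ℚ.* ⅛ ^ℚ k)
  tail-bound {X} {v} 0≤X h {zero} {l} ℕ.z≤n = ℚ.≤-trans
    (ℚ.≤-reflexive (∥∥-cong (trans (+-congˡ -0#≈0#) (+-identityʳ _))))
    (ℚ.≤-trans (partialSum-bound 0≤X h l)
      (ℚ.≤-reflexive (≡.cong (nat l ℚ.*_) (≡.sym (ℚ.*-identityʳ X)))))
  tail-bound {X} {v} 0≤X h {suc k} {suc l} (ℕ.s≤s k≤l) = ℚR.begin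
    ∥ v 0 + V l - (v 0 + V k) ∥ ℚR.≡⟨ ∥∥-cong
      (solve 3 (λ v l k → (v :+ l) :- (v :+ k) := l :- k) refl (v 0) (V l) (V k)) ⟩
    ∥ V l - V k ∥                          ℚR.≤⟨ tail-bound (0≤X⅛ 0≤X) (geometric-suc {X} h) k≤l ⟩
    nat l ℚ.* (X ℚ.* ⅛ ℚ.* ⅛ ^ℚ k)
      ℚR.≤⟨ ℚ.*-monoʳ-≤-nonNeg _ {{ℚ.nonNegative (0≤* (0≤X⅛ 0≤X) (^ℚ-nonNeg (ℚ.<⇒≤ 0<⅛) k))}}
      (nat-mono-≤ (ℕ.n≤1+n l)) ⟩
    nat (suc l) ℚ.* (X ℚ.* ⅛ ℚ.* ⅛ ^ℚ k) ℚR.≡⟨ ≡.cong (nat (suc l) ℚ.*_) (ℚ.*-assoc X ⅛ (⅛ ^ℚ k)) ⟩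
    nat (suc l) ℚ.* (X ℚ.* ⅛ ^ℚ suc k)     ℚR.∎
    where
    module ℚR = ℚ.≤-Reasoning
    V : ℕ → Carrier
    V = partialSum (v ∘ suc)

  -- Row `i` of the difference is `u i` times a tail of `v` that starts at `k ∸ i`, so the two decay
  -- rates combine to `⅛ ^ k`. Stripping off rows lowers `k` and leaves the row length fixed, hence
  -- the separate `l`.
  square-triangle : ∀ {X Y u v} → 0ℚ ℚ.≤ X → 0ℚ ℚ.≤ Y → Geometric X u → Geometric Y v → ∀ {k l} →
    k ℕ.≤ l →
    ∥ partialSum u k * partialSum v l - triangle u v k ∥ ℚ.≤ nat
      k ℚ.* (nat l ℚ.* (X ℚ.* Y ℚ.* ⅛ ^ℚ k))
  square-triangle {X} {Y} {u} {v} 0≤X 0≤Y hu hv {zero} {l} _ = ℚ.≤-reflexive (≡.trans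
    (≡.trans (∥∥-cong (trans (+-cong (zeroˡ _) -0#≈0#) (+-identityʳ 0#))) ∥0∥≡0)
    (≡.sym (ℚ.*-zeroˡ (nat l ℚ.* (X ℚ.* Y ℚ.* 1ℚ)))))
  square-triangle {X} {Y} {u} {v} 0≤X 0≤Y hu hv {suc k} {l} k<l = ℚR.begin
    ∥ (u 0 + U) * V l - (u 0 * V (suc k) + T) ∥
      ℚR.≡⟨ ∥∥-cong (solve 5 (λ u U Vl Vk T →
        (u :+ U) :* Vl :- (u :* Vk :+ T) := u :* (Vl :- Vk) :+ (U :* Vl :- T)) refl (u 0) U (V l)
        (V (suc k)) T) ⟩
    ∥ u 0 * (V l - V (suc k)) + (U * V l - T) ∥
      ℚR.≤⟨ ℚ.≤-trans (∥x+y∥≤ _ _) (ℚ.+-monoˡ-≤ ∥ U * V l - T ∥ (∥x*y∥≤ _ _)) ⟩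
    ∥ u 0 ∥ ℚ.* ∥ V l - V (suc k) ∥ ℚ.+ ∥ U * V l - T ∥
      ℚR.≤⟨ ℚ.+-mono-≤ (*-mono-≤-nonNeg (∥x∥≥0 _) 0≤X
        (ℚ.≤-trans (hu 0) (ℚ.≤-reflexive (ℚ.*-identityʳ X))) (tail-bound 0≤Y hv k<l))
           (square-triangle (0≤X⅛ 0≤X) 0≤Y (geometric-suc {X} hu) hv (ℕ.<⇒≤ k<l)) ⟩
    X ℚ.* (nat l ℚ.* (Y ℚ.* (⅛ ℚ.* ⅛ ^ℚ k))) ℚ.+ nat k ℚ.* (nat l ℚ.* (X ℚ.* ⅛ ℚ.* Y ℚ.* ⅛ ^ℚ k))
      ℚR.≡⟨ S.solve 6 (λ X l Y e q k →
        X S.:* (l S.:* (Y S.:* (e S.:* q))) S.:+ k S.:* (l S.:* (X S.:* e S.:* Y S.:* q))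
             S.:= l S.:* (X S.:* Y S.:* (e S.:* q)) S.:+ k S.:* (l S.:* (X S.:* Y S.:* (e S.:* q))))
               ≡.refl X (nat l) Y ⅛ (⅛ ^ℚ k) (nat k) ⟩
    nat l ℚ.* (X ℚ.* Y ℚ.* ⅛ ^ℚ suc k) ℚ.+ nat k ℚ.* (nat l ℚ.* (X ℚ.* Y ℚ.* ⅛ ^ℚ suc k))
      ℚR.≡⟨ nat-suc* k _ ⟩
    nat (suc k) ℚ.* (nat l ℚ.* (X ℚ.* Y ℚ.* ⅛ ^ℚ suc k)) ℚR.∎
    where
    module ℚR = ℚ.≤-Reasoning
    U T : Carrier
    U = partialSum (u ∘ suc) k
    T = triangle (u ∘ suc) v k
    V : ℕ → Carrier
    V = partialSum v

  expTerm : Carrier → Sequence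
  expTerm z j = ofℚ (1/ j !) * z ^ j

  expSum : Carrier → ℕ → Carrier
  expSum z = partialSum (expTerm z)

  ∥x^n∥≤ : ∀ {z c} → ∥ z ∥ ℚ.≤ c → ∀ n → ∥ z ^ n ∥ ℚ.≤ c ^ℚ n
  ∥x^n∥≤ z≤c zero    = ∥1∥≤1
  ∥x^n∥≤ {z} z≤c (suc n) = ℚ.≤-trans (∥x*y∥≤ z (z ^ n))
    (*-mono-≤-nonNeg (∥x∥≥0 _) (ℚ.≤-trans (∥x∥≥0 z) z≤c) z≤c (∥x^n∥≤ z≤c n))

  expTerm-geometric : ∀ {z c} → 0 ℕ.< c → ∥ z ∥ ℚ.≤ nat c → Geometric (termBound c) (expTerm z)
  expTerm-geometric {z} {c} 0<c z≤c j = ℚ.≤-trans (∥x*y∥≤ _ _)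
    (ℚ.≤-trans (*-mono-≤-nonNeg (∥x∥≥0 _) (ℚ.<⇒≤ (0<1/! j)) (∥ofℚ∥ (ℚ.<⇒≤ (0<1/! j)))
      (∥x^n∥≤ z≤c j)) (1/!-bound c j 0<c))

  convolution-sum : ∀ u v m → sum {suc m} (λ i → u (toℕ i) * v (m ℕ.∸ toℕ i)) ≈ convolution u v m
  convolution-sum u v zero    = +-identityʳ _
  convolution-sum u v (suc m) = +-congˡ (convolution-sum (u ∘ suc) v m)

  expTerm-+ : ∀ z w m → expTerm (z + w) m ≈ convolution (expTerm z) (expTerm w) m
  expTerm-+ z w m = begin
    ofℚ (1/ m !) * (z + w) ^ m                         ≈⟨ *-congˡ (theorem m z w) ⟩
    ofℚ (1/ m !) * sum (binomialTerm z w m) ≈⟨ *-distribˡ-sum (ofℚ (1/ m !)) (binomialTerm z w m) ⟩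
    sum (λ i → ofℚ (1/ m !) * binomialTerm z w m i)
      ≈⟨ sum-cong-≋ (λ i → term (toℕ i) (ℕ.≤-pred (Fin.toℕ<n i))) ⟩
    sum {suc m} (λ i → expTerm z (toℕ i) * expTerm w (m ℕ.∸ toℕ i))
      ≈⟨ convolution-sum (expTerm z) (expTerm w) m ⟩
    convolution (expTerm z) (expTerm w) m              ∎
    where
    term : ∀ k → k ℕ.≤ m → ofℚ (1/ m !) * ((m C k) • (z ^ k * w ^ (m ℕ.∸ k))) ≈ expTerm z
      k * expTerm w (m ℕ.∸ k)
    term k k≤m = begin
      ofℚ (1/ m !) * ((m C k) • (z ^ k * w ^ (m ℕ.∸ k)))
        ≈⟨ *-congˡ (trans (×-congʳ (m C k) (sym (*-identityˡ _))) (sym (×-assoc-* (m C k) 1# _))) ⟩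
      ofℚ (1/ m !) * ((m C k) • 1# * (z ^ k * w ^ (m ℕ.∸ k)))
        ≈⟨ *-assoc _ _ _ ⟨
      ofℚ (1/ m !) * (m C k) • 1# * (z ^ k * w ^ (m ℕ.∸ k))
        ≈⟨ *-congʳ (trans (*-congˡ (sym (ofℚ-nat (m C k)))) (sym (ofℚ-* (1/ m !) (nat (m C k))))) ⟩
      ofℚ (1/ m ! ℚ.* nat (m C k)) * (z ^ k * w ^ (m ℕ.∸ k))
        ≡⟨ ≡.cong (λ q → ofℚ q * (z ^ k * w ^ (m ℕ.∸ k))) (choose/! m k k≤m) ⟩
      ofℚ (1/ k ! ℚ.* 1/ (m ℕ.∸ k) !) * (z ^ k * w ^ (m ℕ.∸ k))
        ≈⟨ *-congʳ (ofℚ-* (1/ k !) (1/ (m ℕ.∸ k) !)) ⟩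
      ofℚ (1/ k !) * ofℚ (1/ (m ℕ.∸ k) !) * (z ^ k * w ^ (m ℕ.∸ k))
        ≈⟨ solve 4 (λ a b c d → a :* b :* (c :* d) := (a :* c) :* (b :* d)) refl _ _ _ _ ⟩
      expTerm z k * expTerm w (m ℕ.∸ k) ∎

  expSum-+ : ∀ {z w c} → 0 ℕ.< c → ∥ z ∥ ℚ.≤ nat c → ∥ w ∥ ℚ.≤ nat c → ∀ k →
    ∥ expSum z k * expSum w k - expSum (z + w) k ∥ ℚ.≤ errorBound (termBound c ℚ.* termBound c) k
  expSum-+ {z} {w} {c} 0<c z≤c w≤c k = ℚ.≤-trans
    (ℚ.≤-reflexive (∥∥-cong (+-congˡ
      (-‿cong (trans (partialSum-cong (expTerm-+ z w) k)
      (partialSum-convolution (expTerm z) (expTerm w) k))))))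
    (square-triangle (0≤nat b) (0≤nat b) (expTerm-geometric 0<c z≤c) (expTerm-geometric 0<c w≤c) {k}
      {k} ℕ.≤-refl)
    where
    b : ℕ
    b = (8 ℕ.* c) ℕ.^ (8 ℕ.* c)

  ∥x-z∥≤ : ∀ x y z → ∥ x - z ∥ ℚ.≤ ∥ x - y ∥ ℚ.+ ∥ y - z ∥
  ∥x-z∥≤ x y z = ℚ.≤-trans (ℚ.≤-reflexive
    (∥∥-cong (solve 3 (λ x y z → x :- z := (x :- y) :+ (y :- z)) refl x y z)))
    (∥x+y∥≤ (x - y) (y - z))

  ∥x-y∥-sym : ∀ x y → ∥ x - y ∥ ≡ ∥ y - x ∥
  ∥x-y∥-sym x y = ≡.trans (≡.sym (∥-x∥≡ (x - y)))
    (∥∥-cong (solve 2 (λ x y → :- (x :- y) := y :- x) refl x y))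

  -- The limits `x′` and `y′` are the factors with known bounds, so `y` is estimated as `y′` plus an
  -- error.
  ∥xy-x′y′∥≤ : ∀ x y x′ y′ → ∥ x * y - x′ * y′ ∥ ℚ.≤ ∥ x - x′ ∥ ℚ.* (∥ y - y′ ∥ ℚ.+ ∥ y′ ∥) ℚ.+ ∥ x′
    ∥ ℚ.* ∥ y - y′ ∥
  ∥xy-x′y′∥≤ x y x′ y′ = ℚR.begin
    ∥ x * y - x′ * y′ ∥
      ℚR.≡⟨ ∥∥-cong (solve 4 (λ x y x′ y′ →
        x :* y :- x′ :* y′ := (x :- x′) :* ((y :- y′) :+ y′) :+ x′ :* (y :- y′)) refl x y x′ y′) ⟩
    ∥ (x - x′) * ((y - y′) + y′) + x′ * (y - y′) ∥
      ℚR.≤⟨ ∥x+y∥≤ _ _ ⟩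
    ∥ (x - x′) * ((y - y′) + y′) ∥ ℚ.+ ∥ x′ * (y - y′) ∥
      ℚR.≤⟨ ℚ.+-mono-≤ (ℚ.≤-trans (∥x*y∥≤ _ _)
        (ℚ.*-monoˡ-≤-nonNeg ∥ x - x′ ∥ {{ℚ.nonNegative (∥x∥≥0 _)}} (∥x+y∥≤ _ _))) (∥x*y∥≤ _ _) ⟩
    ∥ x - x′ ∥ ℚ.* (∥ y - y′ ∥ ℚ.+ ∥ y′ ∥) ℚ.+ ∥ x′ ∥ ℚ.* ∥ y - y′ ∥ ℚR.∎
    where module ℚR = ℚ.≤-Reasoning

  expSum-0 : ∀ k → expSum 0# (suc k) ≈ 1#
  expSum-0 k = begin
    ofℚ 1ℚ * 1# + partialSum (expTerm 0# ∘ suc) k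
      ≈⟨ +-cong (trans (*-identityʳ _) (trans (ofℚ-nat 1) (+-identityʳ 1#)))
           (trans (partialSum-cong {v = λ _ → 0#} (λ j → trans (*-congˡ (zeroˡ _)) (zeroʳ _)) k)
             (zeros k)) ⟩
    1# + 0# ≈⟨ +-identityʳ 1# ⟩
    1# ∎
    where
    zeros : ∀ k → partialSum (λ _ → 0#) k ≈ 0#
    zeros zero    = refl
    zeros (suc k) = trans (+-identityˡ _) (zeros k)

  module _ (σ : Carrier → Carrier) (σ-+ : ∀ x y → σ (x + y) ≈ σ x + σ y)
    (σ-* : ∀ x y → σ (x * y) ≈ σ x * σ y)
           (σ-ofℚ : ∀ q → σ (ofℚ q) ≈ ofℚ q) where
    private
      ofℚ0 : ofℚ 0ℚ ≈ 0#
      ofℚ0 = ofℚ-nat 0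
      ofℚ1 : ofℚ 1ℚ ≈ 1#
      ofℚ1 = trans (ofℚ-nat 1) (+-identityʳ 1#)

    -- Serves for complex conjugation, which commutes with the series because its coefficients are
    -- rational.
    expSum-homomorphic : (∀ {x y} → x ≈ y → σ x ≈ σ y) → ∀ z k → σ (expSum z k) ≈ expSum (σ z) k
    expSum-homomorphic σ-cong z = go (expTerm z) (expTerm (σ z))
      (λ j → trans (σ-* _ _) (*-cong (σ-ofℚ (1/ j !)) (power j)))
      where
      power : ∀ j → σ (z ^ j) ≈ σ z ^ j
      power zero    = trans (σ-cong (sym ofℚ1)) (trans (σ-ofℚ 1ℚ) ofℚ1)
      power (suc j) = trans (σ-* z (z ^ j)) (*-congˡ (power j))
      go : ∀ u v → (∀ j → σ (u j) ≈ v j) → ∀ k → σ (partialSum u k) ≈ partialSum v k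
      go u v h zero    = trans (σ-cong (sym ofℚ0)) (trans (σ-ofℚ 0ℚ) ofℚ0)
      go u v h (suc k) = trans (σ-+ _ _) (+-cong (h 0) (go (u ∘ suc) (v ∘ suc) (h ∘ suc) k))

ℚ[i]-commutativeRing : CommutativeRing 0ℓ 0ℓ
ℚ[i]-commutativeRing = Complexification.commutativeRing ℚ.+-*-commutativeRing

private
  -- Unlike the Euclidean norm this one takes rational values, and it is submultiplicative as well.
  ℓ¹ : ℚ × ℚ → ℚ
  ℓ¹ (a , b) = ℚ.∣ a ∣ ℚ.+ ℚ.∣ b ∣

  ℓ¹-* : ∀ a b c d → ℚ.∣ a ℚ.* c ℚ.- b ℚ.* d ∣ ℚ.+ ℚ.∣ a ℚ.* d ℚ.+ b ℚ.* c ∣ ℚ.≤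
    (ℚ.∣ a ∣ ℚ.+ ℚ.∣ b ∣) ℚ.* (ℚ.∣ c ∣ ℚ.+ ℚ.∣ d ∣)
  ℓ¹-* a b c d = begin
    ℚ.∣ a ℚ.* c ℚ.- b ℚ.* d ∣ ℚ.+ ℚ.∣ a ℚ.* d ℚ.+ b ℚ.* c ∣
      ≤⟨ ℚ.+-mono-≤ (ℚ.∣p-q∣≤∣p∣+∣q∣ (a ℚ.* c) (b ℚ.* d)) (ℚ.∣p+q∣≤∣p∣+∣q∣ (a ℚ.* d) (b ℚ.* c)) ⟩
    (ℚ.∣ a ℚ.* c ∣ ℚ.+ ℚ.∣ b ℚ.* d ∣) ℚ.+ (ℚ.∣ a ℚ.* d ∣ ℚ.+ ℚ.∣ b ℚ.* c ∣)
      ≡⟨ ≡.cong₂ ℚ._+_ (≡.cong₂ ℚ._+_ (ℚ.∣p*q∣≡∣p∣*∣q∣ a c) (ℚ.∣p*q∣≡∣p∣*∣q∣ b d))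
        (≡.cong₂ ℚ._+_ (ℚ.∣p*q∣≡∣p∣*∣q∣ a d) (ℚ.∣p*q∣≡∣p∣*∣q∣ b c)) ⟩
    (ℚ.∣ a ∣ ℚ.* ℚ.∣ c ∣ ℚ.+ ℚ.∣ b ∣ ℚ.* ℚ.∣ d ∣) ℚ.+ (ℚ.∣ a ∣ ℚ.* ℚ.∣ d ∣ ℚ.+ ℚ.∣ b ∣ ℚ.* ℚ.∣ c ∣)
      ≡⟨ S.solve 4 (λ a b c d → (a S.:* c S.:+ b S.:* d) S.:+ (a S.:* d S.:+ b S.:* c)
        S.:= (a S.:+ b) S.:* (c S.:+ d)) ≡.refl (ℚ.∣ a ∣) (ℚ.∣ b ∣) (ℚ.∣ c ∣) (ℚ.∣ d ∣) ⟩
    (ℚ.∣ a ∣ ℚ.+ ℚ.∣ b ∣) ℚ.* (ℚ.∣ c ∣ ℚ.+ ℚ.∣ d ∣) ∎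
    where open ℚ.≤-Reasoning

  ℓ¹-+ : ∀ a b c d → ℚ.∣ a ℚ.+ c ∣ ℚ.+ ℚ.∣ b ℚ.+ d ∣ ℚ.≤ (ℚ.∣ a ∣ ℚ.+ ℚ.∣ b ∣) ℚ.+
    (ℚ.∣ c ∣ ℚ.+ ℚ.∣ d ∣)
  ℓ¹-+ a b c d = ℚ.≤-trans (ℚ.+-mono-≤ (ℚ.∣p+q∣≤∣p∣+∣q∣ a c) (ℚ.∣p+q∣≤∣p∣+∣q∣ b d))
    (ℚ.≤-reflexive (S.solve 4 (λ a b c d →
      (a S.:+ c) S.:+ (b S.:+ d) S.:= (a S.:+ b) S.:+ (c S.:+ d)) ≡.refl (ℚ.∣ a ∣) (ℚ.∣ b ∣)
      (ℚ.∣ c ∣) (ℚ.∣ d ∣)))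

ℚ[i] : NormedℚAlgebra
ℚ[i] = record
  { commutativeRing = ℚ[i]-commutativeRing
  ; ∥_∥     = ℓ¹
  ; ∥∥-cong = λ { (≡.refl , ≡.refl) → ≡.refl }
  ; ∥x∥≥0   = λ (a , b) → 0≤+ (ℚ.0≤∣p∣ a) (ℚ.0≤∣p∣ b)
  ; ∥0∥≡0   = ≡.refl
  ; ∥1∥≤1   = ℚ.≤-refl
  ; ∥x+y∥≤  = λ (a , b) (c , d) → ℓ¹-+ a b c d
  ; ∥x*y∥≤  = λ (a , b) (c , d) → ℓ¹-* a b c d
  ; ∥-x∥≡   = λ (a , b) → ≡.cong₂ ℚ._+_ (ℚ.∣-p∣≡∣p∣ a) (ℚ.∣-p∣≡∣p∣ b)
  ; ofℚ     = λ q → q , 0ℚ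
  ; ofℚ-* = λ p q → S.solve 2 (λ p q → p S.:* q S.:= p S.:* q S.:- S.con 0ℚ S.:* S.con 0ℚ) ≡.refl p
    q
                    , S.solve 2 (λ p q → S.con 0ℚ S.:= p S.:* S.con 0ℚ S.:+ S.con 0ℚ S.:* q) ≡.refl
                      p q
  ; ofℚ-nat = ofℚ-nat
  ; ∥ofℚ∥   = λ {q} 0≤q → ℚ.≤-reflexive (≡.trans (ℚ.+-identityʳ ℚ.∣ q ∣) (ℚ.0≤p⇒∣p∣≡p 0≤q))
  }
  where
  open CommutativeRing ℚ[i]-commutativeRing
  open Mult semiring using () renaming (_×_ to _•_)
  ofℚ-nat : ∀ n → (nat n , 0ℚ) ≈ n • 1#
  ofℚ-nat zero = ≡.refl , ≡.refl
  ofℚ-nat (suc n) with ofℚ-nat n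
  ... | p , q = ≡.trans (nat-+ 1 n) (≡.cong (1ℚ ℚ.+_) p) , ≡.trans (≡.sym (ℚ.+-identityˡ 0ℚ))
    (≡.cong (0ℚ ℚ.+_) q)

-- Complex exponentials through Gaussian rational approximations

module 𝔾 = NormedℚAlgebra ℚ[i]
open 𝔾 using (∥_∥)
open ExponentialSums ℚ[i]
open Exp 𝔾.semiring using () renaming (_^_ to _^ᴳ_)

-- Arithmetic of Cauchy reals acts termwise, so a finite sum of complex numbers, read at index `n`,
-- is the same sum of Gaussian rationals. Estimates for the series can thus be made in `ℚ[i]`.
at : ℕ → ℂ → 𝔾.Carrier
at n z = seq (re z) n , seq (im z) n

at-^ : ∀ n z k → at n (z ^ᶜ k) ≡ at n z ^ᴳ k
at-^ n z zero    = ≡.refl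
at-^ n z (suc k) = ≡.cong (at n z 𝔾.*_) (at-^ n z k)

at-sum : ∀ n (f : ℕ → ℂ) k → at n (Defs.sum {k} (f ∘ toℕ)) ≡ partialSum (at n ∘ f) k
at-sum n f zero    = ≡.refl
at-sum n f (suc k) = ≡.cong (at n (f 0) 𝔾.+_) (at-sum n (f ∘ suc) k)

at-expPartialSum : ∀ n z k → at n (expPartialSum z k) 𝔾.≈ expSum (at n z) k
at-expPartialSum n z k = 𝔾.trans {at n (expPartialSum z k)} {partialSum (at n ∘ f) k}
  {expSum (at n z) k}
  (𝔾.reflexive (at-sum n f k))
  (partialSum-cong {at n ∘ f} {expTerm (at n z)} term k)
  where
  f : ℕ → ℂ
  f j = fromℚ (1/ j !) ·ᶜ (z ^ᶜ j)
  scalar : ∀ q x → (q ℚ.* proj₁ x , q ℚ.* proj₂ x) 𝔾.≈ (q , 0ℚ) 𝔾.* x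
  scalar q (a , b) = S.solve 3 (λ q a b → q S.:* a S.:= q S.:* a S.:- S.con 0ℚ S.:* b) ≡.refl q a b
                   , S.solve 3 (λ q a b → q S.:* b S.:= q S.:* b S.:+ S.con 0ℚ S.:* a) ≡.refl q a b
  term : ∀ j → at n (f j) 𝔾.≈ expTerm (at n z) j
  term j = 𝔾.trans {at n (f j)} {𝔾.ofℚ (1/ j !) 𝔾.* at n (z ^ᶜ j)} {expTerm (at n z) j}
    (scalar (1/ j !) (at n (z ^ᶜ j)))
    (𝔾.*-congˡ {𝔾.ofℚ (1/ j !)} {at n (z ^ᶜ j)} {at n z ^ᴳ j} (𝔾.reflexive (at-^ n z j)))

Near : ℚ → ℂ → ℂ → Set
Near ε z w = Eventually λ n → ∥ at n z 𝔾.- at n w ∥ ℚ.< ε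

near-sym : ∀ {ε z w} → Near ε z w → Near ε w z
near-sym {ε} {z} {w} = eventually-map λ {n} → ≡.subst (ℚ._< ε) (∥x-y∥-sym (at n z) (at n w))

near-trans : ∀ {ε x y z} → Near (½ ℚ.* ε) x y → Near (½ ℚ.* ε) y z → Near ε x z
near-trans {ε} {x} {y} {z} = eventually-zip λ {n} p q →
  ≡.subst (∥ at n x 𝔾.- at n z ∥ ℚ.<_) (halves ε)
  (ℚ.≤-<-trans (∥x-z∥≤ (at n x) (at n y) (at n z)) (ℚ.+-mono-< p q))

≈⇒near : ∀ {z w} → z ≈ᶜ w → ∀ {ε} → 0ℚ ℚ.< ε → Near ε z w
≈⇒near {z} {w} (p , q) {ε} 0<ε = eventually-zip
  (λ {n} a b → ≡.subst (∥ at n z 𝔾.- at n w ∥ ℚ.<_) (halves ε) (ℚ.+-mono-< a b))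
  (p (½ ℚ.* ε) (0<½* 0<ε)) (q (½ ℚ.* ε) (0<½* 0<ε))

near⇒≈ : ∀ {z w} → (∀ {ε} → 0ℚ ℚ.< ε → Near ε z w) → z ≈ᶜ w
near⇒≈ {z} {w} h
  = (λ ε 0<ε → eventually-map (λ {n} →
    ℚ.≤-<-trans (first (proj₁ (at n z 𝔾.- at n w)) (proj₂ (at n z 𝔾.- at n w)))) (h 0<ε))
  , (λ ε 0<ε → eventually-map (λ {n} →
    ℚ.≤-<-trans (second (proj₁ (at n z 𝔾.- at n w)) (proj₂ (at n z 𝔾.- at n w)))) (h 0<ε))
  where
  first : ∀ a b → ℚ.∣ a ∣ ℚ.≤ ℚ.∣ a ∣ ℚ.+ ℚ.∣ b ∣
  first a b = ℚ.≤-trans (ℚ.≤-reflexive (≡.sym (ℚ.+-identityʳ ℚ.∣ a ∣)))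
    (ℚ.+-monoʳ-≤ ℚ.∣ a ∣ (ℚ.0≤∣p∣ b))
  second : ∀ a b → ℚ.∣ b ∣ ℚ.≤ ℚ.∣ a ∣ ℚ.+ ℚ.∣ b ∣
  second a b = ℚ.≤-trans (ℚ.≤-reflexive (≡.sym (ℚ.+-identityˡ ℚ.∣ b ∣)))
    (ℚ.+-monoˡ-≤ ℚ.∣ b ∣ (ℚ.0≤∣p∣ a))

_⟶_ : (ℕ → ℂ) → ℂ → Set
s ⟶ z = ∀ {ε} → 0ℚ ℚ.< ε → ∃[ K ] ∀ k → K ℕ.≤ k → Near ε (s k) z

private
  ∣a∣²≡ : ∀ a → ℚ.∣ a ∣ ℚ.* ℚ.∣ a ∣ ≡ a ℚ.* a
  ∣a∣²≡ p with ℚ.∣p∣≡p∨∣p∣≡-p p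
  ... | inj₁ eq = ≡.cong₂ ℚ._*_ eq eq
  ... | inj₂ eq = ≡.trans (≡.cong₂ ℚ._*_ eq eq)
    (S.solve 1 (λ p → S.:- p S.:* S.:- p S.:= p S.:* p) ≡.refl p)

  0≤a² : ∀ a → 0ℚ ℚ.≤ a ℚ.* a
  0≤a² a = ≡.subst (0ℚ ℚ.≤_) (∣a∣²≡ a) (0≤* (ℚ.0≤∣p∣ a) (ℚ.0≤∣p∣ a))

  ∣a∣<e : ∀ {a b e} → 0ℚ ℚ.< e → a ℚ.* a ℚ.+ b ℚ.* b ℚ.< e ℚ.* e → ℚ.∣ a ∣ ℚ.< e
  ∣a∣<e {a} {b} {e} 0<e h with ℚ.∣ a ∣ ℚ.<? e
  ... | yes p = p
  ... | no ¬p = ⊥-elim (ℚ.<-irrefl ≡.refl (begin-strict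
    a ℚ.* a ℚ.+ b ℚ.* b          <⟨ h ⟩
    e ℚ.* e                      ≤⟨ *-mono-≤-nonNeg (ℚ.<⇒≤ 0<e) (ℚ.0≤∣p∣ a) (ℚ.≮⇒≥ ¬p) (ℚ.≮⇒≥ ¬p) ⟩
    ℚ.∣ a ∣ ℚ.* ℚ.∣ a ∣          ≡⟨ ∣a∣²≡ a ⟩
    a ℚ.* a                      ≡⟨ ℚ.+-identityʳ (a ℚ.* a) ⟨
    a ℚ.* a ℚ.+ 0ℚ               ≤⟨ ℚ.+-monoʳ-≤ (a ℚ.* a) (0≤a² b) ⟩
    a ℚ.* a ℚ.+ b ℚ.* b          ∎))
    where open ℚ.≤-Reasoning

  a²+b²≤ : ∀ a b → a ℚ.* a ℚ.+ b ℚ.* b ℚ.≤ (ℚ.∣ a ∣ ℚ.+ ℚ.∣ b ∣) ℚ.* (ℚ.∣ a ∣ ℚ.+ ℚ.∣ b ∣)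
  a²+b²≤ a b = 0≤⇒≤ (0≤+ 0≤ab 0≤ab) (≡.trans
    (S.solve 2 (λ a b → (a S.:+ b) S.:* (a S.:+ b) S.:= (a S.:* a S.:+ b S.:* b)
      S.:+ (a S.:* b S.:+ a S.:* b)) ≡.refl ℚ.∣ a ∣ ℚ.∣ b ∣)
    (≡.cong (ℚ._+ (ℚ.∣ a ∣ ℚ.* ℚ.∣ b ∣ ℚ.+ ℚ.∣ a ∣ ℚ.* ℚ.∣ b ∣))
      (≡.cong₂ ℚ._+_ (∣a∣²≡ a) (∣a∣²≡ b))))
    where
    0≤ab : 0ℚ ℚ.≤ ℚ.∣ a ∣ ℚ.* ℚ.∣ b ∣
    0≤ab = 0≤* (ℚ.0≤∣p∣ a) (ℚ.0≤∣p∣ b)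

convergesTo⇒⟶ : ∀ {s z} → s ConvergesTo z → s ⟶ z
convergesTo⇒⟶ {s} {z} h {ε} 0<ε with h (½ ℚ.* ε) (0<½* 0<ε)
... | K , f = K , λ k K≤k → close k (f k K≤k)
  where
  close : ∀ k → normSq (s k -ᶜ z) <ᴿ fromℚ ((½ ℚ.* ε) ℚ.* (½ ℚ.* ε)) → Near ε (s k) z
  close k (δ , 0<δ , g) = eventually-map (λ {n} lt →
    let a = seq (re (s k)) n ℚ.- seq (re z) n
        b = seq (im (s k)) n ℚ.- seq (im z) n
        lt′ = ℚ.<-trans (0<⇒< {a ℚ.* a ℚ.+ b ℚ.* b} 0<δ ≡.refl) lt
    in ≡.subst (ℚ.∣ a ∣ ℚ.+ ℚ.∣ b ∣ ℚ.<_) (halves ε)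
      (ℚ.+-mono-< (∣a∣<e {a} {b} (0<½* 0<ε) lt′)
                  (∣a∣<e {b} {a} (0<½* 0<ε)
                    (≡.subst (ℚ._< (½ ℚ.* ε) ℚ.* (½ ℚ.* ε)) (ℚ.+-comm (a ℚ.* a) (b ℚ.* b)) lt′)))) g

⟶⇒convergesTo : ∀ {s z} → s ⟶ z → s ConvergesTo z
⟶⇒convergesTo {s} {z} h ε 0<ε with h {½ ℚ.* ε} (0<½* 0<ε)
... | K , f = K , λ k K≤k → η , 0<η , eventually-map
  (λ {n} → bound (seq (re (s k)) n ℚ.- seq (re z) n) (seq (im (s k)) n ℚ.- seq (im z) n)) (f k K≤k)
  where
  h₂ η : ℚ
  h₂ = ½ ℚ.* ε
  -- The strict order of reals demands a gap: `ε * ε` is four times `h₂ * h₂`, the squared distance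
  -- uses at most one share, and a second one is the gap.
  η = h₂ ℚ.* h₂
  0<η : 0ℚ ℚ.< η
  0<η = 0<* (0<½* 0<ε) (0<½* 0<ε)
  bound : ∀ a b → ℚ.∣ a ∣ ℚ.+ ℚ.∣ b ∣ ℚ.< h₂ → a ℚ.* a ℚ.+ b ℚ.* b ℚ.+ η ℚ.< ε ℚ.* ε
  bound a b lt = begin-strict
    a ℚ.* a ℚ.+ b ℚ.* b ℚ.+ η ≤⟨ ℚ.+-monoˡ-≤ η
      (ℚ.≤-trans (a²+b²≤ a b) (*-mono-≤-nonNeg (0≤+ (ℚ.0≤∣p∣ a) (ℚ.0≤∣p∣ b)) (ℚ.<⇒≤ (0<½* 0<ε))
      (ℚ.<⇒≤ lt) (ℚ.<⇒≤ lt))) ⟩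
    η ℚ.+ η <⟨ 0<⇒< (0<+ 0<η 0<η)
      (≡.trans (≡.sym (≡.cong₂ ℚ._*_ (halves ε) (halves ε)))
      (S.solve 1 (λ h → (h S.:+ h) S.:* (h S.:+ h) S.:= (h S.:* h S.:+ h S.:* h)
      S.:+ (h S.:* h S.:+ h S.:* h)) ≡.refl h₂)) ⟩
    ε ℚ.* ε                        ∎
    where open ℚ.≤-Reasoning

⟶-unique : ∀ {s z w} → s ⟶ z → s ⟶ w → z ≈ᶜ w
⟶-unique {s} {z} {w} h g = near⇒≈ {z} {w} λ {ε} 0<ε →
  let K , f = h {½ ℚ.* ε} (0<½* 0<ε)
      L , k = g {½ ℚ.* ε} (0<½* 0<ε)
  in near-trans {ε} {z} {s (K ℕ.⊔ L)} {w} (near-sym {½ ℚ.* ε} {s (K ℕ.⊔ L)} {z} (f (K ℕ.⊔ L) (ℕ.m≤m⊔n K L)))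
       (k (K ℕ.⊔ L) (ℕ.m≤n⊔m K L))

⟶-cong : ∀ {s t z w} → (∀ k → s k ≈ᶜ t k) → z ≈ᶜ w → s ⟶ z → t ⟶ w
⟶-cong {s} {t} {z} {w} s≈t z≈w h {ε} 0<ε with h {½ ℚ.* (½ ℚ.* ε)} (0<½* (0<½* 0<ε))
... | K , f = K , λ k K≤k → near-trans {ε} {t k} {z} {w}
  (near-trans {½ ℚ.* ε} {t k} {s k} {z}
    (near-sym {_} {s k} {t k} (≈⇒near {s k} {t k} (s≈t k) (0<½* (0<½* 0<ε)))) (f k K≤k))
  (≈⇒near {z} {w} z≈w (0<½* 0<ε))

private
  module ℂΣ = Sum ℂR.semiring
module ℂ^ = Exp ℂR.semiring

·ᶜ-cong : ∀ q {z w} → z ≈ᶜ w → fromℚ q ·ᶜ z ≈ᶜ fromℚ q ·ᶜ w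
·ᶜ-cong q {z} {w} (e , f) = ℝR.*-congˡ {fromℚ q} {re z} {re w} e , ℝR.*-congˡ {fromℚ q} {im z}
  {im w} f

expPartialSum-cong : ∀ {z w} → z ≈ᶜ w → ∀ k → expPartialSum z k ≈ᶜ expPartialSum w k
expPartialSum-cong {z} {w} z≈w k = ℂΣ.sum-cong-≋ {k} {λ j → fromℚ (1/ toℕ j !) ·ᶜ (z ^ᶜ toℕ j)}
  {λ j → fromℚ (1/ toℕ j !) ·ᶜ (w ^ᶜ toℕ j)}
  λ j → ·ᶜ-cong (1/ toℕ j !) {z ^ᶜ toℕ j} {w ^ᶜ toℕ j} (ℂ^.^-congˡ (toℕ j) {z} {w} z≈w)

isExp-unique : ∀ {z w w′} → IsExp z w → IsExp z w′ → w ≈ᶜ w′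
isExp-unique {z} {w} {w′} h h′ = ⟶-unique {expPartialSum z} {w} {w′}
  (convergesTo⇒⟶ {expPartialSum z} {w} h) (convergesTo⇒⟶ {expPartialSum z} {w′} h′)

isExp-cong : ∀ {z z′ w w′} → z ≈ᶜ z′ → w ≈ᶜ w′ → IsExp z w → IsExp z′ w′
isExp-cong {z} {z′} {w} {w′} p q h = ⟶⇒convergesTo {expPartialSum z′} {w′}
  (⟶-cong {expPartialSum z} {expPartialSum z′} {w} {w′} (expPartialSum-cong {z} {z′} p) q
    (convergesTo⇒⟶ {expPartialSum z} {w} h))

Exponential : ℂ → ℂ → Set
Exponential z w = ∀ {ε} → 0ℚ ℚ.< ε → ∃[ K ] ∀ k → K ℕ.≤ k → Eventually λ n →
  ∥ expSum (at n z) k 𝔾.- at n w ∥ ℚ.< ε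

private
  error≡ : ∀ z w k n → ∥ at n (expPartialSum z k) 𝔾.- at n w ∥ ≡ ∥ expSum (at n z) k 𝔾.- at n w ∥
  error≡ z w k n = 𝔾.∥∥-cong {at n (expPartialSum z k) 𝔾.- at n w} {expSum (at n z) k 𝔾.- at n w}
    (𝔾.+-congʳ {𝔾.- at n w} {at n (expPartialSum z k)} {expSum (at n z) k} (at-expPartialSum n z k))

isExp⇒exponential : ∀ {z w} → IsExp z w → Exponential z w
isExp⇒exponential {z} {w} h {ε} 0<ε =
  let K , f = convergesTo⇒⟶ {expPartialSum z} {w} h 0<ε in
  K , λ k K≤k → eventually-map (λ {n} → ≡.subst (ℚ._< ε) (error≡ z w k n)) (f k K≤k)

exponential⇒isExp : ∀ {z w} → Exponential z w → IsExp z w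
exponential⇒isExp {z} {w} h = ⟶⇒convergesTo {expPartialSum z} {w} λ {ε} 0<ε →
  let K , f = h 0<ε in
  K , λ k K≤k → eventually-map (λ {n} → ≡.subst (ℚ._< ε) (≡.sym (error≡ z w k n))) (f k K≤k)

at-bounded : ∀ z → ∃[ c ] 0 ℕ.< c × Eventually λ n → ∥ at n z ∥ ℚ.≤ nat c
at-bounded z = combine (bounded (re z)) (bounded (im z))
  where
  combine : IsBounded (seq (re z)) → IsBounded (seq (im z)) → ∃[ c ] 0 ℕ.< c × Eventually λ n →
    ∥ at n z ∥ ℚ.≤ nat c
  combine (A , 0<A , p) (B , 0<B , q) = suc c , ℕ.z<s , eventually-zip
    (λ {n} a b → ℚ.≤-trans (ℚ.+-mono-≤ a b)
      (ℚ.<⇒≤ (ℚ.<-≤-trans (proj₂ (archimedean (A ℚ.+ B))) (nat-mono-≤ (ℕ.n≤1+n c))))) p q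
    where
    c : ℕ
    c = proj₁ (archimedean (A ℚ.+ B))

-- One natural number `d` bounds all late approximations of both arguments, so the error is small
-- uniformly in `n` and `K` can be chosen before `n`.
expSum-product : ∀ z z′ {ε} → 0ℚ ℚ.< ε → ∃[ K ] ∀ k → K ℕ.≤ k → Eventually λ n →
  ∥ expSum (at n z) k 𝔾.* expSum (at n z′) k 𝔾.- expSum (at n (z +ᶜ z′)) k ∥ ℚ.< ε
expSum-product z z′ {ε} 0<ε = combine (at-bounded z) (at-bounded z′)
  where
  combine : (∃[ c ] 0 ℕ.< c × Eventually λ n → ∥ at n z ∥ ℚ.≤ nat c) →
    (∃[ c ] 0 ℕ.< c × Eventually λ n → ∥ at n z′ ∥ ℚ.≤ nat c) →
    ∃[ K ] ∀ k → K ℕ.≤ k → Eventually λ n →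
      ∥ expSum (at n z) k 𝔾.* expSum (at n z′) k 𝔾.- expSum (at n (z +ᶜ z′)) k ∥ ℚ.< ε
  combine (c , 0<c , p) (c′ , 0<c′ , p′) = proj₁ small , λ k K≤k →
    eventually-zip (λ {n} a b → ℚ.≤-<-trans
      (expSum-+ {at n z} {at n z′} {d} (ℕ.<-≤-trans 0<c (ℕ.m≤m⊔n c c′))
        (ℚ.≤-trans a (nat-mono-≤ (ℕ.m≤m⊔n c c′))) (ℚ.≤-trans b (nat-mono-≤ (ℕ.m≤n⊔m c c′))) k)
      (proj₂ small k K≤k)) p p′
    where
    d b : ℕ
    d = c ℕ.⊔ c′
    b = (8 ℕ.* d) ℕ.^ (8 ℕ.* d)
    small : ∃[ K ] ∀ k → K ℕ.≤ k → errorBound (termBound d ℚ.* termBound d) k ℚ.< ε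
    small = errorBound→0 (termBound d ℚ.* termBound d) (0≤* (0≤nat b) (0≤nat b)) 0<ε

exponential-+ : ∀ {z w z′ w′} → Exponential z w → Exponential z′ w′ →
  Exponential (z +ᶜ z′) (w *ᶜ w′)
exponential-+ {z} {w} {z′} {w′} e e′ {ε} 0<ε = combine (at-bounded w) (at-bounded w′)
  where
  combine : (∃[ c ] 0 ℕ.< c × Eventually λ n → ∥ at n w ∥ ℚ.≤ nat c) →
    (∃[ c ] 0 ℕ.< c × Eventually λ n → ∥ at n w′ ∥ ℚ.≤ nat c) →
    ∃[ K ] ∀ k → K ℕ.≤ k → Eventually λ n → ∥ expSum (at n (z +ᶜ z′)) k 𝔾.- at n (w *ᶜ w′) ∥ ℚ.< ε
  combine (c , 0<c , p) (c′ , 0<c′ , p′) =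
    let K , f = e 0<η
        K′ , f′ = e′ 0<η
        L , g = expSum-product z z′ (0<½* 0<ε)
    in K ℕ.⊔ K′ ℕ.⊔ L , λ k K≤k →
      let KK′≤k = ℕ.m⊔n≤o⇒m≤o (K ℕ.⊔ K′) L K≤k
      in eventually-zip₃ (λ {n} → final k n)
        (eventually-zip _,_ (f k (ℕ.m⊔n≤o⇒m≤o K K′ KK′≤k)) (f′ k (ℕ.m⊔n≤o⇒n≤o K K′ KK′≤k)))
        (eventually-zip _,_ p p′)
        (g k (ℕ.m⊔n≤o⇒n≤o (K ℕ.⊔ K′) L K≤k))
    where
    M h η : ℚ
    h = ½ ℚ.* ε
    -- The error of the product is at most `η * (1 + c′) + c * η`, which `M * η ≡ h` dominates; the
    -- summand `h` in `M` also ensures `η ≤ 1`.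
    M = nat c ℚ.+ nat c′ ℚ.+ 1ℚ ℚ.+ h
    0<h : 0ℚ ℚ.< h
    0<h = 0<½* 0<ε
    0≤cc′ : 0ℚ ℚ.≤ nat c ℚ.+ nat c′
    0≤cc′ = 0≤+ (0≤nat c) (0≤nat c′)
    0<M : 0ℚ ℚ.< M
    0<M = ℚ.+-mono-≤-< (0≤+ 0≤cc′ (ℚ.<⇒≤ 0<1)) 0<h
    r : ℚ
    r = proj₁ (inverse 0<M)
    η = h ℚ.* r
    0<η : 0ℚ ℚ.< η
    0<η = 0<* 0<h (proj₁ (proj₂ (inverse 0<M)))
    Mη≡h : M ℚ.* η ≡ h
    Mη≡h = ≡.trans (S.solve 3 (λ M h r → M S.:* (h S.:* r) S.:= h S.:* (M S.:* r)) ≡.refl M h r)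
      (≡.trans (≡.cong (h ℚ.*_) (proj₂ (proj₂ (inverse 0<M)))) (ℚ.*-identityʳ h))
    η≤1 : η ℚ.≤ 1ℚ
    η≤1 = ℚ.*-cancelˡ-≤-pos M {{ℚ.positive 0<M}}
      (≡.subst₂ ℚ._≤_ (≡.sym Mη≡h) (≡.sym (ℚ.*-identityʳ M))
      (0≤⇒≤ (0≤+ 0≤cc′ (ℚ.<⇒≤ 0<1)) (ℚ.+-comm (nat c ℚ.+ nat c′ ℚ.+ 1ℚ) h)))
    final : ∀ k n → (∥ expSum (at n z) k 𝔾.- at n w ∥ ℚ.< η × ∥ expSum
      (at n z′) k 𝔾.- at n w′ ∥ ℚ.< η) →
      (∥ at n w ∥ ℚ.≤ nat c × ∥ at n w′ ∥ ℚ.≤ nat c′) →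
      ∥ expSum (at n z) k 𝔾.* expSum (at n z′) k 𝔾.- expSum (at n (z +ᶜ z′)) k ∥ ℚ.< h →
      ∥ expSum (at n (z +ᶜ z′)) k 𝔾.- at n (w *ᶜ w′) ∥ ℚ.< ε
    final k n (a , b) (wc , wc′) d = ≡.subst (∥ expSum (at n (z +ᶜ z′)) k 𝔾.- at n (w *ᶜ w′) ∥ ℚ.<_)
      (halves ε)
      (ℚ.≤-<-trans (∥x-z∥≤ (expSum (at n (z +ᶜ z′)) k) (x 𝔾.* y) (at n (w *ᶜ w′)))
        (ℚ.+-mono-<-≤ (≡.subst (ℚ._< h) (∥x-y∥-sym (x 𝔾.* y) (expSum (at n (z +ᶜ z′)) k)) d) (begin
          ∥ x 𝔾.* y 𝔾.- x′ 𝔾.* y′ ∥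
            ≤⟨ ∥xy-x′y′∥≤ x y x′ y′ ⟩
          ∥ x 𝔾.- x′ ∥ ℚ.* (∥ y 𝔾.- y′ ∥ ℚ.+ ∥ y′ ∥) ℚ.+ ∥ x′ ∥ ℚ.* ∥ y 𝔾.- y′ ∥
            ≤⟨ ℚ.+-mono-≤ (*-mono-≤-nonNeg (0≤+ (𝔾.∥x∥≥0 (y 𝔾.- y′)) (𝔾.∥x∥≥0 y′)) (ℚ.<⇒≤ 0<η)
              (ℚ.<⇒≤ a) (ℚ.+-mono-≤ (ℚ.≤-trans (ℚ.<⇒≤ b) η≤1) wc′))
                 (*-mono-≤-nonNeg (𝔾.∥x∥≥0 (y 𝔾.- y′)) (0≤nat c) wc (ℚ.<⇒≤ b)) ⟩
          η ℚ.* (1ℚ ℚ.+ nat c′) ℚ.+ nat c ℚ.* η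
            ≤⟨ 0≤⇒≤ (0≤* (ℚ.<⇒≤ 0<h) (ℚ.<⇒≤ 0<η))
              (S.solve 4 (λ η c c′ h → (c S.:+ c′ S.:+ S.con 1ℚ S.:+ h) S.:* η
              S.:= (η S.:* (S.con 1ℚ S.:+ c′) S.:+ c S.:* η) S.:+ h S.:* η) ≡.refl η (nat c)
              (nat c′) h) ⟩
          M ℚ.* η
            ≡⟨ Mη≡h ⟩
          h ∎)))
      where
      open ℚ.≤-Reasoning
      x y x′ y′ : 𝔾.Carrier
      x = expSum (at n z) k
      y = expSum (at n z′) k
      x′ = at n w
      y′ = at n w′

isExp-+ : ∀ {z w z′ w′} → IsExp z w → IsExp z′ w′ → IsExp (z +ᶜ z′) (w *ᶜ w′)
isExp-+ {z} {w} {z′} {w′} h h′ = exponential⇒isExp {z +ᶜ z′} {w *ᶜ w′}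
  (exponential-+ {z} {w} {z′} {w′} (isExp⇒exponential {z} {w} h) (isExp⇒exponential {z′} {w′} h′))

isExp-0 : IsExp 0ᶜ 1ᶜ
isExp-0 = exponential⇒isExp {0ᶜ} {1ᶜ} λ {ε} 0<ε →
  1 , λ { (suc k) _ → always λ n → ≡.subst (ℚ._< ε) (≡.sym (error≡0 k)) 0<ε }
  where
  error≡0 : ∀ k → ∥ expSum 𝔾.0# (suc k) 𝔾.- 𝔾.1# ∥ ≡ 0ℚ
  error≡0 k = ≡.trans (𝔾.∥∥-cong {expSum 𝔾.0# (suc k) 𝔾.- 𝔾.1#} {𝔾.0#}
    (𝔾.trans {expSum 𝔾.0# (suc k) 𝔾.- 𝔾.1#} {𝔾.1# 𝔾.- 𝔾.1#} {𝔾.0#}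
      (𝔾.+-congʳ {𝔾.- 𝔾.1#} {expSum 𝔾.0# (suc k)} {𝔾.1#} (expSum-0 k)) (𝔾.-‿inverseʳ 𝔾.1#))) 𝔾.∥0∥≡0

conjugate : ℂ → ℂ
conjugate z = re z +i (-ᴿ im z)

private
  bar : 𝔾.Carrier → 𝔾.Carrier
  bar (a , b) = a , ℚ.- b

  bar-expSum : ∀ z k → bar (expSum z k) 𝔾.≈ expSum (bar z) k
  bar-expSum = expSum-homomorphic bar
    (λ (a , b) (c , d) → ≡.refl , S.solve 2
      (λ b d → S.:- (b S.:+ d) S.:= S.:- b S.:+ S.:- d) ≡.refl b d)
    (λ (a , b) (c , d) → S.solve 4
      (λ a b c d → a S.:* c S.:- b S.:* d S.:= a S.:* c S.:- (S.:- b) S.:* (S.:- d)) ≡.refl a b c d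
                       , S.solve 4 (λ a b c d →
                         S.:- (a S.:* d S.:+ b S.:* c) S.:= a S.:* (S.:- d) S.:+ (S.:- b) S.:* c)
                         ≡.refl a b c d)
    (λ q → ≡.refl , ≡.refl)
    (λ (p , q) → p , ≡.cong ℚ.-_ q)

isExp-conjugate : ∀ {z w} → IsExp z w → IsExp (conjugate z) (conjugate w)
isExp-conjugate {z} {w} h = exponential⇒isExp {conjugate z} {conjugate w} λ {ε} 0<ε →
  let K , f = isExp⇒exponential {z} {w} h 0<ε
  in K , λ k K≤k → eventually-map (λ {n} → ≡.subst (ℚ._< ε) (norm k n)) (f k K≤k)
  where
  norm-bar : ∀ x → ∥ bar x ∥ ≡ ∥ x ∥
  norm-bar (a , b) = ≡.cong (ℚ.∣ a ∣ ℚ.+_) (ℚ.∣-p∣≡∣p∣ b)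
  bar-- : ∀ x y → bar (x 𝔾.- y) 𝔾.≈ bar x 𝔾.- bar y
  bar-- (a , b) (c , d) = ≡.refl , S.solve 2
    (λ b d → S.:- (b S.:- d) S.:= S.:- b S.:- S.:- d) ≡.refl b d
  norm : ∀ k n → ∥ expSum (at n z) k 𝔾.- at n w ∥ ≡ ∥ expSum (at n (conjugate z)) k 𝔾.- at n
    (conjugate w) ∥
  norm k n = ≡.trans (≡.sym (norm-bar (expSum (at n z) k 𝔾.- at n w)))
    (𝔾.∥∥-cong {bar (e 𝔾.- at n w)} {e′ 𝔾.- bar (at n w)}
      (𝔾.trans {bar (e 𝔾.- at n w)} {bar e 𝔾.- bar (at n w)} {e′ 𝔾.- bar (at n w)}
        (bar-- e (at n w))
        (𝔾.+-congʳ {𝔾.- bar (at n w)} {bar e} {e′} (bar-expSum (at n z) k))))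
    where
    e e′ : 𝔾.Carrier
    e  = expSum (at n z) k
    e′ = expSum (bar (at n z)) k

abstract
  Exp : ℂ → ℂ → Set
  Exp z w = IsExp z w

  isExp⇒exp : ∀ {z w} → IsExp z w → Exp z w
  isExp⇒exp h = h

  exp⇒exponential : ∀ {z w} → Exp z w → Exponential z w
  exp⇒exponential {z} {w} h = isExp⇒exponential {z} {w} h

  exp-unique : ∀ z w w′ → Exp z w → Exp z w′ → w ≈ᶜ w′
  exp-unique z w w′ = isExp-unique {z} {w} {w′}

  exp-cong : ∀ z z′ w w′ → z ≈ᶜ z′ → w ≈ᶜ w′ → Exp z w → Exp z′ w′
  exp-cong z z′ w w′ = isExp-cong {z} {z′} {w} {w′}

  exp-+ : ∀ z w z′ w′ → Exp z w → Exp z′ w′ → Exp (z +ᶜ z′) (w *ᶜ w′)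
  exp-+ z w z′ w′ = isExp-+ {z} {w} {z′} {w′}

  exp-0 : Exp 0ᶜ 1ᶜ
  exp-0 = isExp-0

  exp-conjugate : ∀ {z w} → Exp z w → Exp (conjugate z) (conjugate w)
  exp-conjugate {z} {w} = isExp-conjugate {z} {w}

-- Consequences of the functional equation of the exponential

module ExpLaws
  (R : CommutativeRing 0ℓ 0ℓ)
  (E : CommutativeRing.Carrier R → CommutativeRing.Carrier R → Set)
  (E-cong′ : ∀ z z′ w w′ → CommutativeRing._≈_ R z z′ → CommutativeRing._≈_ R w w′ → E z w →
    E z′ w′)
  (E-unique′ : ∀ z w w′ → E z w → E z w′ → CommutativeRing._≈_ R w w′)
  (E-0 : E (CommutativeRing.0# R) (CommutativeRing.1# R))
  (E-+′ : ∀ z w z′ w′ → E z w → E z′ w′ →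
    E (CommutativeRing._+_ R z z′) (CommutativeRing._*_ R w w′))
  where
  open CommutativeRing R
  open Mult semiring using (×-congʳ; ×-assocˡ; ×-congˡ) renaming (_×_ to _•_)
  open CMult +-commutativeMonoid using (×-distrib-+)
  open Exp semiring using (_^_; ^-congˡ; ^-assocʳ)
  open SetoidReasoning setoid

  E-cong : ∀ {z z′ w w′} → z ≈ z′ → w ≈ w′ → E z w → E z′ w′
  E-cong = E-cong′ _ _ _ _

  E-unique : ∀ {z w w′} → E z w → E z w′ → w ≈ w′
  E-unique = E-unique′ _ _ _

  E-+ : ∀ {z w z′ w′} → E z w → E z′ w′ → E (z + z′) (w * w′)
  E-+ = E-+′ _ _ _ _

  E-• : ∀ n {z w} → E z w → E (n • z) (w ^ n)
  E-• zero    h = E-0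
  E-• (suc n) h = E-+ h (E-• n h)

  E-neg : ∀ {z w w′} → E z w → E (- z) w′ → w * w′ ≈ 1#
  E-neg h h′ = E-unique (E-cong (-‿inverseʳ _) refl (E-+ h h′)) E-0

  1^n≈1 : ∀ n → 1# ^ n ≈ 1#
  1^n≈1 zero    = refl
  1^n≈1 (suc n) = trans (*-identityˡ _) (1^n≈1 n)

  private
    square≈1 : ∀ {c} → c * c ≈ 1# → ∀ n → c ^ (2 ℕ.* n) ≈ 1#
    square≈1 {c} h n = begin
      c ^ (2 ℕ.* n)      ≈⟨ ^-assocʳ c 2 n ⟨
      (c ^ 2) ^ n        ≈⟨ ^-congˡ n (trans (*-congˡ (*-identityʳ c)) h) ⟩
      1# ^ n             ≈⟨ 1^n≈1 n ⟩
      1#                 ∎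

  -- All that is known of `c` is that its square is 1, so the relation between `z′` and `z` is
  -- doubled to make every exponent of `c` even. The summand `b • z` accounts for negative
  -- multiples.
  rationalMultiple-root : ∀ {z c z′ u} → E z c → c * c ≈ 1# → E z′ u → ∀ q a b →
    q • z′ + b • z ≈ a • z →
    u ^ (q ℕ.* 2) ≈ 1#
  rationalMultiple-root {z} {c} {z′} {u} hz c²≈1 hz′ q a b eq = E-unique
    (E-cong doubled value (E-+ (E-• (q ℕ.* 2) hz′) (E-• (2 ℕ.* b) hz)))
    (E-cong refl (square≈1 c²≈1 a) (E-• (2 ℕ.* a) hz))
    where
    value : u ^ (q ℕ.* 2) * c ^ (2 ℕ.* b) ≈ u ^ (q ℕ.* 2)
    value = trans (*-congˡ (square≈1 c²≈1 b)) (*-identityʳ _)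
    doubled : (q ℕ.* 2) • z′ + (2 ℕ.* b) • z ≈ (2 ℕ.* a) • z
    doubled = begin
      (q ℕ.* 2) • z′ + (2 ℕ.* b) • z   ≈⟨ +-congʳ (×-congˡ (ℕ.*-comm q 2)) ⟩
      (2 ℕ.* q) • z′ + (2 ℕ.* b) • z   ≈⟨ +-cong (×-assocˡ z′ 2 q) (×-assocˡ z 2 b) ⟨
      2 • (q • z′) + 2 • (b • z)       ≈⟨ ×-distrib-+ (q • z′) (b • z) 2 ⟨
      2 • (q • z′ + b • z)             ≈⟨ ×-congʳ 2 eq ⟩
      2 • (a • z)                      ≈⟨ ×-assocˡ z 2 a ⟩
      (2 ℕ.* a) • z                    ∎

module ℂ-exp = ExpLaws ℂ-commutativeRing Exp exp-cong exp-unique exp-0 exp-+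

-- Rational pairs and roots of unity

private
  module ℂD = DomainProperties ℂ-domain
open TwoLegPaths ℂ-domain
open Leg using (coefficient; direction; ratio; factored)

denominator*γ : ∀ γ → nat (ℚ.↧ₙ γ) ℚ.* γ ≡ ℚ.↥ γ ℚ./ 1
denominator*γ γ@(mkℚ i d-1 _) = ℚ.toℚᵘ-injective (begin
  ℚ.toℚᵘ (nat (suc d-1) ℚ.* γ)                          ≈⟨ ℚ.toℚᵘ-homo-* (nat (suc d-1)) γ ⟩
  ℚ.toℚᵘ (nat (suc d-1)) ℚᵘ.* ℚᵘ.mkℚᵘ i d-1
    ≈⟨ ℚᵘ.*-congʳ {ℚᵘ.mkℚᵘ i d-1} (ℚ.toℚᵘ-fromℚᵘ (ℚᵘ.mkℚᵘ (+ suc d-1) 0)) ⟩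
  ℚᵘ.mkℚᵘ (+ suc d-1) 0 ℚᵘ.* ℚᵘ.mkℚᵘ i d-1
    ≈⟨ ℚᵘ.*≡* (≡.trans (ℤ.*-identityʳ (+ suc d-1 ℤ.* i))
    (≡.trans (ℤ.*-comm (+ suc d-1) i)
    (≡.cong (λ k → i ℤ.* (+ k)) (≡.sym (ℕ.+-identityʳ (suc d-1)))))) ⟩
  ℚᵘ.mkℚᵘ i 0                                           ≈⟨ ℚ.toℚᵘ-fromℚᵘ (ℚᵘ.mkℚᵘ i 0) ⟨
  ℚ.toℚᵘ (i ℚ./ 1)                                      ∎)
  where open ℚᵘ.≃-Reasoning

negative/1 : ∀ m → (-[1+ m ] ℚ./ 1) ℚ.+ nat (suc m) ≡ 0ℚ
negative/1 m = ℚ.+-inverseˡ (nat (suc m))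

clearDenominator : ∀ γ → ∃[ q-1 ] ∃[ a ] ∃[ b ] nat (suc q-1) ℚ.* γ ℚ.+ nat b ≡ nat a
clearDenominator γ@(mkℚ (+ a) d-1 _)    = d-1 , a , 0 , ≡.trans (ℚ.+-identityʳ _) (denominator*γ γ)
clearDenominator γ@(mkℚ -[1+ m ] d-1 _) = d-1 , 0 , suc m , ≡.trans
  (≡.cong (ℚ._+ nat (suc m)) (denominator*γ γ)) (negative/1 m)

n•z≈ : ∀ n z → (n ℂ×.× z) ≈ᶜ fromℚᶜ (nat n) *ᶜ z
n•z≈ n z = ℂR.trans {n ℂ×.× z} {(n ℂ×.× 1ᶜ) *ᶜ z} {fromℚᶜ (nat n) *ᶜ z} (ℂD.x•y≈x1*y n z)
  (ℂR.*-congʳ {z} {n ℂ×.× 1ᶜ} {fromℚᶜ (nat n)} (n×1 n))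

pointwiseᶜ : ∀ {z w} → (∀ n → seq (re z) n ≡ seq (re w) n) → (∀ n → seq (im z) n ≡ seq (im w) n) →
  z ≈ᶜ w
pointwiseᶜ {z} {w} p q = pointwise {re z} {re w} p , pointwise {im z} {im w} q

angleMultiple : ∀ π γ {q a b} → nat q ℚ.* γ ℚ.+ nat b ≡ nat a →
  (q ℂ×.× (0ᴿ +i (π *ᴿ fromℚ γ))) +ᶜ (b ℂ×.× (0ᴿ +i π)) ≈ᶜ (a ℂ×.× (0ᴿ +i π))
angleMultiple π γ {q} {a} {b} eq = begin
  (q ℂ×.× z′) +ᶜ (b ℂ×.× z) ≈⟨ ℂR.+-cong {q ℂ×.× z′} {fromℚᶜ (nat q) *ᶜ z′} {b ℂ×.× z}
    {fromℚᶜ (nat b) *ᶜ z} (n•z≈ q z′) (n•z≈ b z) ⟩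
  (fromℚᶜ (nat q) *ᶜ z′) +ᶜ (fromℚᶜ (nat b) *ᶜ z)
    ≈⟨ pointwiseᶜ {(fromℚᶜ (nat q) *ᶜ z′) +ᶜ (fromℚᶜ (nat b) *ᶜ z)}
    {fromℚᶜ (nat a) *ᶜ z} real imaginary ⟩
  fromℚᶜ (nat a) *ᶜ z                               ≈⟨ n•z≈ a z ⟨
  (a ℂ×.× z)                                     ∎
  where
  open SetoidReasoning ℂR.setoid
  z z′ : ℂ
  z  = 0ᴿ +i π
  z′ = 0ᴿ +i (π *ᴿ fromℚ γ)
  real : ∀ n → (nat q ℚ.* 0ℚ ℚ.- 0ℚ ℚ.* (seq π n ℚ.* γ)) ℚ.+ (nat b ℚ.* 0ℚ ℚ.- 0ℚ ℚ.* seq π n) ≡ nat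
    a ℚ.* 0ℚ ℚ.- 0ℚ ℚ.* seq π n
  real n = S.solve 5 (λ q b a p g →
    (q S.:* S.con 0ℚ S.:- S.con 0ℚ S.:* (p S.:* g)) S.:+ (b S.:* S.con 0ℚ S.:- S.con 0ℚ S.:* p)
    S.:= a S.:* S.con 0ℚ S.:- S.con 0ℚ S.:* p) ≡.refl (nat q) (nat b) (nat a) (seq π n) γ
  imaginary : ∀ n → (nat q ℚ.* (seq π n ℚ.* γ) ℚ.+ 0ℚ ℚ.* 0ℚ) ℚ.+ (nat b ℚ.* seq π n ℚ.+ 0ℚ ℚ.* 0ℚ)
    ≡ nat a ℚ.* seq π n ℚ.+ 0ℚ ℚ.* 0ℚ
  imaginary n = ≡.trans
    (S.solve 4 (λ q b p g → (q S.:* (p S.:* g) S.:+ S.con 0ℚ S.:* S.con 0ℚ)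
      S.:+ (b S.:* p S.:+ S.con 0ℚ S.:* S.con 0ℚ) S.:= (q S.:* g S.:+ b) S.:* p S.:+ S.con 0ℚ
      S.:* S.con 0ℚ) ≡.refl (nat q) (nat b) (seq π n) γ)
    (≡.cong (λ s → s ℚ.* seq π n ℚ.+ 0ℚ ℚ.* 0ℚ) eq)

conjugate-imaginary : ∀ t → conjugate (0ᴿ +i t) ≈ᶜ ℂR.- (0ᴿ +i t)
conjugate-imaginary t = pointwiseᶜ {conjugate (0ᴿ +i t)} {ℂR.- (0ᴿ +i t)} (λ _ → ≡.refl)
  (λ _ → ≡.refl)

unitModulus : ∀ {t u} → Exp (0ᴿ +i t) u → u *ᶜ conjugate u ≈ᶜ 1ᶜ
unitModulus {t} {u} h = ℂ-exp.E-neg {0ᴿ +i t} {u} {conjugate u} h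
  (exp-cong (conjugate (0ᴿ +i t)) (ℂR.- (0ᴿ +i t)) (conjugate u) (conjugate u)
    (conjugate-imaginary t) (ℂR.refl {conjugate u}) (exp-conjugate {0ᴿ +i t} {u} h))

-- A vanishing sine makes `e^{iπ}` real, hence equal to its conjugate, and unit modulus then says
-- that its square is 1.
isPi-square : ∀ {π} → IsPi π → ∃[ c ] Exp (0ᴿ +i π) c × c *ᶜ c ≈ᶜ 1ᶜ
isPi-square {π} (_ , (c , h) , _) = (c +i 0ᴿ) , e , ℂR.trans {(c +i 0ᴿ) *ᶜ (c +i 0ᴿ)}
  {(c +i 0ᴿ) *ᶜ conjugate (c +i 0ᴿ)} {1ᶜ}
    (pointwiseᶜ {(c +i 0ᴿ) *ᶜ (c +i 0ᴿ)} {(c +i 0ᴿ) *ᶜ conjugate (c +i 0ᴿ)} (λ _ → ≡.refl)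
      (λ _ → ≡.refl))
    (unitModulus {π} {c +i 0ᴿ} e)
  where
  e : Exp (0ᴿ +i π) (c +i 0ᴿ)
  e = isExp⇒exp {0ᴿ +i π} {c +i 0ᴿ} h

rootOfUnity : ∀ {π γ u} → IsPi π → IsExp (0ᴿ +i (π *ᴿ fromℚ γ)) u → ∃[ N-1 ] u ℂ^.^ suc N-1 ≈ᶜ 1ᶜ
rootOfUnity {π} {γ} {u} isπ h = fromDenominator (clearDenominator γ) (isPi-square {π} isπ)
  where
  fromDenominator : (∃[ q-1 ] ∃[ a ] ∃[ b ] nat (suc q-1) ℚ.* γ ℚ.+ nat b ≡ nat a) →
    (∃[ c ] Exp (0ᴿ +i π) c × c *ᶜ c ≈ᶜ 1ᶜ) → ∃[ N-1 ] u ℂ^.^ suc N-1 ≈ᶜ 1ᶜ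
  fromDenominator (q-1 , a , b , eq) (c , e , c²≈1) = suc (q-1 ℕ.* 2) ,
    ℂ-exp.rationalMultiple-root {0ᴿ +i π} {c} {0ᴿ +i (π *ᴿ fromℚ γ)} {u} e c²≈1
      (isExp⇒exp {0ᴿ +i (π *ᴿ fromℚ γ)} {u} h) (suc q-1) a b
        (angleMultiple π γ {suc q-1} {a} {b} eq)

unit-normSq : ∀ {t u} → IsExp (0ᴿ +i t) u → normSq u ≈ᴿ 1ᴿ
unit-normSq {t} {u} h = ℝR.trans {normSq u} {re (u *ᶜ conjugate u)} {1ᴿ}
  (pointwise {normSq u} {re (u *ᶜ conjugate u)} λ n →
    S.solve 2 (λ a b → a S.:* a S.:+ b S.:* b S.:= a S.:* a S.:- b S.:* (S.:- b)) ≡.refl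
    (seq (re u) n) (seq (im u) n))
  (proj₁ (unitModulus {t} {u} (isExp⇒exp {0ᴿ +i t} {u} h)))

equalSquares : ∀ {r d} → 0ᴿ <ᴿ r → 0ℚ ℚ.< d → r *ᴿ r ≈ᴿ fromℚ d *ᴿ fromℚ d → r ≈ᴿ fromℚ d
equalSquares {r} {d} (δ , 0<δ , p) 0<d eq = ≈-x-y {r} {fromℚ d}
  (ℝ-noZeroDivisors {r +ᴿ fromℚ d} {r -ᴿ fromℚ d} (positive≉0 {r +ᴿ fromℚ d} sum>0)
  (ℝR.trans {(r +ᴿ fromℚ d) *ᴿ (r -ᴿ fromℚ d)} {r *ᴿ r -ᴿ fromℚ d *ᴿ fromℚ d} {0ᴿ}
    (pointwise {(r +ᴿ fromℚ d) *ᴿ (r -ᴿ fromℚ d)} {r *ᴿ r -ᴿ fromℚ d *ᴿ fromℚ d} λ n →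
      S.solve 2 (λ r d → (r S.:+ d) S.:* (r S.:- d) S.:= r S.:* r S.:- d S.:* d) ≡.refl (seq r n) d)
    (x-y≈0 {r *ᴿ r} {fromℚ d *ᴿ fromℚ d} eq)))
  where
  sum>0 : 0ᴿ <ᴿ r +ᴿ fromℚ d
  sum>0 = δ , 0<δ , eventually-map (λ {n} h → 0<⇒< (0<+ 0<d (<⇒0<- h))
    (S.solve 3 (λ r d e → r S.:+ d S.:= (S.con 0ℚ S.:+ e) S.:+ (d S.:+ (r S.:- (S.con 0ℚ S.:+ e))))
      ≡.refl (seq r n) d δ)) p

nonNegative-ℚ : ∀ {d} → 0ᴿ ≤ᴿ fromℚ d → 0ℚ ℚ.≤ d
nonNegative-ℚ {d} h = ℚ.≮⇒≥ λ d<0 →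
  h (ℚ.- (½ ℚ.* d) , 0<-½d d<0 , always λ _ → 0<⇒< (0<-½d d<0) (split d))
  where
  0<-½d : d ℚ.< 0ℚ → 0ℚ ℚ.< ℚ.- (½ ℚ.* d)
  0<-½d d<0 = ≡.subst (0ℚ ℚ.<_) (S.solve 1
    (λ d → S.con ½ S.:* (S.:- d) S.:= S.:- (S.con ½ S.:* d)) ≡.refl d)
    (0<* 0<½ (ℚ.neg-antimono-< d<0))
  split : ∀ d → 0ℚ ≡ d ℚ.+ ℚ.- (½ ℚ.* d) ℚ.+ ℚ.- (½ ℚ.* d)
  split = S.solve 1 (λ d → S.con 0ℚ S.:= d S.:+ S.:- (S.con ½ S.:* d) S.:+ S.:- (S.con ½ S.:* d))
    ≡.refl

positiveModulus : ∀ {r d} → 0ᴿ <ᴿ r → 0ℚ ℚ.≤ d → r *ᴿ r ≈ᴿ fromℚ d *ᴿ fromℚ d → 0ℚ ℚ.< d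
positiveModulus {r} {d} 0<r 0≤d eq = byCases (ℚ.<-cmp 0ℚ d)
  where
  zero-absurd : 0ℚ ≡ d → ⊥
  zero-absurd 0≡d = positive≉0 {r} 0<r (ℝ-noZeroDivisors {r} {r} (positive≉0 {r} 0<r)
    (ℝR.trans {r *ᴿ r} {fromℚ d *ᴿ fromℚ d} {0ᴿ} eq (pointwise {fromℚ d *ᴿ fromℚ d} {0ᴿ} λ _ →
      ≡.trans (≡.cong (ℚ._* d) (≡.sym 0≡d)) (ℚ.*-zeroˡ d))))
  byCases : Tri (0ℚ ℚ.< d) (0ℚ ≡ d) (d ℚ.< 0ℚ) → 0ℚ ℚ.< d
  byCases (tri< 0<d _ _) = 0<d
  byCases (tri≈ _ 0≡d _) = ⊥-elim (zero-absurd 0≡d)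
  byCases (tri> _ _ d<0) = ⊥-elim (ℚ.<-irrefl ≡.refl (ℚ.≤-<-trans 0≤d d<0))

normSq-scale : ∀ r u → normSq (r ·ᶜ u) ≈ᴿ (r *ᴿ r) *ᴿ normSq u
normSq-scale r u = pointwise {normSq (r ·ᶜ u)} {(r *ᴿ r) *ᴿ normSq u} λ n →
  S.solve 3 (λ r a b → (r S.:* a) S.:* (r S.:* a) S.:+ (r S.:* b) S.:* (r S.:* b) S.:= r S.:* r
    S.:* (a S.:* a S.:+ b S.:* b)) ≡.refl (seq r n) (seq (re u) n) (seq (im u) n)

normSq-sym : ∀ p q → normSq (p -ᶜ q) ≈ᴿ normSq (q -ᶜ p)
normSq-sym p q = pointwise {normSq (p -ᶜ q)} {normSq (q -ᶜ p)} λ n →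
  S.solve 4 (λ a b c d → (a S.:- c) S.:* (a S.:- c) S.:+ (b S.:- d) S.:* (b S.:- d) S.:= (c S.:- a)
    S.:* (c S.:- a) S.:+ (d S.:- b) S.:* (d S.:- b)) ≡.refl
    (seq (re p) n) (seq (im p) n) (seq (re q) n) (seq (im q) n)

positive-ratio : ∀ {d} → 0ℚ ℚ.< d → ∃[ m-1 ] ∃[ n-1 ] (suc n-1 ℂ×.× fromℚᶜ d) ≈ᶜ (suc m-1 ℂ×.× 1ᶜ)
positive-ratio {d} 0<d = numerator d 0<d (denominator*γ d)
  where
  n•fromℚᶜ : ∀ n q {m} → nat n ℚ.* q ≡ nat m → (n ℂ×.× fromℚᶜ q) ≈ᶜ (m ℂ×.× 1ᶜ)
  n•fromℚᶜ n q {m} eq = begin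
    (n ℂ×.× fromℚᶜ q)            ≈⟨ n•z≈ n (fromℚᶜ q) ⟩
    fromℚᶜ (nat n) *ᶜ fromℚᶜ q      ≈⟨ pointwiseᶜ {fromℚᶜ (nat n) *ᶜ fromℚᶜ q} {fromℚᶜ (nat m)}
                                   (λ _ → ≡.trans (S.solve 2
                                     (λ n q → n S.:* q S.:- S.con 0ℚ S.:* S.con 0ℚ S.:= n S.:* q)
                                     ≡.refl (nat n) q) eq)
                                   (λ _ → S.solve 2 (λ n q →
                                     n S.:* S.con 0ℚ S.:+ S.con 0ℚ S.:* q S.:= S.con 0ℚ) ≡.refl
                                     (nat n) q) ⟩
    fromℚᶜ (nat m)               ≈⟨ n×1 m ⟨
    (m ℂ×.× 1ᶜ)               ∎
    where open SetoidReasoning ℂR.setoid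
  numerator : ∀ d → 0ℚ ℚ.< d → nat (ℚ.↧ₙ d) ℚ.* d ≡ ℚ.↥ d ℚ./ 1 →
    ∃[ m-1 ] ∃[ n-1 ] (suc n-1 ℂ×.× fromℚᶜ d) ≈ᶜ (suc m-1 ℂ×.× 1ᶜ)
  numerator d@(mkℚ (+ suc m) n-1 _) _ eq = m , n-1 , n•fromℚᶜ (suc n-1) d {suc m} eq
  numerator d@(mkℚ (+ 0) n-1 _) 0<d _    = ⊥-elim (ℚ.<-irrefl (≡.sym (ℚ.↥p≡0⇒p≡0 d ≡.refl)) 0<d)
  numerator d@(mkℚ -[1+ m ] n-1 _) 0<d _ = ⊥-elim (ℚ.<-asym 0<d (ℚ.negative⁻¹ d))

-- The `r` of the angle and the `d` of the distance come from separate hypotheses. As `u` has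
-- modulus 1, both squares equal the squared distance, and positivity of `r` gives `r ≈ d`, so the
-- leg has a rational coefficient.
pairLeg : ∀ {p q} → HasRationalDistance p q → HasRationalAngle p q → Leg (q -ᶜ p)
pairLeg {p} {q} (d , 0≤d , d²≈) (r , γ , π , u , 0<r , isπ , e , q-p≈ru) = record
  { coefficient   = fromℚᶜ d
  ; direction     = u
  ; numerator-1   = proj₁ (positive-ratio 0<d)
  ; denominator-1 = proj₁ (proj₂ (positive-ratio 0<d))
  ; order-1       = proj₁ (rootOfUnity {π} {γ} {u} isπ e)
  ; ratio         = proj₂ (proj₂ (positive-ratio 0<d))
  ; root          = proj₂ (rootOfUnity {π} {γ} {u} isπ e)
  ; factored = ℂR.trans {q -ᶜ p} {r ·ᶜ u} {fromℚᶜ d *ᶜ u} q-p≈ru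
    (ℂR.trans {r ·ᶜ u} {fromℚ d ·ᶜ u} {fromℚᶜ d *ᶜ u}
      (ℝR.*-congʳ {re u} {r} {fromℚ d} r≈d , ℝR.*-congʳ {im u} {r} {fromℚ d} r≈d)
      (pointwiseᶜ {fromℚ d ·ᶜ u} {fromℚᶜ d *ᶜ u}
        (λ n → S.solve 3 (λ d a b → d S.:* a S.:= d S.:* a S.:- S.con 0ℚ S.:* b) ≡.refl d
          (seq (re u) n) (seq (im u) n))
        (λ n → S.solve 3 (λ d a b → d S.:* b S.:= d S.:* b S.:+ S.con 0ℚ S.:* a) ≡.refl d
          (seq (re u) n) (seq (im u) n))))
  }
  where
  r²≈d² : r *ᴿ r ≈ᴿ fromℚ d *ᴿ fromℚ d
  r²≈d² = begin
    r *ᴿ r                       ≈⟨ ℝR.*-identityʳ (r *ᴿ r) ⟨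
    r *ᴿ r *ᴿ 1ᴿ ≈⟨ ℝR.*-congˡ {r *ᴿ r} {normSq u} {1ᴿ} (unit-normSq {π *ᴿ fromℚ γ} {u} e) ⟨
    r *ᴿ r *ᴿ normSq u           ≈⟨ normSq-scale r u ⟨
    normSq (r ·ᶜ u)              ≈⟨ normSq-cong {q -ᶜ p} {r ·ᶜ u} q-p≈ru ⟨
    normSq (q -ᶜ p)              ≈⟨ normSq-sym p q ⟨
    normSq (p -ᶜ q)              ≈⟨ d²≈ ⟨
    fromℚ d *ᴿ fromℚ d           ∎
    where open SetoidReasoning ℝR.setoid
  0<d : 0ℚ ℚ.< d
  0<d = positiveModulus {r} {d} 0<r (nonNegative-ℚ {d} 0≤d) r²≈d²
  r≈d : r ≈ᴿ fromℚ d
  r≈d = equalSquares {r} {d} 0<r 0<d r²≈d²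

-- Order of the reals and real powers

<ᴿ-cong : ∀ {x x′ y y′} → x ≈ᴿ x′ → y ≈ᴿ y′ → x <ᴿ y → x′ <ᴿ y′
<ᴿ-cong {x} {x′} {y} {y′} p q (δ , 0<δ , h) = η , 0<η , eventually-zip₃ (λ {n} a b c → 0<⇒<
    (0<+ (<⇒0<- a) (0<+ (<⇒0<- (∣p∣<e⇒-e<p b)) (0<+ (<⇒0<- (∣p∣<e⇒p<e c)) 0<η)))
    (≡.trans (S.solve 6 (λ x x′ y y′ d e →
      y′ S.:= (x′ S.:+ e) S.:+ ((y S.:- (x S.:+ d))
      S.:+ (((x S.:- x′) S.:- (S.:- e)) S.:+ ((e S.:- (y S.:- y′)) S.:+ e)))
      S.:+ (d S.:- (e S.:+ e S.:+ (e S.:+ e)))) ≡.refl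
        (seq x n) (seq x′ n) (seq y n) (seq y′ n) δ η)
      (≡.trans (≡.cong (λ z → (seq x′ n ℚ.+ η) ℚ.+
        ((seq y n ℚ.- (seq x n ℚ.+ δ)) ℚ.+
        (((seq x n ℚ.- seq x′ n) ℚ.- (ℚ.- η)) ℚ.+ ((η ℚ.- (seq y n ℚ.- seq y′ n)) ℚ.+ η))) ℚ.+
        (δ ℚ.- z)) four)
        (S.solve 2 (λ a d → a S.:+ (d S.:- d) S.:= a) ≡.refl
          ((seq x′ n ℚ.+ η) ℚ.+ ((seq y n ℚ.- (seq x n ℚ.+ δ)) ℚ.+
          (((seq x n ℚ.- seq x′ n) ℚ.- (ℚ.- η)) ℚ.+ ((η ℚ.- (seq y n ℚ.- seq y′ n)) ℚ.+ η)))) δ))))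
    h (p η 0<η) (q η 0<η)
  where
  η : ℚ
  -- A quarter of the old gap: one share for the error in `x`, one for the error in `y`, one for the
  -- new gap, one spare.
  η = ½ ℚ.* (½ ℚ.* δ)
  0<η : 0ℚ ℚ.< η
  0<η = 0<½* (0<½* 0<δ)
  four : η ℚ.+ η ℚ.+ (η ℚ.+ η) ≡ δ
  four = ≡.trans (≡.cong₂ ℚ._+_ (halves (½ ℚ.* δ)) (halves (½ ℚ.* δ))) (halves δ)

<ᴿ-asym : ∀ {x y} → x <ᴿ y → ¬ y <ᴿ x
<ᴿ-asym (δ , 0<δ , p) (η , 0<η , q) with witness (eventually-zip _,_ p q)
... | n , a , b = ℚ.<-asym (ℚ.<-trans (0<⇒< 0<δ ≡.refl) a) (ℚ.<-trans (0<⇒< 0<η ≡.refl) b)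

<ᴿ-irrefl : ∀ {x} → ¬ x <ᴿ x
<ᴿ-irrefl {x} h = <ᴿ-asym {x} {x} h h

fromℕ-< : ∀ {m n} → fromℕ m <ᴿ fromℕ n → m ℕ.< n
fromℕ-< {m} {n} (δ , 0<δ , h) = ℕ.≰⇒> λ n≤m → ℚ.<-irrefl ≡.refl
  (ℚ.≤-<-trans (nat-mono-≤ n≤m) (ℚ.<-trans (0<⇒< 0<δ ≡.refl) (proj₂ (witness h))))

0<diff⇒< : ∀ {x y} → 0ᴿ <ᴿ y -ᴿ x → x <ᴿ y
0<diff⇒< {x} {y} (δ , 0<δ , h) = δ , 0<δ , eventually-map (λ {n} a → 0<⇒< (<⇒0<- a)
  (S.solve 3 (λ x y d → y S.:= (x S.:+ d) S.:+ ((y S.:- x) S.:- (S.con 0ℚ S.:+ d))) ≡.refl (seq x n)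
    (seq y n) δ)) h

diff<0⇒< : ∀ {x y} → y -ᴿ x <ᴿ 0ᴿ → y <ᴿ x
diff<0⇒< {x} {y} (δ , 0<δ , h) = δ , 0<δ , eventually-map (λ {n} a → 0<⇒< (<⇒0<- a)
  (S.solve 3 (λ x y d → x S.:= (y S.:+ d) S.:+ (S.con 0ℚ S.:- ((y S.:- x) S.:+ d))) ≡.refl (seq x n)
    (seq y n) δ)) h

<⇒diff<0 : ∀ {x y} → y <ᴿ x → y -ᴿ x <ᴿ 0ᴿ
<⇒diff<0 {x} {y} (δ , 0<δ , h) = δ , 0<δ , eventually-map (λ {n} a → 0<⇒< (<⇒0<- a)
  (S.solve 3 (λ x y d → S.con 0ℚ S.:= ((y S.:- x) S.:+ d) S.:+ (x S.:- (y S.:+ d))) ≡.refl (seq x n)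
    (seq y n) δ)) h

trichotomy : ∀ x y → ¬ ¬ (x <ᴿ y ⊎ x ≈ᴿ y ⊎ y <ᴿ x)
trichotomy x y k = trichotomy₀ (y -ᴿ x) λ where
  (inj₁ p)        → k (inj₁ (0<diff⇒< {x} {y} p))
  (inj₂ (inj₁ z)) → k (inj₂ (inj₁ (ℝR.sym {y} {x} (≈-x-y {y} {x} z))))
  (inj₂ (inj₂ n)) → k (inj₂ (inj₂ (diff<0⇒< {x} {y} n)))

0<ᴿ-* : ∀ {x y} → 0ᴿ <ᴿ x → 0ᴿ <ᴿ y → 0ᴿ <ᴿ x *ᴿ y
0<ᴿ-* {x} {y} (δ , 0<δ , p) (η , 0<η , q) = ½ ℚ.* (δ ℚ.* η) , 0<½* 0<δη , eventually-zip
  (λ {n} a b → begin-strict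
    0ℚ ℚ.+ ½ ℚ.* (δ ℚ.* η)   ≡⟨ ℚ.+-identityˡ (½ ℚ.* (δ ℚ.* η)) ⟩
    ½ ℚ.* (δ ℚ.* η)          <⟨ 0<⇒< (0<½* 0<δη) (≡.sym (halves (δ ℚ.* η))) ⟩
    δ ℚ.* η ≤⟨ *-mono-≤-nonNeg (ℚ.<⇒≤ 0<η) (ℚ.≤-trans (ℚ.<⇒≤ 0<δ) (below {δ} a)) (below {δ} a)
      (below {η} b) ⟩
    seq x n ℚ.* seq y n      ∎) p q
  where
  open ℚ.≤-Reasoning
  0<δη : 0ℚ ℚ.< δ ℚ.* η
  0<δη = 0<* 0<δ 0<η
  below : ∀ {d p} → 0ℚ ℚ.+ d ℚ.< p → d ℚ.≤ p
  below {d} {p} h = ℚ.<⇒≤ (≡.subst (ℚ._< p) (ℚ.+-identityˡ d) h)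

≮0-* : ∀ {x y} → 0ᴿ ≤ᴿ x → 0ᴿ ≤ᴿ y → 0ᴿ ≤ᴿ x *ᴿ y
≮0-* {x} {y} 0≤x 0≤y xy<0 = trichotomy₀ x λ where
  (inj₂ (inj₂ x<0)) → 0≤x x<0
  (inj₂ (inj₁ x≈0)) → negative≉0 {x *ᴿ y} xy<0
    (ℝR.trans {x *ᴿ y} {0ᴿ *ᴿ y} {0ᴿ} (ℝR.*-congʳ {y} {x} {0ᴿ} x≈0) (ℝR.zeroˡ y))
  (inj₁ 0<x) → trichotomy₀ y λ where
    (inj₂ (inj₂ y<0)) → 0≤y y<0
    (inj₂ (inj₁ y≈0)) → negative≉0 {x *ᴿ y} xy<0
      (ℝR.trans {x *ᴿ y} {x *ᴿ 0ᴿ} {0ᴿ} (ℝR.*-congˡ {x} {y} {0ᴿ} y≈0) (ℝR.zeroʳ x))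
    (inj₁ 0<y) → <ᴿ-asym {0ᴿ} {x *ᴿ y} (0<ᴿ-* {x} {y} 0<x 0<y) xy<0

-- Strict growth of the exponential and real powers

private
  module 𝔾^ = Exp 𝔾.semiring

  NonNegative : 𝔾.Carrier → Set
  NonNegative (a , b) = 0ℚ ℚ.≤ a × b ≡ 0ℚ

  nonNeg-+ : ∀ {x y} → NonNegative x → NonNegative y → NonNegative (x 𝔾.+ y)
  nonNeg-+ (p , q) (r , s) = 0≤+ p r , ≡.trans (≡.cong₂ ℚ._+_ q s) (ℚ.+-identityˡ 0ℚ)

  nonNeg-* : ∀ {x y} → NonNegative x → NonNegative y → NonNegative (x 𝔾.* y)
  nonNeg-* {a , b} {c , d} (p , q) (r , s) =
      ≡.subst (0ℚ ℚ.≤_) (≡.trans (S.solve 2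
        (λ a c → a S.:* c S.:= a S.:* c S.:- S.con 0ℚ S.:* S.con 0ℚ) ≡.refl a c)
        (≡.cong₂ (λ b d → a ℚ.* c ℚ.- b ℚ.* d) (≡.sym q) (≡.sym s))) (0≤* p r)
    , ≡.trans (≡.cong₂ (λ b d → a ℚ.* d ℚ.+ b ℚ.* c) q s)
      (S.solve 2 (λ a c → a S.:* S.con 0ℚ S.:+ S.con 0ℚ S.:* c S.:= S.con 0ℚ) ≡.refl a c)

  nonNeg-^ : ∀ {x} → NonNegative x → ∀ n → NonNegative (x 𝔾^.^ n)
  nonNeg-^ h zero    = ℚ.<⇒≤ 0<1 , ≡.refl
  nonNeg-^ h (suc n) = nonNeg-* h (nonNeg-^ h n)

  nonNeg-sum : ∀ u → (∀ j → NonNegative (u j)) → ∀ k → NonNegative (partialSum u k)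
  nonNeg-sum u h zero    = ℚ.≤-refl , ≡.refl
  nonNeg-sum u h (suc k) = nonNeg-+ (h 0) (nonNeg-sum (u ∘ suc) (h ∘ suc) k)

  -- The first two terms are 1 and `h`, the later ones are nonnegative rationals; hence at least two
  -- terms are summed.
  1+h≤exp : ∀ {h} → 0ℚ ℚ.≤ h → ∀ k →
    ∃[ q ] 1ℚ ℚ.+ h ℚ.≤ q × expSum (h , 0ℚ) (suc (suc k)) 𝔾.≈ (q , 0ℚ)
  1+h≤exp {h} 0≤h k = 1ℚ ℚ.+ (h ℚ.+ proj₁ rest) , ℚ.+-monoʳ-≤ 1ℚ {h} {h ℚ.+ proj₁ rest}
    (0≤⇒≤ {h} {h ℚ.+ proj₁ rest} {proj₁ rest} (proj₁ nonNeg) ≡.refl)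
    , (S.solve 2 (λ h r → (S.con 1ℚ S.:* S.con 1ℚ S.:- S.con 0ℚ S.:* S.con 0ℚ)
      S.:+ ((S.con 1ℚ S.:* (h S.:* S.con 1ℚ S.:- S.con 0ℚ S.:* S.con 0ℚ) S.:- S.con 0ℚ
      S.:* (h S.:* S.con 0ℚ S.:+ S.con 0ℚ S.:* S.con 1ℚ)) S.:+ r) S.:= S.con 1ℚ S.:+ (h S.:+ r))
      ≡.refl h (proj₁ rest))
    , ≡.trans (S.solve 2 (λ h r →
      (S.con 1ℚ S.:* S.con 0ℚ S.:+ S.con 0ℚ S.:* S.con 1ℚ)
      S.:+ ((S.con 1ℚ S.:* (h S.:* S.con 0ℚ S.:+ S.con 0ℚ S.:* S.con 1ℚ) S.:+ S.con 0ℚ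
      S.:* (h S.:* S.con 1ℚ S.:- S.con 0ℚ S.:* S.con 0ℚ)) S.:+ r) S.:= r) ≡.refl h (proj₂ rest))
      (proj₂ nonNeg)
    where
    rest : 𝔾.Carrier
    rest = partialSum (expTerm (h , 0ℚ) ∘ suc ∘ suc) k
    nonNeg : NonNegative rest
    nonNeg = nonNeg-sum (expTerm (h , 0ℚ) ∘ suc ∘ suc)
      (λ j → nonNeg-* (ℚ.<⇒≤ (0<1/! (suc (suc j))) , ≡.refl)
      (nonNeg-^ (0≤h , ≡.refl) (suc (suc j)))) k

  -- From `N ≥ 1` and `δ ≤ 1` one gets `(N - ε)(1 + δ) - 2ε ≥ N + δ - 4ε`, and with `8ε = δ` the
  -- right side is `N + δ/2`.
  growth : ∀ {N δ ε e q f Y} → 1ℚ ℚ.≤ N → 0ℚ ℚ.< δ → δ ℚ.≤ 1ℚ → 0ℚ ℚ.< ε → nat 8 ℚ.* ε ≡ δ →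
    ℚ.∣ e ℚ.- N ∣ ℚ.< ε → 1ℚ ℚ.+ δ ℚ.≤ q → ℚ.∣ e ℚ.* q ℚ.- f ∣ ℚ.< ε → ℚ.∣ f ℚ.- Y ∣ ℚ.< ε →
      N ℚ.+ ½ ℚ.* δ ℚ.< Y
  growth {N} {δ} {ε} {e} {q} {f} {Y} 1≤N 0<δ δ≤1 0<ε 8ε≡δ e≈N q≥ eq≈f f≈Y = begin-strict
    N ℚ.+ ½ ℚ.* δ
      ≡⟨ ≡.cong (λ d → N ℚ.+ ½ ℚ.* d) 8ε≡δ ⟨
    N ℚ.+ ½ ℚ.* (nat 8 ℚ.* ε)
      ≤⟨ 0≤⇒≤ (0≤+ (0≤* (ℚ.<⇒≤ 0<ε) (≤⇒0≤- δ≤1)) (0≤* (≤⇒0≤- 1≤N) (ℚ.<⇒≤ 0<δ)))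
           (≡.trans unchanged (S.solve 3
             (λ N d e → ((N S.:- e) S.:* (S.con 1ℚ S.:+ d) S.:- e S.:- e)
             S.:+ (S.con (nat 8) S.:* e S.:- d) S.:= (N S.:+ S.con ½ S.:* (S.con (nat 8) S.:* e))
             S.:+ (e S.:* (S.con 1ℚ S.:- d) S.:+ (N S.:- S.con 1ℚ) S.:* d)) ≡.refl N δ ε)) ⟩
    (N ℚ.- ε) ℚ.* (1ℚ ℚ.+ δ) ℚ.- ε ℚ.- ε
      ≤⟨ ℚ.+-monoˡ-≤ (ℚ.- ε) (ℚ.+-monoˡ-≤ (ℚ.- ε)
        (*-mono-≤-nonNeg (0≤+ (ℚ.<⇒≤ 0<1) (ℚ.<⇒≤ 0<δ)) (ℚ.≤-trans 0≤N-ε N-ε≤e) N-ε≤e q≥)) ⟩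
    e ℚ.* q ℚ.- ε ℚ.- ε
      <⟨ 0<⇒< (0<+ (<⇒0<- (∣p∣<e⇒p<e eq≈f)) (<⇒0<- (∣p∣<e⇒p<e f≈Y)))
        (S.solve 4 (λ p e f Y → Y S.:= (p S.:- e S.:- e)
        S.:+ ((e S.:- (p S.:- f)) S.:+ (e S.:- (f S.:- Y)))) ≡.refl (e ℚ.* q) ε f Y) ⟩
    Y ∎
    where
    open ℚ.≤-Reasoning
    base : ℚ
    base = (N ℚ.- ε) ℚ.* (1ℚ ℚ.+ δ) ℚ.- ε ℚ.- ε
    unchanged : base ≡ base ℚ.+ (nat 8 ℚ.* ε ℚ.- δ)
    unchanged = ≡.sym (≡.trans (≡.cong (base ℚ.+_)
      (≡.trans (≡.cong (ℚ._- δ) 8ε≡δ) (ℚ.+-inverseʳ δ))) (ℚ.+-identityʳ base))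
    N-ε≤e : N ℚ.- ε ℚ.≤ e
    N-ε≤e = 0≤⇒≤ (ℚ.<⇒≤ (<⇒0<- (∣p∣<e⇒-e<p e≈N)))
      (S.solve 3 (λ N ε e → e S.:= (N S.:- ε) S.:+ ((e S.:- N) S.:- (S.:- ε))) ≡.refl N ε e)
    0≤N-ε : 0ℚ ℚ.≤ N ℚ.- ε
    0≤N-ε = ≤⇒0≤- (ℚ.≤-trans ε≤1 1≤N)
      where
      ε≤1 : ε ℚ.≤ 1ℚ
      ε≤1 = ℚ.≤-trans (0≤⇒≤ (0≤* (nat-mono-≤ {0} {7} ℕ.z≤n) (ℚ.<⇒≤ 0<ε))
        (≡.trans (≡.sym 8ε≡δ) (S.solve 1
        (λ e → S.con (nat 8) S.:* e S.:= e S.:+ S.con (nat 7) S.:* e) ≡.refl ε))) δ≤1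

  ∣first∣≤ : ∀ x → ℚ.∣ proj₁ x ∣ ℚ.≤ 𝔾.∥ x ∥
  ∣first∣≤ (a , b) = ℚ.≤-trans (ℚ.≤-reflexive (≡.sym (ℚ.+-identityʳ ℚ.∣ a ∣)))
    (ℚ.+-monoʳ-≤ ℚ.∣ a ∣ (ℚ.0≤∣p∣ b))

  product-first : ∀ e x f {q ε} → x 𝔾.≈ (q , 0ℚ) → 𝔾.∥ e 𝔾.* x 𝔾.- f ∥ ℚ.< ε →
    ℚ.∣ proj₁ e ℚ.* q ℚ.- proj₁ f ∣ ℚ.< ε
  product-first (e₁ , e₂) (a , b) (f₁ , f₂) {q} {ε} (a≡q , b≡0) h = ≡.subst (λ t → ℚ.∣ t ∣ ℚ.< ε)
    (≡.trans (≡.cong₂ (λ a b → e₁ ℚ.* a ℚ.- e₂ ℚ.* b ℚ.- f₁) a≡q b≡0)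
      (S.solve 4 (λ e₁ e₂ q f₁ → (e₁ S.:* q S.:- e₂ S.:* S.con 0ℚ) S.:- f₁ S.:= e₁ S.:* q S.:- f₁)
        ≡.refl e₁ e₂ q f₁))
    (ℚ.≤-<-trans (∣first∣≤ ((e₁ , e₂) 𝔾.* (a , b) 𝔾.- (f₁ , f₂))) h)

-- The idea is `e^y = e^x e^(y-x)` with `e^(y-x) ≥ 1 + (y - x)`. No value of `e^(y-x)` is given, so
-- the factorisation is applied to partial sums at late rational approximations, where
-- `expSum-product` holds for any two arguments.
exp-strict : ∀ {x y Y n} → 1 ℕ.≤ n → Exp (x +i 0ᴿ) (fromℕ n +i 0ᴿ) → Exp (y +i 0ᴿ) (Y +i 0ᴿ) →
  x <ᴿ y → fromℕ n <ᴿ Y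
exp-strict {x} {y} {Y} {n} 1≤n hx hy (δ₀ , 0<δ₀ , gap) =
  conclude (exp⇒exponential {z} {fromℕ n +i 0ᴿ} hx 0<ε) (exp⇒exponential {z +ᶜ d} {Y +i 0ᴿ} hy′ 0<ε)
    (expSum-product z d 0<ε)
  where
  z d : ℂ
  z = x +i 0ᴿ
  d = (y -ᴿ x) +i 0ᴿ
  hy′ : Exp (z +ᶜ d) (Y +i 0ᴿ)
  hy′ = exp-cong (y +i 0ᴿ) (z +ᶜ d) (Y +i 0ᴿ) (Y +i 0ᴿ)
    (pointwise {y} {x +ᴿ (y -ᴿ x)}
      (λ m → S.solve 2 (λ x y → y S.:= x S.:+ (y S.:- x)) ≡.refl (seq x m) (seq y m)) , pointwise
      {0ᴿ} {0ᴿ +ᴿ 0ᴿ} λ _ → ≡.refl)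
    (ℂR.refl {Y +i 0ᴿ}) hy
  δ ε : ℚ
  δ = δ₀ ℚ.⊓ 1ℚ
  0<δ : 0ℚ ℚ.< δ
  0<δ = minimum (ℚ.≤-total δ₀ 1ℚ)
    where
    minimum : δ₀ ℚ.≤ 1ℚ ⊎ 1ℚ ℚ.≤ δ₀ → 0ℚ ℚ.< δ
    minimum (inj₁ p) = ≡.subst (0ℚ ℚ.<_) (≡.sym (ℚ.p≤q⇒p⊓q≡p p)) 0<δ₀
    minimum (inj₂ p) = ≡.subst (0ℚ ℚ.<_) (≡.sym (ℚ.p≥q⇒p⊓q≡q p)) 0<1
  ε = ½ ℚ.* (½ ℚ.* (½ ℚ.* δ))
  0<ε : 0ℚ ℚ.< ε
  0<ε = 0<½* (0<½* (0<½* 0<δ))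
  8ε≡δ : nat 8 ℚ.* ε ≡ δ
  8ε≡δ = S.solve 1 (λ d → S.con (nat 8) S.:* (S.con ½ S.:* (S.con ½ S.:* (S.con ½ S.:* d))) S.:= d)
    ≡.refl δ
  Limit : (ℕ → ℕ → ℚ) → Set
  Limit s = ∃[ K ] ∀ k → K ℕ.≤ k → Eventually λ m → s k m ℚ.< ε
  conclude : Limit (λ k m → 𝔾.∥ expSum (at m z) k 𝔾.- at m (fromℕ n +i 0ᴿ) ∥) →
    Limit (λ k m → 𝔾.∥ expSum (at m (z +ᶜ d)) k 𝔾.- at m (Y +i 0ᴿ) ∥) →
    Limit (λ k m → 𝔾.∥ expSum (at m z) k 𝔾.* expSum (at m d) k 𝔾.- expSum (at m (z +ᶜ d)) k ∥) →
      fromℕ n <ᴿ Y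
  conclude (K₁ , f₁) (K₂ , f₂) (K₃ , f₃) = ½ ℚ.* δ , 0<½* 0<δ , eventually-zip₃ (λ {m} → step m)
      (eventually-zip _,_ gap (f₁ k K₁≤k)) (f₂ k K₂≤k) (f₃ k K₃≤k)
    where
    j k : ℕ
    j = K₁ ℕ.⊔ K₂ ℕ.⊔ K₃
    -- Two more terms than the thresholds ask for, so that `1+h≤exp` applies.
    k = suc (suc j)
    j≤k : j ℕ.≤ k
    j≤k = ℕ.≤-trans (ℕ.n≤1+n j) (ℕ.n≤1+n (suc j))
    K₁≤k : K₁ ℕ.≤ k
    K₁≤k = ℕ.≤-trans (ℕ.m≤m⊔n K₁ K₂) (ℕ.≤-trans (ℕ.m≤m⊔n (K₁ ℕ.⊔ K₂) K₃) j≤k)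
    K₂≤k : K₂ ℕ.≤ k
    K₂≤k = ℕ.≤-trans (ℕ.m≤n⊔m K₁ K₂) (ℕ.≤-trans (ℕ.m≤m⊔n (K₁ ℕ.⊔ K₂) K₃) j≤k)
    K₃≤k : K₃ ℕ.≤ k
    K₃≤k = ℕ.≤-trans (ℕ.m≤n⊔m (K₁ ℕ.⊔ K₂) K₃) j≤k
    step : ∀ m → (seq x m ℚ.+ δ₀ ℚ.< seq y m × 𝔾.∥ expSum (at m z) k 𝔾.- at m
      (fromℕ n +i 0ᴿ) ∥ ℚ.< ε) →
      𝔾.∥ expSum (at m (z +ᶜ d)) k 𝔾.- at m (Y +i 0ᴿ) ∥ ℚ.< ε →
      𝔾.∥ expSum (at m z) k 𝔾.* expSum (at m d) k 𝔾.- expSum (at m (z +ᶜ d)) k ∥ ℚ.< ε →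
        nat n ℚ.+ ½ ℚ.* δ ℚ.< seq Y m
    step m (g , a) b c = growth {nat n} {δ} {ε} {proj₁ e} {q} {proj₁ f} {seq Y m}
      (nat-mono-≤ {1} {n} 1≤n) 0<δ (ℚ.p⊓q≤q δ₀ 1ℚ) 0<ε 8ε≡δ
        (ℚ.≤-<-trans (∣first∣≤ (e 𝔾.- at m (fromℕ n +i 0ᴿ))) a)
        (ℚ.≤-trans (ℚ.+-monoʳ-≤ 1ℚ δ≤h) (proj₁ (proj₂ large)))
        (product-first e (expSum (h , 0ℚ) k) f (proj₂ (proj₂ large)) c)
        (ℚ.≤-<-trans (∣first∣≤ (f 𝔾.- at m (Y +i 0ᴿ))) b)
      where
      e f : 𝔾.Carrier
      e = expSum (at m z) k
      f = expSum (at m (z +ᶜ d)) k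
      h : ℚ
      h = seq y m ℚ.- seq x m
      δ≤h : δ ℚ.≤ h
      δ≤h = ℚ.≤-trans (ℚ.p⊓q≤p δ₀ 1ℚ)
        (0≤⇒≤ (ℚ.<⇒≤ (<⇒0<- g)) (S.solve 3
        (λ x y d → y S.:- x S.:= d S.:+ (y S.:- (x S.:+ d))) ≡.refl (seq x m) (seq y m) δ₀))
      large : ∃[ q ] 1ℚ ℚ.+ h ℚ.≤ q × expSum (h , 0ℚ) k 𝔾.≈ (q , 0ℚ)
      large = 1+h≤exp (ℚ.≤-trans (ℚ.<⇒≤ 0<δ) δ≤h) j
      q : ℚ
      q = proj₁ large

real-unique : ∀ {x X X′} → Exp (x +i 0ᴿ) (X +i 0ᴿ) → Exp (x +i 0ᴿ) (X′ +i 0ᴿ) → X ≈ᴿ X′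
real-unique {x} {X} {X′} h h′ = proj₁ (exp-unique (x +i 0ᴿ) (X +i 0ᴿ) (X′ +i 0ᴿ) h h′)

real-+ : ∀ {x X y Y} → Exp (x +i 0ᴿ) (X +i 0ᴿ) → Exp (y +i 0ᴿ) (Y +i 0ᴿ) →
  Exp ((x +ᴿ y) +i 0ᴿ) ((X *ᴿ Y) +i 0ᴿ)
real-+ {x} {X} {y} {Y} h h′ = exp-cong ((x +i 0ᴿ) +ᶜ (y +i 0ᴿ)) ((x +ᴿ y) +i 0ᴿ)
  ((X +i 0ᴿ) *ᶜ (Y +i 0ᴿ)) ((X *ᴿ Y) +i 0ᴿ)
  (pointwise {x +ᴿ y} {x +ᴿ y} (λ _ → ≡.refl) , pointwise {0ᴿ +ᴿ 0ᴿ} {0ᴿ} λ _ → ≡.refl)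
  ( pointwise {re ((X +i 0ᴿ) *ᶜ (Y +i 0ᴿ))} {X *ᴿ Y}
    (λ m → S.solve 2 (λ a b → a S.:* b S.:- S.con 0ℚ S.:* S.con 0ℚ S.:= a S.:* b) ≡.refl (seq X m)
    (seq Y m))
  , pointwise {im ((X +i 0ᴿ) *ᶜ (Y +i 0ᴿ))} {0ᴿ}
    (λ m → S.solve 2 (λ a b → a S.:* S.con 0ℚ S.:+ S.con 0ℚ S.:* b S.:= S.con 0ℚ) ≡.refl (seq X m)
    (seq Y m)))
  (exp-+ (x +i 0ᴿ) (X +i 0ᴿ) (y +i 0ᴿ) (Y +i 0ᴿ) h h′)

real-cong : ∀ {x x′ X} → x ≈ᴿ x′ → Exp (x +i 0ᴿ) (X +i 0ᴿ) → Exp (x′ +i 0ᴿ) (X +i 0ᴿ)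
real-cong {x} {x′} {X} p = exp-cong (x +i 0ᴿ) (x′ +i 0ᴿ) (X +i 0ᴿ) (X +i 0ᴿ) (p , ℝR.refl {0ᴿ})
  (ℂR.refl {X +i 0ᴿ})

-- The two `IsPower` hypotheses each bring a logarithm of `n`; `exp-strict` rules out that one lies
-- below the other.
log-unique : ∀ {n l l′} → 1 ℕ.≤ n → Exp (l +i 0ᴿ) (fromℕ n +i 0ᴿ) → Exp (l′ +i 0ᴿ) (fromℕ n +i 0ᴿ) →
  l ≈ᴿ l′
log-unique {n} {l} {l′} 1≤n h h′ = ℝ-stable {l} {l′} λ l≉l′ → trichotomy l l′ λ where
  (inj₁ l<l′)        → <ᴿ-irrefl {fromℕ n} (exp-strict {l} {l′} {fromℕ n} {n} 1≤n h h′ l<l′)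
  (inj₂ (inj₁ l≈l′)) → l≉l′ l≈l′
  (inj₂ (inj₂ l′<l)) → <ᴿ-irrefl {fromℕ n} (exp-strict {l′} {l} {fromℕ n} {n} 1≤n h′ h l′<l)

log-nonNegative : ∀ {n l} → 1 ℕ.≤ n → Exp (l +i 0ᴿ) (fromℕ n +i 0ᴿ) → 0ᴿ ≤ᴿ l
log-nonNegative {n} {l} 1≤n h l<0 = ℕ.<⇒≱
  (fromℕ-< {n} {1} (exp-strict {l} {0ᴿ} {1ᴿ} {n} 1≤n h exp-0 l<0)) 1≤n

power-1+ : ∀ {n α A B} → 1 ℕ.≤ n → IsPower n α A → IsPower n (1ᴿ +ᴿ α) B → B ≈ᴿ fromℕ n *ᴿ A
power-1+ {n} {α} {A} {B} 1≤n (l , el , eA) (l′ , el′ , eB) = real-unique {(1ᴿ +ᴿ α) *ᴿ l′} {B}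
  {fromℕ n *ᴿ A}
  (isExp⇒exp {((1ᴿ +ᴿ α) *ᴿ l′) +i 0ᴿ} {B +i 0ᴿ} eB)
  (real-cong {l +ᴿ α *ᴿ l} {(1ᴿ +ᴿ α) *ᴿ l′} {fromℕ n *ᴿ A} exponents
    (real-+ {l} {fromℕ n} {α *ᴿ l} {A} hl (isExp⇒exp {(α *ᴿ l) +i 0ᴿ} {A +i 0ᴿ} eA)))
  where
  open SetoidReasoning ℝR.setoid
  hl : Exp (l +i 0ᴿ) (fromℕ n +i 0ᴿ)
  hl = isExp⇒exp {l +i 0ᴿ} {fromℕ n +i 0ᴿ} el
  exponents : l +ᴿ α *ᴿ l ≈ᴿ (1ᴿ +ᴿ α) *ᴿ l′
  exponents = begin
    l +ᴿ α *ᴿ l ≈⟨ pointwise {l +ᴿ α *ᴿ l} {(1ᴿ +ᴿ α) *ᴿ l}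
      (λ m → S.solve 2 (λ l a → l S.:+ a S.:* l S.:= (S.con 1ℚ S.:+ a) S.:* l) ≡.refl (seq l m)
      (seq α m)) ⟩
    (1ᴿ +ᴿ α) *ᴿ l ≈⟨ ℝR.*-congˡ {1ᴿ +ᴿ α} {l} {l′}
      (log-unique {n} {l} {l′} 1≤n hl (isExp⇒exp {l′ +i 0ᴿ} {fromℕ n +i 0ᴿ} el′)) ⟩
    (1ᴿ +ᴿ α) *ᴿ l′        ∎

-- The square of `A` is `e^(2αl)` with `l` the logarithm of `n`. By `exp-strict` it can fall below
-- `n` only if `2αl < l`, but `2α - 1` and `l` are both nonnegative.
power-square : ∀ {n α A} → 1 ℕ.≤ n → fromℚ ½ ≤ᴿ α → IsPower n α A → fromℕ n ≤ᴿ A *ᴿ A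
power-square {n} {α} {A} 1≤n ½≤α (l , el , eA) A²<n = trichotomy l (αl +ᴿ αl) λ where
    (inj₁ l<2αl) → <ᴿ-asym {A *ᴿ A} {fromℕ n} A²<n
      (exp-strict {l} {αl +ᴿ αl} {A *ᴿ A} {n} 1≤n hl hA² l<2αl)
    (inj₂ (inj₁ l≈2αl)) → <ᴿ-irrefl {fromℕ n} (<ᴿ-cong {A *ᴿ A} {fromℕ n} {fromℕ n} {fromℕ n}
      (real-unique {αl +ᴿ αl} {A *ᴿ A} {fromℕ n} hA² (real-cong {l} {αl +ᴿ αl} {fromℕ n} l≈2αl hl))
        (ℝR.refl {fromℕ n}) A²<n)
    (inj₂ (inj₂ 2αl<l)) → ≮0-* {α +ᴿ α -ᴿ 1ᴿ} {l} 0≤2α-1 (log-nonNegative {n} {l} 1≤n hl)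
      (<ᴿ-cong {αl +ᴿ αl -ᴿ l} {(α +ᴿ α -ᴿ 1ᴿ) *ᴿ l} {0ᴿ} {0ᴿ}
        (pointwise {αl +ᴿ αl -ᴿ l} {(α +ᴿ α -ᴿ 1ᴿ) *ᴿ l}
          (λ m → S.solve 2 (λ a l → a S.:* l S.:+ a S.:* l S.:- l S.:= (a S.:+ a S.:- S.con 1ℚ)
          S.:* l) ≡.refl (seq α m) (seq l m)))
        (ℝR.refl {0ᴿ}) (<⇒diff<0 {l} {αl +ᴿ αl} 2αl<l))
  where
  αl : ℝ
  αl = α *ᴿ l
  hl : Exp (l +i 0ᴿ) (fromℕ n +i 0ᴿ)
  hl = isExp⇒exp {l +i 0ᴿ} {fromℕ n +i 0ᴿ} el
  hA : Exp (αl +i 0ᴿ) (A +i 0ᴿ)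
  hA = isExp⇒exp {(α *ᴿ l) +i 0ᴿ} {A +i 0ᴿ} eA
  hA² : Exp ((αl +ᴿ αl) +i 0ᴿ) ((A *ᴿ A) +i 0ᴿ)
  hA² = real-+ {αl} {A} {αl} {A} hA hA
  0≤2α-1 : 0ᴿ ≤ᴿ α +ᴿ α -ᴿ 1ᴿ
  0≤2α-1 (δ , 0<δ , h) = ½≤α (½ ℚ.* δ , 0<½* 0<δ , eventually-map (λ {m} p → 0<⇒< (0<½* (<⇒0<- p))
    (S.solve 2 (λ a d → S.con ½ S.:= (a S.:+ S.con ½ S.:* d) S.:+ S.con ½
      S.:* (S.con 0ℚ S.:- ((a S.:+ a S.:- S.con 1ℚ) S.:+ d))) ≡.refl (seq α m) δ)) h)

module _ {n A E} (1≤n : 1 ℕ.≤ n) (0≤A : 0ᴿ ≤ᴿ A) (4nA<E : fromℕ 4 *ᴿ (fromℕ n *ᴿ A) <ᴿ fromℕ E) where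
  private
    δ M r : ℚ
    δ = proj₁ 4nA<E
    0<δ : 0ℚ ℚ.< δ
    0<δ = proj₁ (proj₂ 4nA<E)
    M = nat 4 ℚ.* nat n
    0<M : 0ℚ ℚ.< M
    0<M = 0<* (nat-mono-< {0} {4} ℕ.z<s) (nat-mono-< {0} {n} 1≤n)
    r = proj₁ (inverse 0<M)
    0<r : 0ℚ ℚ.< r
    0<r = proj₁ (proj₂ (inverse 0<M))
    Mr≡1 : M ℚ.* r ≡ 1ℚ
    Mr≡1 = proj₂ (proj₂ (inverse 0<M))
    gap : Eventually λ m → M ℚ.* seq A m ℚ.+ δ ℚ.< nat E
    gap = eventually-map (λ {m} →
      ≡.subst (λ p → p ℚ.+ δ ℚ.< nat E) (≡.sym (ℚ.*-assoc (nat 4) (nat n) (seq A m))))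
      (proj₂ (proj₂ 4nA<E))

  -- If `E ≤ 4nk`, dividing `4nA + δ < E` by `4n` puts `A` below `k` with gap `r * δ`.
  lineBound : ∀ {k} → fromℕ k ≤ᴿ A → 4 ℕ.* n ℕ.* k ℕ.< E
  lineBound {k} k≤A = ℕ.≰⇒> λ E≤4nk → k≤A (r ℚ.* δ , 0<* 0<r 0<δ , eventually-map (λ {m} h →
    ℚ.*-cancelˡ-<-nonNeg M {{ℚ.nonNegative (ℚ.<⇒≤ 0<M)}} (begin-strict
      M ℚ.* (seq A m ℚ.+ r ℚ.* δ) ≡⟨ S.solve 4
        (λ M a r d → M S.:* (a S.:+ r S.:* d) S.:= M S.:* a S.:+ M S.:* r S.:* d) ≡.refl M
        (seq A m) r δ ⟩
      M ℚ.* seq A m ℚ.+ M ℚ.* r ℚ.* δ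
        ≡⟨ ≡.cong (λ p → M ℚ.* seq A m ℚ.+ p) (≡.trans (≡.cong (ℚ._* δ) Mr≡1) (ℚ.*-identityˡ δ)) ⟩
      M ℚ.* seq A m ℚ.+ δ                  <⟨ h ⟩
      nat E                                ≤⟨ nat-mono-≤ E≤4nk ⟩
      nat (4 ℕ.* n ℕ.* k) ≡⟨ ≡.trans (nat-* (4 ℕ.* n) k) (≡.cong (ℚ._* nat k) (nat-* 4 n)) ⟩
      M ℚ.* nat k                          ∎)) gap)
    where open ℚ.≤-Reasoning

  -- In effect `E² > 16n²A² ≥ 16n³`. It is run backwards, since `n ≤ A²` is a negation: `E² ≤ 16n³`
  -- would force `A² < n`.
  manyEdges : fromℕ n ≤ᴿ A *ᴿ A → 16 ℕ.* (n ℕ.* n ℕ.* n) ℕ.< E ℕ.* E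
  manyEdges n≤A² = ℕ.≰⇒> λ E²≤16n³ → trichotomy₀ A (bySign E²≤16n³)
    where
    positive : E ℕ.* E ℕ.≤ 16 ℕ.* (n ℕ.* n ℕ.* n) → 0ᴿ <ᴿ A → A *ᴿ A <ᴿ fromℕ n
    -- With `s` equal to `δ / M`, the square of `M a + δ` is at least `M² (a² + s²)`, so `s * s` is
    -- a gap between `A * A` and `n`.
    positive E²≤16n³ (η , 0<η , pos) = s ℚ.* s , 0<* 0<s 0<s , eventually-zip (λ {m} a b →
      ℚ.*-cancelˡ-<-nonNeg (M ℚ.* M) {{ℚ.nonNegative (0≤* (ℚ.<⇒≤ 0<M) (ℚ.<⇒≤ 0<M))}}
        (step (ℚ.<-trans 0<η (≡.subst (ℚ._< seq A m) (ℚ.+-identityˡ η) a)) b)) pos gap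
      where
      s : ℚ
      s = r ℚ.* δ
      0<s : 0ℚ ℚ.< s
      0<s = 0<* 0<r 0<δ
      Ms≡δ : M ℚ.* s ≡ δ
      Ms≡δ = ≡.trans (≡.sym (ℚ.*-assoc M r δ)) (≡.trans (≡.cong (ℚ._* δ) Mr≡1) (ℚ.*-identityˡ δ))
      step : ∀ {a} → 0ℚ ℚ.< a → M ℚ.* a ℚ.+ δ ℚ.< nat E →
        M ℚ.* M ℚ.* (a ℚ.* a ℚ.+ s ℚ.* s) ℚ.< M ℚ.* M ℚ.* nat n
      step {a} 0<a lt = begin-strict
        M ℚ.* M ℚ.* (a ℚ.* a ℚ.+ s ℚ.* s)
          ≤⟨ 0≤⇒≤ (ℚ.<⇒≤ (0<+ 0<aδ 0<aδ))
            (≡.trans (≡.cong (λ d → (M ℚ.* a ℚ.+ d) ℚ.* (M ℚ.* a ℚ.+ d)) (≡.sym Ms≡δ))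
               (≡.trans (S.solve 3 (λ M a s →
                 (M S.:* a S.:+ M S.:* s) S.:* (M S.:* a S.:+ M S.:* s) S.:= M S.:* M
                 S.:* (a S.:* a S.:+ s S.:* s)
                 S.:+ (M S.:* a S.:* (M S.:* s) S.:+ M S.:* a S.:* (M S.:* s))) ≡.refl M a s)
                 (≡.cong (λ d → M ℚ.* M ℚ.* (a ℚ.* a ℚ.+ s ℚ.* s) ℚ.+
                   (M ℚ.* a ℚ.* d ℚ.+ M ℚ.* a ℚ.* d)) Ms≡δ))) ⟩
        (M ℚ.* a ℚ.+ δ) ℚ.* (M ℚ.* a ℚ.+ δ)
          <⟨ ℚ.*-monoʳ-<-pos (M ℚ.* a ℚ.+ δ) {{ℚ.positive (0<+ (0<* 0<M 0<a) 0<δ)}} lt ⟩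
        (M ℚ.* a ℚ.+ δ) ℚ.* nat E
          ≤⟨ ℚ.*-monoʳ-≤-nonNeg (nat E) {{ℚ.nonNegative (0≤nat E)}} (ℚ.<⇒≤ lt) ⟩
        nat E ℚ.* nat E
          ≡⟨ nat-* E E ⟨
        nat (E ℕ.* E)
          ≤⟨ nat-mono-≤ E²≤16n³ ⟩
        nat (16 ℕ.* (n ℕ.* n ℕ.* n))
          ≡⟨ ≡.trans (nat-* 16 (n ℕ.* n ℕ.* n))
            (≡.cong (nat 16 ℚ.*_) (≡.trans (nat-* (n ℕ.* n) n) (≡.cong (ℚ._* nat n) (nat-* n n)))) ⟩
        nat 16 ℚ.* (nat n ℚ.* nat n ℚ.* nat n)
          ≡⟨ S.solve 1 (λ n → S.con (nat 16) S.:* (n S.:* n S.:* n) S.:= (S.con (nat 4) S.:* n)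
            S.:* (S.con (nat 4) S.:* n) S.:* n) ≡.refl (nat n) ⟩
        M ℚ.* M ℚ.* nat n ∎
        where
        open ℚ.≤-Reasoning
        0<aδ : 0ℚ ℚ.< M ℚ.* a ℚ.* δ
        0<aδ = 0<* (0<* 0<M 0<a) 0<δ

    bySign : E ℕ.* E ℕ.≤ 16 ℕ.* (n ℕ.* n ℕ.* n) → ¬ (0ᴿ <ᴿ A ⊎ A ≈ᴿ 0ᴿ ⊎ A <ᴿ 0ᴿ)
    bySign E²≤16n³ (inj₁ 0<A)        = n≤A² (positive E²≤16n³ 0<A)
    bySign E²≤16n³ (inj₂ (inj₁ A≈0)) = n≤A² (<ᴿ-cong {0ᴿ} {A *ᴿ A} {fromℕ n} {fromℕ n}
      (ℝR.sym {A *ᴿ A} {0ᴿ} (ℝR.trans {A *ᴿ A} {0ᴿ *ᴿ A} {0ᴿ} (ℝR.*-congʳ {A} {A} {0ᴿ} A≈0)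
        (ℝR.zeroˡ A))) (ℝR.refl {fromℕ n})
      (½ , 0<½ , always λ _ → ℚ.<-≤-trans {0ℚ ℚ.+ ½} {1ℚ} {nat n}
        (0<⇒< {0ℚ ℚ.+ ½} {1ℚ} {½} 0<½ ≡.refl) (nat-mono-≤ {1} {n} 1≤n)))
    bySign E²≤16n³ (inj₂ (inj₂ A<0)) = 0≤A A<0

-- Counting walks of length two

module Counting where
  open import Data.Fin.Base using (zero; suc)
  open import Data.Nat.Base using (_+_; _*_; _∸_; _≤_; _<_; z≤n)
  open import Data.Nat.Properties
  open ≡ using (refl; sym; trans; cong; cong₂; subst)
  open import Algebra.Properties.Semiring.Sum +-*-semiring
    using (sum; sum-cong-≋; ∑-comm; ∑-distrib-+; *-distribˡ-sum; *-distribʳ-sum)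

  sum-mono : ∀ {n} {f g : Fin n → ℕ} → (∀ i → f i ≤ g i) → sum f ≤ sum g
  sum-mono {zero}  h = z≤n
  sum-mono {suc n} h = +-mono-≤ (h zero) (sum-mono (h ∘ suc))

  sum-const : ∀ n c → sum {n} (λ _ → c) ≡ n * c
  sum-const zero    c = refl
  sum-const (suc n) c = cong (_+_ c) (sum-const n c)

  2ab≤a²+b² : ∀ a b → 2 * (a * b) ≤ a * a + b * b
  2ab≤a²+b² a b with ≤-total a b
  ... | inj₁ a≤b = subst (λ c → 2 * (a * c) ≤ a * a + c * c) (m+[n∸m]≡n a≤b) (lemma a (b ∸ a))
    where
    lemma : ∀ a c → 2 * (a * (a + c)) ≤ a * a + (a + c) * (a + c)
    lemma a c = subst (2 * (a * (a + c)) ≤_)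
      (solve 2 (λ a c → con 2 :* (a :* (a :+ c)) :+ c :* c := a :* a :+ (a :+ c) :* (a :+ c)) refl a
      c) (m≤m+n _ (c * c))
      where open ℕ.+-*-Solver
  ... | inj₂ b≤a = subst (λ c → 2 * (c * b) ≤ c * c + b * b) (m+[n∸m]≡n b≤a) (lemma b (a ∸ b))
    where
    lemma : ∀ b c → 2 * ((b + c) * b) ≤ (b + c) * (b + c) + b * b
    lemma b c = subst (2 * ((b + c) * b) ≤_)
      (solve 2 (λ b c → con 2 :* ((b :+ c) :* b) :+ c :* c := (b :+ c) :* (b :+ c) :+ b :* b) refl b
      c) (m≤m+n _ (c * c))
      where open ℕ.+-*-Solver

  -- Summing `2ab ≤ a² + b²` over all pairs of entries gives twice the claim and stays within ℕ.
  cauchySchwarz : ∀ {n} (d : Fin n → ℕ) → sum d * sum d ≤ n * sum (λ i → d i * d i)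
  cauchySchwarz {n} d = *-cancelˡ-≤ 2 (begin
    2 * (sum d * sum d)                              ≡⟨ cong (2 *_) (*-distribʳ-sum (sum d) d) ⟩
    2 * sum (λ i → d i * sum d) ≡⟨ cong (2 *_) (sum-cong-≋ λ i → *-distribˡ-sum (d i) d) ⟩
    2 * sum (λ i → sum (λ j → d i * d j)) ≡⟨ *-distribˡ-sum 2 (λ i → sum (λ j → d i * d j)) ⟩
    sum (λ i → 2 * sum (λ j → d i * d j)) ≡⟨ sum-cong-≋ (λ i → *-distribˡ-sum 2 (λ j → d i * d j)) ⟩
    sum (λ i → sum (λ j → 2 * (d i * d j)))
      ≤⟨ sum-mono (λ i → sum-mono (λ j → 2ab≤a²+b² (d i) (d j))) ⟩
    sum (λ i → sum (λ j → d i * d i + d j * d j))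
      ≡⟨ sum-cong-≋ (λ i → ∑-distrib-+ (λ _ → d i * d i) (λ j → d j * d j)) ⟩
    sum (λ i → sum {n} (λ _ → d i * d i) + Q)
      ≡⟨ ∑-distrib-+ (λ i → sum {n} (λ _ → d i * d i)) (λ _ → Q) ⟩
    sum (λ i → sum {n} (λ _ → d i * d i)) + sum {n} (λ _ → Q)
      ≡⟨ cong₂ _+_ (trans (sum-cong-≋ (λ i → sum-const n (d i * d i)))
        (sym (*-distribˡ-sum n (λ i → d i * d i)))) (sum-const n Q) ⟩
    n * Q + n * Q                                    ≡⟨ cong (_+_ (n * Q)) (+-identityʳ (n * Q)) ⟨
    2 * (n * Q)                                      ∎)
    where
    open ≤-Reasoning
    Q : ℕ
    Q = sum (λ i → d i * d i)

  ⟦_⟧ : ∀ {P : Set} → Dec P → ℕ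
  ⟦ yes _ ⟧ = 1
  ⟦ no _ ⟧  = 0

  ⟦_⟧ᶜ : ∀ {P : Set} → Dec P → ℕ
  ⟦ yes _ ⟧ᶜ = 0
  ⟦ no _ ⟧ᶜ  = 1

  ⟦⟧+⟦⟧ᶜ : ∀ {P : Set} (d : Dec P) x → x ≡ x * ⟦ d ⟧ + x * ⟦ d ⟧ᶜ
  ⟦⟧+⟦⟧ᶜ (yes _) x = sym (trans (cong₂ _+_ (*-identityʳ x) (*-zeroʳ x)) (+-identityʳ x))
  ⟦⟧+⟦⟧ᶜ (no _)  x = sym (cong₂ _+_ (*-zeroʳ x) (*-identityʳ x))

  -- a is the adjacency matrix.  Walks v - p - w are counted from below by
  -- Cauchy-Schwarz and from above by splitting on whether w lies on the line v p.
  fewWalks : ∀ {n} (E : ℕ) (a : Fin n → Fin n → ℕ) {OnLine : Fin n → Fin n → Fin n → Set}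
    (C? : ∀ v p w → Dec (OnLine v p w)) →
    (∀ i j → a i j ≡ a j i) →
    (∀ v p → a v p * (4 * n * sum (λ w → a p w * ⟦ C? v p w ⟧)) ≤ a v p * E) →
    (∀ v w → sum (λ p → a v p * a p w * ⟦ C? v p w ⟧ᶜ) ≤ 38) →
    2 * E ≤ sum (λ i → sum (a i)) → ¬ 16 * (n * n * n) < E * E
  fewWalks {n} E a C? a-sym onLine offLine 2E≤D 16n³<E² = <⇒≱ 16n³<E² E²≤16n³
    where
    open ≤-Reasoning
    d : Fin n → ℕ
    d p = sum (a p)
    D Q : ℕ
    D = sum d
    Q = sum (λ p → d p * d p)
    on off : Fin n → Fin n → Fin n → ℕ
    on  v p w = a v p * a p w * ⟦ C? v p w ⟧
    off v p w = a v p * a p w * ⟦ C? v p w ⟧ᶜ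

    walks : Q ≡ sum (λ v → sum (λ p → sum (on v p))) + sum (λ v → sum (λ w → sum (λ p → off v p w)))
    walks = begin-equality
      sum (λ p → d p * d p)
        ≡⟨ sum-cong-≋ (λ p → trans (*-distribʳ-sum (d p) (a p))
          (sum-cong-≋ (λ v → *-distribˡ-sum (a p v) (a p)))) ⟩
      sum (λ p → sum (λ v → sum (λ w → a p v * a p w)))
        ≡⟨ ∑-comm (λ p v → sum (λ w → a p v * a p w)) ⟩
      sum (λ v → sum (λ p → sum (λ w → a p v * a p w)))
        ≡⟨ sum-cong-≋ (λ v → sum-cong-≋
          (λ p → sum-cong-≋ (λ w → trans (cong (_* a p w) (a-sym p v))
          (⟦⟧+⟦⟧ᶜ (C? v p w) (a v p * a p w))))) ⟩
      sum (λ v → sum (λ p → sum (λ w → on v p w + off v p w)))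
        ≡⟨ sum-cong-≋ (λ v → trans (sum-cong-≋ (λ p → ∑-distrib-+ (on v p) (off v p)))
          (∑-distrib-+ (λ p → sum (on v p)) (λ p → sum (off v p)))) ⟩
      sum (λ v → sum (λ p → sum (on v p)) + sum (λ p → sum (off v p)))
        ≡⟨ ∑-distrib-+ (λ v → sum (λ p → sum (on v p))) (λ v → sum (λ p → sum (off v p))) ⟩
      sum (λ v → sum (λ p → sum (on v p))) + sum (λ v → sum (λ p → sum (off v p)))
        ≡⟨ cong (_+_ (sum (λ v → sum (λ p → sum (on v p))))) (sum-cong-≋ (λ v → ∑-comm (off v))) ⟩
      sum (λ v → sum (λ p → sum (on v p))) + sum (λ v → sum (λ w → sum (λ p → off v p w))) ∎

    on≤ : 4 * n * sum (λ v → sum (λ p → sum (on v p))) ≤ D * E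
    on≤ = begin
      4 * n * sum (λ v → sum (λ p → sum (on v p)))
        ≡⟨ *-distribˡ-sum (4 * n) (λ v → sum (λ p → sum (on v p))) ⟩
      sum (λ v → 4 * n * sum (λ p → sum (on v p)))
        ≡⟨ sum-cong-≋ (λ v → *-distribˡ-sum (4 * n) (λ p → sum (on v p))) ⟩
      sum (λ v → sum (λ p → 4 * n * sum (on v p)))
        ≤⟨ sum-mono (λ v → sum-mono (λ p → ≤-trans (≤-reflexive (factor v p)) (onLine v p))) ⟩
      sum (λ v → sum (λ p → a v p * E))
        ≡⟨ trans (*-distribʳ-sum E d) (sum-cong-≋ (λ v → *-distribʳ-sum E (a v))) ⟨
      D * E ∎
      where
      factor : ∀ v p → 4 * n * sum (on v p) ≡ a v p * (4 * n * sum (λ w → a p w * ⟦ C? v p w ⟧))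
      factor v p = begin-equality
        4 * n * sum (on v p)
          ≡⟨ cong (4 * n *_) (trans (sum-cong-≋ (λ w → *-assoc (a v p) (a p w) ⟦ C? v p w ⟧))
            (sym (*-distribˡ-sum (a v p) (λ w → a p w * ⟦ C? v p w ⟧)))) ⟩
        4 * n * (a v p * s)    ≡⟨ *-assoc (4 * n) (a v p) s ⟨
        4 * n * a v p * s      ≡⟨ cong (_* s) (*-comm (4 * n) (a v p)) ⟩
        a v p * (4 * n) * s    ≡⟨ *-assoc (a v p) (4 * n) s ⟩
        a v p * (4 * n * s)    ∎
        where
        s : ℕ
        s = sum (λ w → a p w * ⟦ C? v p w ⟧)

    off≤ : sum (λ v → sum (λ w → sum (λ p → off v p w))) ≤ n * (n * 38)
    off≤ = begin
      sum (λ v → sum (λ w → sum (λ p → off v p w)))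
        ≤⟨ sum-mono (λ v → sum-mono (λ w → offLine v w)) ⟩
      sum {n} (λ _ → sum {n} (λ _ → 38))
        ≡⟨ trans (sum-cong-≋ {n} (λ _ → sum-const n 38)) (sum-const n (n * 38)) ⟩
      n * (n * 38)                                    ∎

    4D²≤ : 4 * (D * D) ≤ D * E + 152 * (n * n * n)
    4D²≤ = begin
      4 * (D * D)                            ≤⟨ *-monoʳ-≤ 4 (cauchySchwarz d) ⟩
      4 * (n * Q)                            ≡⟨ *-assoc 4 n Q ⟨
      4 * n * Q                              ≡⟨ cong (4 * n *_) walks ⟩
      4 * n * (On + Off)                     ≡⟨ *-distribˡ-+ (4 * n) On Off ⟩
      4 * n * On + 4 * n * Off               ≤⟨ +-mono-≤ on≤ (*-monoʳ-≤ (4 * n) off≤) ⟩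
      D * E + 4 * n * (n * (n * 38))
        ≡⟨ cong (_+_ (D * E)) (solve 1
        (λ n → con 4 :* n :* (n :* (n :* con 38)) := con 152 :* (n :* n :* n)) refl n) ⟩
      D * E + 152 * (n * n * n)              ∎
      where
      open ℕ.+-*-Solver
      On Off : ℕ
      On  = sum (λ v → sum (λ p → sum (on v p)))
      Off = sum (λ v → sum (λ w → sum (λ p → off v p w)))

    -- `4D² - DE` increases with `D`, and at the least admissible value `D = 2E` it equals `14E²`.
    -- The excess `x` of `D` over `2E` replaces the subtraction.
    14E²≤ : 14 * (E * E) ≤ 152 * (n * n * n)
    14E²≤ = excess (D ∸ 2 * E) (sym (m+[n∸m]≡n 2E≤D))
      where
      excess : ∀ x → D ≡ 2 * E + x → 14 * (E * E) ≤ 152 * (n * n * n)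
      excess x D≡ = +-cancelˡ-≤ ((2 * E + x) * E) _ _ (begin
        (2 * E + x) * E + 14 * (E * E) ≤⟨ m≤m+n _ (15 * (E * x) + 4 * (x * x)) ⟩
        (2 * E + x) * E + 14 * (E * E) + (15 * (E * x) + 4 * (x * x))
          ≡⟨ solve 2 (λ E x → (con 2 :* E :+ x) :* E :+ con 14 :* (E :* E)
          :+ (con 15 :* (E :* x) :+ con 4 :* (x :* x)) := con 4
          :* ((con 2 :* E :+ x) :* (con 2 :* E :+ x))) refl E x ⟩
        4 * ((2 * E + x) * (2 * E + x)) ≡⟨ cong (λ D → 4 * (D * D)) D≡ ⟨
        4 * (D * D)                                                   ≤⟨ 4D²≤ ⟩
        D * E + 152 * (n * n * n) ≡⟨ cong (λ D → D * E + 152 * (n * n * n)) D≡ ⟩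
        (2 * E + x) * E + 152 * (n * n * n)                           ∎)
        where open ℕ.+-*-Solver

    -- Here the constants meet: 152 is `4 * 38`, and it stays below 224, which is `14 * 16`.
    E²≤16n³ : E * E ≤ 16 * (n * n * n)
    E²≤16n³ = *-cancelˡ-≤ 14 (begin
      14 * (E * E)               ≤⟨ 14E²≤ ⟩
      152 * (n * n * n)          ≤⟨ *-monoˡ-≤ (n * n * n) (m≤m+n 152 72) ⟩
      224 * (n * n * n)          ≡⟨ *-assoc 14 16 (n * n * n) ⟩
      14 * (16 * (n * n * n))    ∎)

  length-filter : ∀ {n} {A : Set} {P : A → Set} (P? : ∀ x → Dec (P x)) (f : Fin n → A) →
    sum (λ i → ⟦ P? (f i) ⟧) ≡ length (filter P? (tabulate f))
  length-filter {zero}  P? f = refl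
  length-filter {suc n} P? f with P? (f zero)
  ... | yes _ = cong suc (length-filter P? (f ∘ suc))
  ... | no _  = length-filter P? (f ∘ suc)

  count≤ : ∀ {n} {P : Fin n → Set} (P? : ∀ i → Dec (P i)) {c} →
    (∀ is → Unique is → All P is → length is ≤ c) →
    sum (λ i → ⟦ P? i ⟧) ≤ c
  count≤ {n} P? h = ≤-trans (≤-reflexive (length-filter P? (λ i → i)))
    (h (filter P? (allFin n)) (Uniqueₚ.filter⁺ P? (Uniqueₚ.allFin⁺ n))
      (Allₚ.all-filter P? (allFin n)))

open Counting

open import Algebra.Properties.Semiring.Sum ℕ.+-*-semiring
  using (∑-comm; ∑-distrib-+; sum-cong-≋) renaming (sum to ∑)
open import Data.List.Membership.Propositional using (_∈_)
open import Data.Nat.Base using (_≤_)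

-- Points of the plane

module CrossProduct (R : CommutativeRing 0ℓ 0ℓ) where
  open CommutativeRing R
  open IntegerSolver R
  open SetoidReasoning setoid

  -- Cramer's rule: eliminating `β - β′` from the two equations leaves `α - α′` times the
  -- determinant of the directions. The further factor `α * β` turns that determinant into the cross
  -- product of the legs.
  cross-vanishes : ∀ {α α′ β β′ p q s t} → α * p + β * s ≈ α′ * p + β′ * s →
    α * q + β * t ≈ α′ * q + β′ * t →
    (α * p * (β * t) - α * q * (β * s)) * (α - α′) ≈ 0#
  cross-vanishes {α} {α′} {β} {β′} {p} {q} {s} {t} h₁ h₂ = begin
    (α * p * (β * t) - α * q * (β * s)) * (α - α′)
      ≈⟨ solve 8 (λ α α′ β β′ p q s t → (α :* p :* (β :* t) :- α :* q :* (β :* s)) :* (α :- α′)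
           := α :* β :* (((α :* p :+ β :* s) :- (α′ :* p :+ β′ :* s)) :* t
             :- ((α :* q :+ β :* t) :- (α′ :* q :+ β′ :* t)) :* s)) refl α α′ β β′ p q s t ⟩
    α * β * ((α * p + β * s - (α′ * p + β′ * s)) * t - (α * q + β * t - (α′ * q + β′ * t)) * s)
      ≈⟨ *-congˡ (+-cong (*-congʳ (trans (+-congʳ h₁) (-‿inverseʳ _)))
        (-‿cong (*-congʳ (trans (+-congʳ h₂) (-‿inverseʳ _))))) ⟩
    α * β * (0# * t - 0# * s)
      ≈⟨ *-congˡ (+-cong (zeroˡ t) (-‿cong (zeroˡ s))) ⟩
    α * β * (0# - 0#)
      ≈⟨ trans (*-congˡ (-‿inverseʳ 0#)) (zeroʳ _) ⟩
    0# ∎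

cross : ℂ → ℂ → ℝ
cross z w = re z *ᴿ im w -ᴿ im z *ᴿ re w

-- By `ratio` a positive integer multiple of the coefficient is an integer, so the same multiple of
-- its imaginary part vanishes.
realCoefficient : ∀ {z} (Z : Leg z) → im (coefficient Z) ≈ᴿ 0ᴿ
realCoefficient Z = ℝ-noZeroDivisors {fromℚ (nat d)} {im c}
  (λ h → ℚ.<-irrefl (≡.sym (fromℚ≈0 h)) (nat-mono-< {0} {d} ℕ.z<s))
  (ℝR.trans {fromℚ (nat d) *ᴿ im c} {im (fromℚᶜ (nat d) *ᶜ c)} {0ᴿ}
    (pointwise {fromℚ (nat d) *ᴿ im c} {im (fromℚᶜ (nat d) *ᶜ c)} λ n →
      S.solve 3 (λ d a b → d S.:* b S.:= d S.:* b S.:+ S.con 0ℚ S.:* a) ≡.refl (nat d)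
      (seq (re c) n) (seq (im c) n))
    (proj₂ (begin
      fromℚᶜ (nat d) *ᶜ c     ≈⟨ n•z≈ d c ⟨
      (d ℂ×.× c)           ≈⟨ ratio Z ⟩
      (m ℂ×.× 1ᶜ)          ≈⟨ n×1 m ⟩
      fromℚᶜ (nat m)          ∎)))
  where
  open SetoidReasoning ℂR.setoid
  c : ℂ
  c = coefficient Z
  d m : ℕ
  d = Leg.denominator Z
  m = Leg.numerator Z

record Scaled (z : ℂ) (α : ℝ) (ω : ℂ) : Set where
  constructor scaled
  field
    re≈ : re z ≈ᴿ α *ᴿ re ω
    im≈ : im z ≈ᴿ α *ᴿ im ω

leg-scaled : ∀ {z} (Z : Leg z) → Scaled z (re (coefficient Z)) (direction Z)
leg-scaled {z} Z = scaled
  (begin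
    re z                                   ≈⟨ proj₁ (factored Z) ⟩
    re c *ᴿ re ω -ᴿ im c *ᴿ im ω ≈⟨ ℝR.+-congˡ {re c *ᴿ re ω} {ℝR.- (im c *ᴿ im ω)}
      {ℝR.- (0ᴿ *ᴿ im ω)} (ℝR.-‿cong {im c *ᴿ im ω} {0ᴿ *ᴿ im ω}
      (ℝR.*-congʳ {im ω} {im c} {0ᴿ} (realCoefficient Z))) ⟩
    re c *ᴿ re ω -ᴿ 0ᴿ *ᴿ im ω ≈⟨ pointwise {re c *ᴿ re ω -ᴿ 0ᴿ *ᴿ im ω} {re c *ᴿ re ω}
      (λ n → S.solve 3 (λ a p q → a S.:* p S.:- S.con 0ℚ S.:* q S.:= a S.:* p) ≡.refl (seq (re c) n)
      (seq (re ω) n) (seq (im ω) n)) ⟩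
    re c *ᴿ re ω                           ∎)
  (begin
    im z                                   ≈⟨ proj₂ (factored Z) ⟩
    re c *ᴿ im ω +ᴿ im c *ᴿ re ω ≈⟨ ℝR.+-congˡ {re c *ᴿ im ω} {im c *ᴿ re ω} {0ᴿ *ᴿ re ω}
      (ℝR.*-congʳ {re ω} {im c} {0ᴿ} (realCoefficient Z)) ⟩
    re c *ᴿ im ω +ᴿ 0ᴿ *ᴿ re ω ≈⟨ pointwise {re c *ᴿ im ω +ᴿ 0ᴿ *ᴿ re ω} {re c *ᴿ im ω}
      (λ n → S.solve 3 (λ a p q → a S.:* q S.:+ S.con 0ℚ S.:* p S.:= a S.:* q) ≡.refl (seq (re c) n)
      (seq (re ω) n) (seq (im ω) n)) ⟩
    re c *ᴿ im ω                           ∎)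
  where
  open SetoidReasoning ℝR.setoid
  c ω : ℂ
  c = coefficient Z
  ω = direction Z

scaled-resp : ∀ {z α ω ω′} → ω ≈ᶜ ω′ → Scaled z α ω → Scaled z α ω′
scaled-resp {z} {α} {ω} {ω′} (p , q) (scaled r i) = scaled
  (ℝR.trans {re z} {α *ᴿ re ω} {α *ᴿ re ω′} r (ℝR.*-congˡ {α} {re ω} {re ω′} p))
  (ℝR.trans {im z} {α *ᴿ im ω} {α *ᴿ im ω′} i (ℝR.*-congˡ {α} {im ω} {im ω′} q))

-- Non-parallel directions are linearly independent over ℝ, so the coordinates of the common sum
-- with respect to them are unique.
scaled-rigid : ∀ {x y x′ y′ α β α′ β′ ω η} → Scaled x α ω → Scaled y β η → Scaled x′ α′ ω →
  Scaled y′ β′ η →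
  x +ᶜ y ≈ᶜ x′ +ᶜ y′ → ¬ cross x y ≈ᴿ 0ᴿ → x ≈ᶜ x′
scaled-rigid {x} {y} {x′} {y′} {α} {β} {α′} {β′} {ω} {η} (scaled xr xi) (scaled yr yi)
  (scaled xr′ xi′) (scaled yr′ yi′) (hr , hi) cross≉0 =
    ℝR.trans {re x} {α *ᴿ re ω} {re x′} xr
      (ℝR.trans {α *ᴿ re ω} {α′ *ᴿ re ω} {re x′} (ℝR.*-congʳ {re ω} {α} {α′} α≈α′)
      (ℝR.sym {re x′} {α′ *ᴿ re ω} xr′))
  , ℝR.trans {im x} {α *ᴿ im ω} {im x′} xi
    (ℝR.trans {α *ᴿ im ω} {α′ *ᴿ im ω} {im x′} (ℝR.*-congʳ {im ω} {α} {α′} α≈α′)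
    (ℝR.sym {im x′} {α′ *ᴿ im ω} xi′))
  where
  factoredCross : ℝ
  factoredCross = α *ᴿ re ω *ᴿ (β *ᴿ im η) -ᴿ α *ᴿ im ω *ᴿ (β *ᴿ re η)
  cross≈ : cross x y ≈ᴿ factoredCross
  cross≈ = ℝR.+-cong {re x *ᴿ im y} {α *ᴿ re ω *ᴿ (β *ᴿ im η)} {ℝR.- (im x *ᴿ re y)}
    {ℝR.- (α *ᴿ im ω *ᴿ (β *ᴿ re η))}
    (ℝR.*-cong {re x} {α *ᴿ re ω} {im y} {β *ᴿ im η} xr yi)
    (ℝR.-‿cong {im x *ᴿ re y} {α *ᴿ im ω *ᴿ (β *ᴿ re η)}
      (ℝR.*-cong {im x} {α *ᴿ im ω} {re y} {β *ᴿ re η} xi yr))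
  h₁ : α *ᴿ re ω +ᴿ β *ᴿ re η ≈ᴿ α′ *ᴿ re ω +ᴿ β′ *ᴿ re η
  h₁ = ℝR.trans {α *ᴿ re ω +ᴿ β *ᴿ re η} {re x +ᴿ re y} {α′ *ᴿ re ω +ᴿ β′ *ᴿ re η}
    (ℝR.sym {re x +ᴿ re y} {α *ᴿ re ω +ᴿ β *ᴿ re η}
      (ℝR.+-cong {re x} {α *ᴿ re ω} {re y} {β *ᴿ re η} xr yr))
    (ℝR.trans {re x +ᴿ re y} {re x′ +ᴿ re y′} {α′ *ᴿ re ω +ᴿ β′ *ᴿ re η} hr
      (ℝR.+-cong {re x′} {α′ *ᴿ re ω} {re y′} {β′ *ᴿ re η} xr′ yr′))
  h₂ : α *ᴿ im ω +ᴿ β *ᴿ im η ≈ᴿ α′ *ᴿ im ω +ᴿ β′ *ᴿ im η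
  h₂ = ℝR.trans {α *ᴿ im ω +ᴿ β *ᴿ im η} {im x +ᴿ im y} {α′ *ᴿ im ω +ᴿ β′ *ᴿ im η}
    (ℝR.sym {im x +ᴿ im y} {α *ᴿ im ω +ᴿ β *ᴿ im η}
      (ℝR.+-cong {im x} {α *ᴿ im ω} {im y} {β *ᴿ im η} xi yi))
    (ℝR.trans {im x +ᴿ im y} {im x′ +ᴿ im y′} {α′ *ᴿ im ω +ᴿ β′ *ᴿ im η} hi
      (ℝR.+-cong {im x′} {α′ *ᴿ im ω} {im y′} {β′ *ᴿ im η} xi′ yi′))
  α≈α′ : α ≈ᴿ α′
  α≈α′ = ≈-x-y {α} {α′} (ℝ-noZeroDivisors {factoredCross} {α -ᴿ α′}
    (λ h → cross≉0 (ℝR.trans {cross x y} {factoredCross} {0ᴿ} cross≈ h))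
    (CrossProduct.cross-vanishes ℝ-commutativeRing {α} {α′} {β} {β′} {re ω} {im ω} {re η}
      {im η} h₁ h₂))

-- The vector `q -ᶜ p` turned by a right angle.
normal : ℂ → ℂ → ℂ
normal p q = (-ᴿ (im q -ᴿ im p)) +i (re q -ᴿ re p)

_∙_ : ℂ → ℂ → ℝ
z ∙ w = re z *ᴿ re w +ᴿ im z *ᴿ im w

Collinear : ℂ → ℂ → ℂ → Set
Collinear p q r = normal p q ∙ r ≈ᴿ normal p q ∙ p

lineThrough : ∀ p q → ¬ p ≈ᶜ q → Line
lineThrough p q p≉q = record
  { a = re (normal p q) ; b = im (normal p q) ; c = normal p q ∙ p
  ; nondegenerate = λ (a≈0 , b≈0) → p≉q
      ( ℝR.sym {re q} {re p} (≈-x-y {re q} {re p} b≈0)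
      , ℝR.sym {im q} {im p} (≈-x-y {im q} {im p}
        (ℝR.trans {im q -ᴿ im p} { -ᴿ (-ᴿ (im q -ᴿ im p))} {0ᴿ}
          (pointwise {im q -ᴿ im p} { -ᴿ (-ᴿ (im q -ᴿ im p))} λ n →
            ≡.sym (neg-involutive (seq (im q) n ℚ.- seq (im p) n)))
          (ℝR.trans { -ᴿ (-ᴿ (im q -ᴿ im p))} { -ᴿ 0ᴿ} {0ᴿ}
            (ℝR.-‿cong { -ᴿ (im q -ᴿ im p)} {0ᴿ} a≈0) (pointwise { -ᴿ 0ᴿ} {0ᴿ} λ _ → ≡.refl)))) ) }

¬collinear⇒cross≉0 : ∀ {p q r} → ¬ Collinear p q r → ¬ cross (q -ᶜ p) (r -ᶜ q) ≈ᴿ 0ᴿ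
¬collinear⇒cross≉0 {p} {q} {r} off cross≈0 = off (≈-x-y {normal p q ∙ r} {normal p q ∙ p}
  (ℝR.trans {normal p q ∙ r -ᴿ normal p q ∙ p} {cross (q -ᶜ p) (r -ᶜ q)} {0ᴿ}
    (pointwise {normal p q ∙ r -ᴿ normal p q ∙ p} {cross (q -ᶜ p) (r -ᶜ q)} λ n →
      S.solve 6 (λ a b c d e f → (S.:- (d S.:- b) S.:* e S.:+ (c S.:- a) S.:* f)
        S.:- (S.:- (d S.:- b) S.:* a S.:+ (c S.:- a) S.:* b)
                 S.:= (c S.:- a) S.:* (f S.:- d) S.:- (d S.:- b) S.:* (e S.:- c)) ≡.refl
        (seq (re p) n) (seq (im p) n) (seq (re q) n) (seq (im q) n) (seq (re r) n) (seq (im r) n))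
    cross≈0))

-- A walk that returns to its start thus counts as collinear, and for every other walk the
-- difference `w -ᶜ v` is nonzero, as `fewPaths` requires.
collinear-closed : ∀ {p q r} → r -ᶜ p ≈ᶜ 0ᶜ → Collinear p q r
collinear-closed {p} {q} {r} (h , k) = ℝR.+-cong {re (normal p q) *ᴿ re r} {re (normal p q) *ᴿ re p}
  {im (normal p q) *ᴿ im r} {im (normal p q) *ᴿ im p}
  (ℝR.*-congˡ {re (normal p q)} {re r} {re p} (≈-x-y {re r} {re p} h))
  (ℝR.*-congˡ {im (normal p q)} {im r} {im p} (≈-x-y {im r} {im p} k))

difference-injective : ∀ {p q v} → p -ᶜ v ≈ᶜ q -ᶜ v → p ≈ᶜ q
difference-injective {p} {q} {v} (h , k) = cancel {re p} {re q} {re v} h , cancel {im p} {im q}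
  {im v} k
  where
  cancel : ∀ {x y z} → x -ᴿ z ≈ᴿ y -ᴿ z → x ≈ᴿ y
  cancel {x} {y} {z} = null-cong λ n →
    S.solve 3 (λ x y z → (x S.:- z) S.:- (y S.:- z) S.:= x S.:- y) ≡.refl (seq x n) (seq y n)
    (seq z n)

telescope : ∀ p q r → (q -ᶜ p) +ᶜ (r -ᶜ q) ≈ᶜ r -ᶜ p
telescope p q r = pointwiseᶜ {(q -ᶜ p) +ᶜ (r -ᶜ q)} {r -ᶜ p}
  (λ n → sum≡ (seq (re p) n) (seq (re q) n) (seq (re r) n))
  (λ n → sum≡ (seq (im p) n) (seq (im q) n) (seq (im r) n))
  where
  sum≡ : ∀ a b c → (b ℚ.- a) ℚ.+ (c ℚ.- b) ≡ c ℚ.- a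
  sum≡ = S.solve 3 (λ a b c → (b S.:- a) S.:+ (c S.:- b) S.:= c S.:- a) ≡.refl

leg-reverse : ∀ {p q} → Leg (p -ᶜ q) → Leg (q -ᶜ p)
leg-reverse {p} {q} X = leg-resp {ℂR.- (p -ᶜ q)} {q -ᶜ p}
  (pointwiseᶜ {ℂR.- (p -ᶜ q)} {q -ᶜ p} (λ n → swap≡ (seq (re p) n) (seq (re q) n))
    (λ n → swap≡ (seq (im p) n) (seq (im q) n))) (leg-neg {p -ᶜ q} X)
  where
  swap≡ : ∀ a b → ℚ.- (a ℚ.- b) ≡ b ℚ.- a
  swap≡ = S.solve 2 (λ a b → S.:- (a S.:- b) S.:= b S.:- a) ≡.refl

Detour : ℂ → ℂ → ℂ → Set
Detour v w p = Leg (p -ᶜ v) × Leg (w -ᶜ p) × ¬ Collinear v p w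

fewDetours : ∀ {k v w} (p : Fin k → ℂ) → (∀ i → Detour v w (p i)) → (∀ i j → p i ≈ᶜ p j → i ≡ j) →
  k ℕ.≤ 38
fewDetours {zero}  {v} {w} p detour distinct = ℕ.z≤n
fewDetours {suc k} {v} {w} p detour distinct = fewPaths {w -ᶜ v} {suc k}
  (λ w-v≈0 → proj₂ (proj₂ (detour Fin.zero)) (collinear-closed {v} {p Fin.zero} {w} w-v≈0)) path
    rigid
  (λ i j eq → distinct i j (difference-injective {p i} {p j} {v} eq))
  where
  first : ∀ i → Leg (p i -ᶜ v)
  first i = proj₁ (detour i)
  second : ∀ i → Leg (w -ᶜ p i)
  second i = proj₁ (proj₂ (detour i))
  path : ∀ i → Path (w -ᶜ v)
  path i = record { X = first i ; Y = second i ; x+y≈z = telescope v (p i) w }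
  rigid : ∀ i j → direction (first i) ≈ᶜ direction (first j) →
    direction (second i) ≈ᶜ direction (second j) → p i -ᶜ v ≈ᶜ p j -ᶜ v
  rigid i j ω≈ η≈ = scaled-rigid {p i -ᶜ v} {w -ᶜ p i} {p j -ᶜ v} {w -ᶜ p j}
    (scaled-resp {p i -ᶜ v} {re (coefficient (first i))} {direction (first i)}
      {direction (first j)} ω≈ (leg-scaled (first i)))
    (scaled-resp {w -ᶜ p i} {re (coefficient (second i))} {direction (second i)}
      {direction (second j)} η≈ (leg-scaled (second i)))
    (leg-scaled (first j)) (leg-scaled (second j))
    (ℂR.trans {(p i -ᶜ v) +ᶜ (w -ᶜ p i)} {w -ᶜ v} {(p j -ᶜ v) +ᶜ (w -ᶜ p j)} (telescope v (p i) w)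
      (ℂR.sym {(p j -ᶜ v) +ᶜ (w -ᶜ p j)} {w -ᶜ v} (telescope v (p j) w)))
    (¬collinear⇒cross≉0 {v} {p i} {w} (proj₂ (proj₂ (detour i))))

-- The graph of the listed pairs and its adjacency counts

⟦⟧-cong : ∀ {P Q : Set} (p : Dec P) (q : Dec Q) → (P → Q) → (Q → P) → ⟦ p ⟧ ≡ ⟦ q ⟧
⟦⟧-cong (yes _) (yes _) f g = ≡.refl
⟦⟧-cong (yes p) (no ¬q) f g = ⊥-elim (¬q (f p))
⟦⟧-cong (no ¬p) (yes q) f g = ⊥-elim (¬p (g q))
⟦⟧-cong (no _)  (no _)  f g = ≡.refl

⟦⟧-× : ∀ {P Q : Set} (p : Dec P) (q : Dec Q) → ⟦ p ⟧ ℕ.* ⟦ q ⟧ ≡ ⟦ p ×-dec q ⟧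
⟦⟧-× (yes _) (yes _) = ≡.refl
⟦⟧-× (yes _) (no _)  = ≡.refl
⟦⟧-× (no _)  (yes _) = ≡.refl
⟦⟧-× (no _)  (no _)  = ≡.refl

⟦⟧ᶜ-¬ : ∀ {P : Set} (p : Dec P) → ⟦ p ⟧ᶜ ≡ ⟦ ¬? p ⟧
⟦⟧ᶜ-¬ (yes _) = ≡.refl
⟦⟧ᶜ-¬ (no _)  = ≡.refl

⟦⟧-⊎ : ∀ {P Q : Set} (p : Dec P) (q : Dec Q) → ¬ (P × Q) → ⟦ p ⟧ ℕ.+ ⟦ q ⟧ ≤ ⟦ p ⊎-dec q ⟧
⟦⟧-⊎ (yes p) (yes q) h = ⊥-elim (h (p , q))
⟦⟧-⊎ (yes _) (no _)  h = ℕ.≤-refl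
⟦⟧-⊎ (no _)  (yes _) h = ℕ.≤-refl
⟦⟧-⊎ (no _)  (no _)  h = ℕ.≤-refl

term≤∑ : ∀ {n} (f : Fin n → ℕ) i → f i ≤ ∑ f
term≤∑ f Fin.zero    = ℕ.m≤m+n _ _
term≤∑ f (Fin.suc i) = ℕ.m≤n⇒m≤o+n (f Fin.zero) (term≤∑ (f ∘ Fin.suc) i)

lookup-injective : ∀ {A : Set} {xs : List A} → Unique xs → ∀ i j → lookup xs i ≡ lookup xs j → i ≡ j
lookup-injective (x∉ ∷ u) Fin.zero    Fin.zero    eq = ≡.refl
lookup-injective (x∉ ∷ u) Fin.zero    (Fin.suc j) eq = ⊥-elim (All.lookup x∉ (∈ₚ.∈-lookup j) eq)
lookup-injective (x∉ ∷ u) (Fin.suc i) Fin.zero eq = ⊥-elim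
  (All.lookup x∉ (∈ₚ.∈-lookup i) (≡.sym eq))
lookup-injective (x∉ ∷ u) (Fin.suc i) (Fin.suc j) eq = ≡.cong Fin.suc (lookup-injective u i j eq)

module EdgeList {n} (xs : List (Fin n × Fin n)) where
  _≟×_ : (x y : Fin n × Fin n) → Dec (x ≡ y)
  _≟×_ = ≡-dec Fin._≟_ Fin._≟_

  _∈?_ : (x : Fin n × Fin n) (ys : List (Fin n × Fin n)) → Dec (x ∈ ys)
  _∈?_ = DecMembership._∈?_ _≟×_

  -- Edges are the pairs listed in `xs`, so adjacency is decidable although `RationalPair` need not
  -- be.
  Adjacent : Fin n → Fin n → Set
  Adjacent i j = (i , j) ∈ xs ⊎ (j , i) ∈ xs

  adjacent? : ∀ i j → Dec (Adjacent i j)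
  adjacent? i j = ((i , j) ∈? xs) ⊎-dec ((j , i) ∈? xs)

  length≤∑ : ∀ ys → Unique ys → length ys ≤ ∑ (λ i → ∑ (λ j → ⟦ (i , j) ∈? ys ⟧))
  length≤∑ [] [] = ℕ.z≤n
  length≤∑ (y ∷ ys) (y∉ ∷ u) = begin
    suc (length ys)
      ≤⟨ ℕ.+-mono-≤ point (length≤∑ ys u) ⟩
    ∑ (λ i → ∑ (λ j → ⟦ (i , j) ≟× y ⟧)) ℕ.+ ∑ (λ i → ∑ (λ j → ⟦ (i , j) ∈? ys ⟧))
      ≡⟨ ∑-distrib-+ (λ i → ∑ (λ j → ⟦ (i , j) ≟× y ⟧)) (λ i → ∑ (λ j → ⟦ (i , j) ∈? ys ⟧)) ⟨
    ∑ (λ i → ∑ (λ j → ⟦ (i , j) ≟× y ⟧) ℕ.+ ∑ (λ j → ⟦ (i , j) ∈? ys ⟧))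
      ≡⟨ sum-cong-≋ (λ i → ∑-distrib-+ (λ j → ⟦ (i , j) ≟× y ⟧) (λ j → ⟦ (i , j) ∈? ys ⟧)) ⟨
    ∑ (λ i → ∑ (λ j → ⟦ (i , j) ≟× y ⟧ ℕ.+ ⟦ (i , j) ∈? ys ⟧))
      ≤⟨ sum-mono (λ i → sum-mono (λ j → cons i j)) ⟩
    ∑ (λ i → ∑ (λ j → ⟦ (i , j) ∈? (y ∷ ys) ⟧)) ∎
    where
    open ℕ.≤-Reasoning
    point : 1 ≤ ∑ (λ i → ∑ (λ j → ⟦ (i , j) ≟× y ⟧))
    point = ℕ.≤-trans (ℕ.≤-reflexive
      (⟦⟧-cong (yes ≡.refl) (y ≟× y) (λ _ → ≡.refl) (λ _ → ≡.refl {x = y})))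
      (ℕ.≤-trans (term≤∑ (λ j → ⟦ (proj₁ y , j) ≟× y ⟧) (proj₂ y))
        (term≤∑ (λ i → ∑ (λ j → ⟦ (i , j) ≟× y ⟧)) (proj₁ y)))
    cons : ∀ i j → ⟦ (i , j) ≟× y ⟧ ℕ.+ ⟦ (i , j) ∈? ys ⟧ ≤ ⟦ (i , j) ∈? (y ∷ ys) ⟧
    cons i j = ℕ.≤-trans (⟦⟧-⊎ ((i , j) ≟× y) ((i , j) ∈? ys) λ
      { (≡.refl , y∈) → All.lookup y∉ y∈ ≡.refl })
      (ℕ.≤-reflexive (⟦⟧-cong (((i , j) ≟× y) ⊎-dec ((i , j) ∈? ys)) ((i , j) ∈? (y ∷ ys))
        (λ { (inj₁ eq) → here eq ; (inj₂ y∈) → there y∈ })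
          (λ { (here eq) → inj₁ eq ; (there y∈) → inj₂ y∈ })))

  -- Listed pairs are increasing, so a pair and its reversal are never both listed, and each listed
  -- pair yields two distinct entries of the adjacency matrix.
  degrees : Unique xs → All (λ (i , j) → i Fin.< j) xs →
    2 ℕ.* length xs ≤ ∑ (λ i → ∑ (λ j → ⟦ adjacent? i j ⟧))
  degrees u ordered = begin
    length xs ℕ.+ (length xs ℕ.+ 0)
      ≡⟨ ≡.cong (length xs ℕ.+_) (ℕ.+-identityʳ (length xs)) ⟩
    length xs ℕ.+ length xs
      ≤⟨ ℕ.+-mono-≤ (length≤∑ xs u) (length≤∑ xs u) ⟩
    ∑ (λ i → ∑ (λ j → m i j)) ℕ.+ ∑ (λ i → ∑ (λ j → m i j))
      ≡⟨ ≡.cong (∑ (λ i → ∑ (λ j → m i j)) ℕ.+_) (∑-comm m) ⟩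
    ∑ (λ i → ∑ (λ j → m i j)) ℕ.+ ∑ (λ i → ∑ (λ j → m j i))
      ≡⟨ ∑-distrib-+ (λ i → ∑ (λ j → m i j)) (λ i → ∑ (λ j → m j i)) ⟨
    ∑ (λ i → ∑ (λ j → m i j) ℕ.+ ∑ (λ j → m j i))
      ≡⟨ sum-cong-≋ (λ i → ∑-distrib-+ (λ j → m i j) (λ j → m j i)) ⟨
    ∑ (λ i → ∑ (λ j → m i j ℕ.+ m j i))
      ≤⟨ sum-mono (λ i → sum-mono (λ j → ⟦⟧-⊎ ((i , j) ∈? xs) ((j , i) ∈? xs) λ (p , q) →
        Fin.<-asym (All.lookup ordered p) (All.lookup ordered q))) ⟩
    ∑ (λ i → ∑ (λ j → ⟦ adjacent? i j ⟧)) ∎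
    where
    open ℕ.≤-Reasoning
    m : Fin n → Fin n → ℕ
    m i j = ⟦ (i , j) ∈? xs ⟧

module Points {n} (S : Fin n → ℂ) (S-injective : Injective _≡_ _≈ᶜ_ S)
              (xs : List (Fin n × Fin n)) (pairs : All (RationalPair S) xs) where
  open EdgeList xs

  adjacent-leg : ∀ {i j} → Adjacent i j → Leg (S j -ᶜ S i)
  adjacent-leg {i} {j} (inj₁ ij∈) =
    let _ , d , a = All.lookup pairs ij∈ in pairLeg {S i} {S j} d a
  adjacent-leg {i} {j} (inj₂ ji∈) =
    let _ , d , a = All.lookup pairs ji∈ in leg-reverse {S i} {S j} (pairLeg {S j} {S i} d a)

  adjacent-distinct : ∀ {i j} → Adjacent i j → ¬ S i ≈ᶜ S j
  adjacent-distinct (inj₁ ij∈) eq = Fin.<⇒≢ (proj₁ (All.lookup pairs ij∈)) (S-injective eq)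
  adjacent-distinct (inj₂ ji∈) eq = Fin.<⇒≢ (proj₁ (All.lookup pairs ji∈)) (≡.sym (S-injective eq))

  OnLine : Fin n → Fin n → Fin n → Set
  OnLine v p w = Collinear (S v) (S p) (S w)

  offLine≤38 : (C? : ∀ v p w → Dec (OnLine v p w)) → ∀ v w →
    ∑ (λ p → ⟦ adjacent? v p ⟧ ℕ.* ⟦ adjacent? p w ⟧ ℕ.* ⟦ C? v p w ⟧ᶜ) ≤ 38
  offLine≤38 C? v w = ℕ.≤-trans
    (ℕ.≤-reflexive (sum-cong-≋ λ p →
      ≡.trans (≡.cong₂ ℕ._*_ (⟦⟧-× (adjacent? v p) (adjacent? p w)) (⟦⟧ᶜ-¬ (C? v p w)))
      (⟦⟧-× (adjacent? v p ×-dec adjacent? p w) (¬? (C? v p w)))))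
    (count≤ (λ p → (adjacent? v p ×-dec adjacent? p w) ×-dec ¬? (C? v p w)) λ ps u all →
      fewDetours {length ps} {S v} {S w} (λ i → S (lookup ps i))
        (λ i → let (vp , pw) , off = All.lookup all (∈ₚ.∈-lookup i)
              in adjacent-leg {v} {lookup ps i} vp , adjacent-leg {lookup ps i} {w} pw , off)
        (λ i j eq → lookup-injective u i j (S-injective eq)))

  -- The points counted lie on the line through `S v` and `S p`. That these differ is known only for
  -- adjacent indices, hence the factor `⟦ adjacent? v p ⟧` on both sides.
  onLine-count : ∀ {A E} → (∀ {k} → fromℕ k ≤ᴿ A → 4 ℕ.* n ℕ.* k ℕ.< E) →
    ((ℓ : Line) → AtMost A (λ i → S i ∈ᴸ ℓ)) →
    (C? : ∀ v p w → Dec (OnLine v p w)) → ∀ v p →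
      ⟦ adjacent? v p ⟧ ℕ.* (4 ℕ.* n ℕ.* ∑ (λ w → ⟦ adjacent? p w ⟧ ℕ.* ⟦ C? v p w ⟧)) ≤
      ⟦ adjacent? v p ⟧ ℕ.* E
  onLine-count {A} {E} bound lines C? v p = byAdjacency (adjacent? v p)
    where
    P? : ∀ w → Dec (Adjacent p w × OnLine v p w)
    P? w = adjacent? p w ×-dec C? v p w
    ws : List (Fin n)
    ws = filter P? (allFin n)
    count≡ : ∑ (λ w → ⟦ adjacent? p w ⟧ ℕ.* ⟦ C? v p w ⟧) ≡ length ws
    count≡ = ≡.trans (sum-cong-≋ λ w → ⟦⟧-× (adjacent? p w) (C? v p w)) (length-filter P? (λ w → w))
    byAdjacency : (d : Dec (Adjacent v p)) →
      ⟦ d ⟧ ℕ.* (4 ℕ.* n ℕ.* ∑ (λ w → ⟦ adjacent? p w ⟧ ℕ.* ⟦ C? v p w ⟧)) ≤ ⟦ d ⟧ ℕ.* E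
    byAdjacency (no _)    = ℕ.z≤n
    byAdjacency (yes adj) = ℕ.*-monoʳ-≤ 1 (ℕ.<⇒≤ (≡.subst (λ k → 4 ℕ.* n ℕ.* k ℕ.< E) (≡.sym count≡)
      (bound (lines (lineThrough (S v) (S p) (adjacent-distinct {v} {p} adj)) ws
        (Uniqueₚ.filter⁺ P? (Uniqueₚ.allFin⁺ n))
        (All.map proj₂ (Allₚ.all-filter P? (allFin n)))))))

realAxis : Line
realAxis = record
  { a = 0ᴿ ; b = 1ᴿ ; c = 0ᴿ
  ; nondegenerate = λ (_ , 1≈0) → ℚ.<-irrefl (≡.sym (fromℚ≈0 {1ℚ} 1≈0)) 0<1 }

theorem4 : (α : ℝ) → fromℚ ½ ≤ᴿ α → α ≤ᴿ 1ᴿ →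
    (n : ℕ) → 1 ≤ n →
    (S : Fin n → ℂ) → Injective _≡_ _≈ᶜ_ S →
    (n^α : ℝ) → IsPower n α n^α →
    ((ℓ : Line) → AtMost n^α (λ i → S i ∈ᴸ ℓ)) →
    (n^1+α : ℝ) → IsPower n (1ᴿ +ᴿ α) n^1+α →
    AtMost (fromℕ 4 *ᴿ n^1+α) (RationalPair S)
theorem4 α ½≤α _ n 1≤n S S-injective A isA lines B isB xs unique pairs 4B<E =
  -- The goal is now `⊥`, so collinearity may be decided for all triples of points at once.
  ¬¬-Fin (λ v → ¬¬-Fin λ p → ¬¬-Fin λ w → ¬¬-excluded-middle {A = OnLine v p w}) λ C? →
  fewWalks E (λ i j → ⟦ adjacent? i j ⟧) C?
    (λ i j → ⟦⟧-cong (adjacent? i j) (adjacent? j i) ⊎-swap ⊎-swap)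
    (onLine-count {A} {E} (lineBound {n} {A} {E} 1≤n 0≤A 4nA<E) lines C?)
    (offLine≤38 C?)
    (degrees unique (All.map proj₁ pairs))
    (manyEdges {n} {A} {E} 1≤n 0≤A 4nA<E (power-square {n} {α} {A} 1≤n ½≤α isA))
  where
  open EdgeList xs
  open Points S S-injective xs pairs
  E : ℕ
  E = length xs
  -- The incidence hypothesis, applied to the empty list of points on some line, bounds 0 by `A`.
  0≤A : 0ᴿ ≤ᴿ A
  0≤A = lines realAxis [] [] []
  4nA<E : fromℕ 4 *ᴿ (fromℕ n *ᴿ A) <ᴿ fromℕ E
  4nA<E = <ᴿ-cong {fromℕ 4 *ᴿ B} {fromℕ 4 *ᴿ (fromℕ n *ᴿ A)} {fromℕ E} {fromℕ E}
    (ℝR.*-congˡ {fromℕ 4} {B} {fromℕ n *ᴿ A} (power-1+ {n} {α} {A} {B} 1≤n isA isB))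
      (ℝR.refl {fromℕ E}) 4B<E
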